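{- Let $D$ be the derivation of $\mathbb{Q}[X,Y,Z]$ with $D(X)=YZ$, $D(Y)=XZ$, $D(Z)=XY$. Define $(XD)^0(X)=X$, $(XD)^{n+1}(X)=XD\big((XD)^n(X)\big)$; $(DX)^0(X)=X$, $(DX)^{n+1}(X)=D\big(X(DX)^n(X)\big)$; $(DX)^0(Y)=Y$, $(DX)^{n+1}(Y)=D\big(X(DX)^n(Y)\big)$; and integers $a_{n,i,j},c_{n,i,j},d_{n,i,j}$ by $$(XD)^{2n}(X)=\sum a_{2n,i,j}X^{2i+1}Y^{2j}Z^{4n-2i-2j},\quad (XD)^{2n+1}(X)=\sum a_{2n+1,i,j}X^{2i+1}Y^{2j+1}Z^{4n-2i-2j+1},$$ $$(DX)^{2n}(X)=\sum c_{2n,i,j}X^{2i+1}Y^{2j}Z^{4n-2i-2j},\quad (DX)^{2n+1}(X)=\sum c_{2n+1,i,j}X^{2i+1}Y^{2j+1}Z^{4n-2i-2j+1},$$ $$(DX)^{2n}(Y)=\sum d_{2n,i,j}X^{2i}Y^{2j+1}Z^{4n-2i-2j},\quad (DX)^{2n+1}(Y)=\sum d_{2n+1,i,j}X^{2i}Y^{2j}Z^{4n-2i-2j+3}$$ (sums over $i,j\ge0$). Then for $n\ge1$: (i) $\sum_{i,j\ge0}a_{n,i,j}=(2n-1)!!$; (ii) $\sum_{j\ge0}a_{n,i,j}=N(n,n-i)$; (iii) $\sum_{i\ge0}a_{n,i,\lfloor n/2\rfloor}x^i=\sum_{i\ge0}a_{n,i,\lfloor n/2\rfloor-i}x^i=\widetilde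 P_n(x)$; (iv) $\sum_{j\ge0}c_{n,i,j}=2^n\left\langle {n\atop i}\right\rangle$; (v) $\sum_{j\ge0}d_{n,i,j}=B(n,i)$; (vi) $\sum_{i\ge0}c_{n,i,\lfloor n/2\rfloor}x^i=\sum_{i\ge0}c_{n,i,\lfloor n/2\rfloor-i}x^i=P_{n+1}(x)$; (vii) $\sum_{i\ge0}c_{2n-1,i,0}x^{2n-2-i}=\sum_{i\ge0}c_{2n,i,0}x^{2n-1-i}=P_{2n}(x)$; (viii) $\sum_{i\ge0}d_{n,i,\lceil n/2\rceil}x^i=\widetilde P_n(x)$ and $\sum_{i\ge0}d_{n,i,\lceil n/2\rceil-i}x^i=\widetilde P_{n+1}(x)$; (ix) $\sum_{i\ge0}d_{2n,i,0}x^{2n-i}=\sum_{i\ge0}d_{2n+1,i,0}x^{2n+1-i}=\widetilde P_{2n+1}(x)$.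
   Context: $\mathfrak S_n$ is the symmetric group on $[n]=\{1,\dots,n\}$. An interior peak of $\pi\in\mathfrak S_n$ is an index $i\in\{2,\dots,n-1\}$ with $\pi(i-1)<\pi(i)>\pi(i+1)$; $P_{n,k}$ is the number of $\pi\in\mathfrak S_n$ with $k$ interior peaks and $P_n(x)=\sum_kP_{n,k}x^k$. A left peak is an index $i\in[n-1]$ with $\pi(i-1)<\pi(i)>\pi(i+1)$ where $\pi(0)=0$; $\widetilde P_{n,k}$ is the number of $\pi\in\mathfrak S_n$ with $k$ left peaks and $\widetilde P_n(x)=\sum_k\widetilde P_{n,k}x^k$. $\left\langle {n\atop k}\right\rangle$ is the Eulerian number, the number of $\pi\in\mathfrak S_n$ with exactly $k$ descents (positions $i$ with $\pi(i)>\pi(i+1)$). A signed permutation of $[n]$ is a bijection $\pi$ of $\{\pm1,\dots,\pm n\}$ with $\pi(-i)=-\pi(i)$; its type-$B$ descent number is $|\{i\in[n]:\pi(i-1)>\pi(i)\}|$ with $\pi(0)=0$; $B(n,k)$ is the number of signed permutations of $[n]$ with $k$ type-$B$ descents. $N(n,k)$ is the number of perfect matchings of $[2n]$ (partitions of $[2n]$ into blocks of size 2) in which exactly $k$ blocks have odd smaller element. -}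

module Defs where

open import Data.Nat as ℕ using (ℕ; zero; suc; _+_; _*_; _∸_; _/_; _%_; _≡ᵇ_; _<ᵇ_; _≤ᵇ_)
open import Data.Integer as ℤ using (ℤ; +_; -[1+_]; ∣_∣)
open import Data.Bool using (Bool; true; false; if_then_else_; _∧_; not)
open import Data.List using (List; []; _∷_; [_]; map; concatMap; upTo; length; _++_)
open import Data.Bool.ListAction using (any; all)

-- Polynomials in X, Y, Z as coefficient functions:
-- p a b c = coefficient of X^a Y^b Z^c.  (All polynomials occurring in the
-- theorem have natural-number coefficients.)

Poly : Set
Poly = ℕ → ℕ → ℕ → ℕ

varX : Poly
varX 1 0 0 = 1
varX _ _ _ = 0

varY : Poly
varY 0 1 0 = 1
varY _ _ _ = 0

mulX : Poly → Poly
mulX p zero    b c = 0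
mulX p (suc a) b c = p a b c

-- The derivation D = YZ ∂/∂X + XZ ∂/∂Y + XY ∂/∂Z, coefficientwise
-- (the unique derivation with D X = YZ, D Y = XZ, D Z = XY).
-- YZ ∂X : X^(a+1) Y^b Z^c  ↦  (a+1) X^a Y^(b+1) Z^(c+1)
dX : Poly → Poly
dX p a (suc b) (suc c) = suc a * p (suc a) b c
dX p _ _ _ = 0
-- XZ ∂Y : X^a Y^(b+1) Z^c  ↦  (b+1) X^(a+1) Y^b Z^(c+1)
dY : Poly → Poly
dY p (suc a) b (suc c) = suc b * p a (suc b) c
dY p _ _ _ = 0
-- XY ∂Z : X^a Y^b Z^(c+1)  ↦  (c+1) X^(a+1) Y^(b+1) Z^c
dZ : Poly → Poly
dZ p (suc a) (suc b) c = suc c * p a b (suc c)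
dZ p _ _ _ = 0

D : Poly → Poly
D p a b c = dX p a b c + dY p a b c + dZ p a b c

XDpow : ℕ → Poly
XDpow zero    = varX
XDpow (suc n) = mulX (D (XDpow n))

DXpow : ℕ → Poly → Poly
DXpow zero    q = q
DXpow (suc n) q = D (mulX (DXpow n q))

coeffZ : Poly → ℕ → ℕ → ℤ → ℕ
coeffZ p a b (+ c)     = p a b c
coeffZ p a b -[1+ _ ]  = 0

atZ : (ℕ → ℕ) → ℤ → ℕ
atZ f (+ k)     = f k
atZ f -[1+ _ ]  = 0

isEven : ℕ → Bool
isEven n = n % 2 ≡ᵇ 0

zexp : ℕ → ℕ → ℕ → ℕ → ℤ
zexp m i j off = (+ (4 * m + off)) ℤ.- (+ (2 * i + 2 * j))

aCoef : ℕ → ℕ → ℕ → ℕ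
aCoef n i j = if isEven n
  then coeffZ (XDpow n) (2 * i + 1) (2 * j)     (zexp (n / 2) i j 0)
  else coeffZ (XDpow n) (2 * i + 1) (2 * j + 1) (zexp (n / 2) i j 1)

cCoef : ℕ → ℕ → ℕ → ℕ
cCoef n i j = if isEven n
  then coeffZ (DXpow n varX) (2 * i + 1) (2 * j)     (zexp (n / 2) i j 0)
  else coeffZ (DXpow n varX) (2 * i + 1) (2 * j + 1) (zexp (n / 2) i j 1)

dCoef : ℕ → ℕ → ℕ → ℕ
dCoef n i j = if isEven n
  then coeffZ (DXpow n varY) (2 * i) (2 * j + 1) (zexp (n / 2) i j 0)
  else coeffZ (DXpow n varY) (2 * i) (2 * j)     (zexp (n / 2) i j 3)

-- Finite sums  Σ_{k=0}^{N-1} f k.  All coefficient families above vanish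
-- for indices i or j > n (negative Z-exponent), so summing over
-- 0 ≤ i, j ≤ n is the same as summing over all i, j ≥ 0.

sumTo : ℕ → (ℕ → ℕ) → ℕ
sumTo zero    f = 0
sumTo (suc N) f = sumTo N f + f N

count : {A : Set} → (A → Bool) → List A → ℕ
count p []       = 0
count p (x ∷ xs) = (if p x then 1 else 0) + count p xs

words : {A : Set} → ℕ → List A → List (List A)
words zero    xs = [ [] ]
words (suc k) xs = concatMap (λ x → map (x ∷_) (words k xs)) xs

distinct : List ℕ → Bool
distinct []       = true
distinct (x ∷ xs) = not (any (x ≡ᵇ_) xs) ∧ distinct xs

range : ℕ → List ℕ
range n = map suc (upTo n)

perms : ℕ → List (List ℕ)
perms n = filterB (words n (range n))
  where
  filterB : List (List ℕ) → List (List ℕ)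
  filterB [] = []
  filterB (w ∷ ws) = if distinct w then w ∷ filterB ws else filterB ws

peaks : List ℕ → ℕ
peaks (x ∷ rest@(y ∷ z ∷ _)) = (if (x <ᵇ y) ∧ (z <ᵇ y) then 1 else 0) + peaks rest
peaks _ = 0

ipk : List ℕ → ℕ
ipk w = peaks w

-- left peaks (π(0) = 0)
lpk : List ℕ → ℕ
lpk w = peaks (0 ∷ w)

des : List ℕ → ℕ
des (x ∷ rest@(y ∷ _)) = (if y <ᵇ x then 1 else 0) + des rest
des _ = 0

Pnk : ℕ → ℕ → ℕ
Pnk n k = count (λ w → ipk w ≡ᵇ k) (perms n)

Ptnk : ℕ → ℕ → ℕ
Ptnk n k = count (λ w → lpk w ≡ᵇ k) (perms n)

eulerian : ℕ → ℕ → ℕ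
eulerian n k = count (λ w → des w ≡ᵇ k) (perms n)

signedPerms : ℕ → List (List ℤ)
signedPerms n = filterB (words n (map +_ (range n) ++ map ℤ.-_ (map +_ (range n))))
  where
  filterB : List (List ℤ) → List (List ℤ)
  filterB [] = []
  filterB (w ∷ ws) = if distinct (map ∣_∣ w) then w ∷ filterB ws else filterB ws

_<ℤᵇ_ : ℤ → ℤ → Bool
x <ℤᵇ y = not (y ℤ.≤ᵇ x)

desℤ : List ℤ → ℕ
desℤ (x ∷ rest@(y ∷ _)) = (if y <ℤᵇ x then 1 else 0) + desℤ rest
desℤ _ = 0

-- type-B descents: i ∈ [n] with π(i-1) > π(i), π(0) = 0
desB : List ℤ → ℕ
desB w = desℤ (+ 0 ∷ w)

Bnk : ℕ → ℕ → ℕ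
Bnk n k = count (λ w → desB w ≡ᵇ k) (signedPerms n)

-- 1-indexed lookup (0 if out of range)
at : List ℕ → ℕ → ℕ
at []       _             = 0
at (x ∷ xs) zero          = 0
at (x ∷ xs) (suc zero)    = x
at (x ∷ xs) (suc (suc i)) = at xs (suc i)

-- perfect matchings of [2n] as fixed-point-free involutions f of [2n]
-- (block {i, f i}), written in one-line notation
isFPFInv : ℕ → List ℕ → Bool
isFPFInv m w = all (λ i → (at w (at w i) ≡ᵇ i) ∧ not (at w i ≡ᵇ i)) (range m)

matchings : ℕ → List (List ℕ)
matchings n = filterB (words (2 * n) (range (2 * n)))
  where
  filterB : List (List ℕ) → List (List ℕ)
  filterB [] = []
  filterB (w ∷ ws) = if isFPFInv (2 * n) w then w ∷ filterB ws else filterB ws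

oddBlocks : ℕ → List ℕ → ℕ
oddBlocks m w = count (λ i → (i <ᵇ at w i) ∧ not (isEven i)) (range m)

Nnk : ℕ → ℕ → ℕ
Nnk n k = count (λ w → oddBlocks (2 * n) w ≡ᵇ k) (matchings n)

_‼ : ℕ → ℕ
zero ‼          = 1
suc zero ‼      = 1
suc (suc m) ‼   = suc (suc m) * m ‼

half : ℕ → ℕ
half n = n / 2

halfUp : ℕ → ℕ
halfUp n = (n + 1) / 2

{-# OPTIONS --safe #-}
module Submission where

-- On coefficients, X D and D X send the coefficient at X^a Y^b Z^c to a weighted sum of three
-- neighbours. Summing over b + c, or restricting to the largest exponent of Y or of Z, turns
-- this into a two-term recurrence C(n+1, k) = α(k) C(n, k) + β(n, k-1) C(n, k-1). The numbers of
-- (signed) permutations by descents or peaks obey the same recurrences by insertion of the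
-- largest letter, and the matchings do by adjoining the elements 2n+1 and 2n+2.
--
-- The smallest exponent of Y satisfies no such recurrence by itself. For (vii) and (ix) put
-- φ = X (Y + Z) and θ = X² + Y Z: then X D (φ) = φ θ and X D (θ) = φ², which is how peaks grow
-- under insertion, so (X D)^n (φ) = Σ_w φ^(2p+1) θ^(n-2p) over permutations w of [n] with p left
-- peaks, and (X D)^n (θ) = Σ_w φ^(2p+2) θ^(n-1-2p) with p interior peaks. Since
-- (X D)^n (X q) = X (D X)^n (q), the claims follow by setting Y = 0; there Y X and X Z,
-- respectively X² and Y Z, are told apart by the parity of the exponent of Y.

open import Defs
open import Data.Bool using (Bool; true; false; if_then_else_; T; not; _∧_; _xor_; T?)
open import Data.Bool.ListAction using (any)
open import Data.Bool.Properties using (T-≡; T-∧; ∧-identityʳ; ∧-zeroʳ; ¬-not; not-¬; not-injective; not-involutive; not-distribˡ-xor)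
open import Data.Empty using (⊥-elim)
open import Data.Integer using (ℤ; -[1+_]; ∣_∣)
import Data.Integer as ℤ
import Data.Integer.Properties as ℤ
open import Data.List using (List; []; _∷_; [_]; _++_; applyUpTo; concatMap; filter; filterᵇ; length; map; upTo)
open import Data.List.Membership.Propositional using (_∈_; _∉_; find; lose)
open import Data.List.Membership.Propositional.Properties
open import Data.List.Membership.Propositional.Properties.WithK using (unique∧set⇒bag)
open import Data.List.Properties using (filter-accept; filter-all; filter-reject; length-applyUpTo; map-++; map-id; upTo-∷ʳ)
open import Data.List.Relation.Binary.BagAndSetEquality using (∼bag⇒↭)
open import Data.List.Relation.Binary.Permutation.Propositional using (_↭_)
open import Data.List.Relation.Binary.Permutation.Propositional.Properties using (map⁺)
open import Data.List.Relation.Unary.All as All using (All; []; _∷_)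
import Data.List.Relation.Unary.All.Properties as All
open import Data.List.Relation.Unary.AllPairs as AllPairs using (AllPairs; []; _∷_)
import Data.List.Relation.Unary.AllPairs.Properties as AllPairs
open import Data.List.Relation.Unary.Any using (here; there; any?)
open import Data.List.Relation.Unary.Unique.Propositional using (Unique)
import Data.List.Relation.Unary.Unique.Propositional.Properties as Unique
open import Data.Nat using (ℕ; zero; suc; _+_; _*_; _∸_; _^_; _⊔_; _≤_; _<_; z≤n; s≤s; _≡ᵇ_; _<ᵇ_; _≤ᵇ_; _/_; _%_)
open import Data.Nat.DivMod using ([m+kn]%n≡m%n; m*n/n≡m; +-distrib-/-∣ʳ)
open import Data.Nat.Divisibility using (n∣m*n)
open import Data.Nat.ListAction using (sum)
open import Data.Nat.ListAction.Properties using (sum-++; sum-↭)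
open import Data.Nat.Properties
open import Data.Nat.Tactic.RingSolver using (solve-∀)
open import Data.Product using (_×_; _,_; ∃; ∃₂; proj₁; proj₂)
open import Data.Sum using (_⊎_; inj₁; inj₂)
open import Function using (_∘_; id; mk⇔; _⇔_; Equivalence)
open import Relation.Binary.Definitions using (tri<; tri≈; tri>)
open import Relation.Binary.PropositionalEquality hiding ([_])
open import Relation.Nullary using (¬_; Dec; yes; no; ¬?; contradiction)

-- A step of X D + ε Y Z raises the degree by two and the exponent of X by 0 or 2, so n and the
-- exponents of X and Y locate a coefficient; a, c and d become one family with start X^s Y^t and
-- shift ε. The weights are exponents: α is the exponent of X plus ε, because Y Z ∂X followed by X
-- restores that exponent, and β is the exponent left to Y and Z together, or to one of them. Two
-- obstacles shape the rest. The statistic in (ii) runs backwards: i counts the blocks whose larger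
-- element is odd, since each of the n odd elements of [2n] is the smaller or the larger one of its
-- block. In (vii) and (ix) the two sums belong to consecutive n: a monomial free of Y arises only
-- through X Z ∂Y from one with Y^1, with factor 1. The insertion steps are stated for an arbitrary
-- function f of the statistic. For f = `δ k` they give the recurrences of the numbers; for f a
-- coefficient of φ^r θ^s they match X D term by term.

private variable
  X Y : Set

-- Differences with default 0, antidiagonal sums, finite sums.

-- f (A − B), read as 0 when A < B.
atDiff : (ℕ → ℕ) → ℕ → ℕ → ℕ
atDiff f A       zero    = f A
atDiff f zero    (suc B) = 0
atDiff f (suc A) (suc B) = atDiff f A B

shift : (ℕ → ℕ) → ℕ → ℕ
shift f zero    = 0
shift f (suc n) = f n

atDiff-cong : ∀ {f g} A B → (∀ k → k + B ≡ A → f k ≡ g k) → atDiff f A B ≡ atDiff g A B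
atDiff-cong A       zero    f≡g = f≡g A (+-identityʳ A)
atDiff-cong zero    (suc B) f≡g = refl
atDiff-cong (suc A) (suc B) f≡g = atDiff-cong A B λ k eq → f≡g k (trans (+-suc k B) (cong suc eq))

atDiff-≤ : ∀ f A B k → k + B ≡ A → atDiff f A B ≡ f k
atDiff-≤ f A       zero    k eq = cong f (trans (sym eq) (+-identityʳ k))
atDiff-≤ f zero    (suc B) k eq with () ← trans (sym (+-suc k B)) eq
atDiff-≤ f (suc A) (suc B) k eq = atDiff-≤ f A B k (suc-injective (trans (sym (+-suc k B)) eq))

atDiff-> : ∀ f {A B} → A < B → atDiff f A B ≡ 0
atDiff-> f {zero}  (s≤s _)   = refl
atDiff-> f {suc A} (s≤s A<B) = atDiff-> f A<B

atDiff-0 : ∀ A B → atDiff (λ _ → 0) A B ≡ 0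
atDiff-0 A       zero    = refl
atDiff-0 zero    (suc B) = refl
atDiff-0 (suc A) (suc B) = atDiff-0 A B

atDiff-+ : ∀ f g A B → atDiff (λ k → f k + g k) A B ≡ atDiff f A B + atDiff g A B
atDiff-+ f g A       zero    = refl
atDiff-+ f g zero    (suc B) = refl
atDiff-+ f g (suc A) (suc B) = atDiff-+ f g A B

atDiff-* : ∀ c f A B → atDiff (λ k → c * f k) A B ≡ c * atDiff f A B
atDiff-* c f A       zero    = refl
atDiff-* c f zero    (suc B) = sym (*-zeroʳ c)
atDiff-* c f (suc A) (suc B) = atDiff-* c f A B

-- For A < B both sides vanish, the left by the default of `atDiff` and the right by truncation, so
-- the weight comes out without a side condition. This is how the factor of a derivative becomes the
-- β of a recurrence.
atDiff-id* : ∀ f A B → atDiff (λ k → k * f k) A B ≡ (A ∸ B) * atDiff f A B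
atDiff-id* f A       zero    = refl
atDiff-id* f zero    (suc B) = refl
atDiff-id* f (suc A) (suc B) = atDiff-id* f A B

atDiff-shift : ∀ f A B → atDiff (shift f) A B ≡ atDiff f A (suc B)
atDiff-shift f zero    zero    = refl
atDiff-shift f (suc A) zero    = refl
atDiff-shift f zero    (suc B) = refl
atDiff-shift f (suc A) (suc B) = atDiff-shift f A B

-- The sides can differ only for B = A + 1, where the left is the default 0 and the right reads
-- `f 0`; hence the hypothesis.
atDiff-suc : ∀ f → f 0 ≡ 0 → ∀ A B → atDiff (f ∘ suc) A B ≡ atDiff f (suc A) B
atDiff-suc f f0 A       zero    = refl
atDiff-suc f f0 zero    (suc zero)    = sym f0
atDiff-suc f f0 zero    (suc (suc B)) = refl
atDiff-suc f f0 (suc A) (suc B) = atDiff-suc f f0 A B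

-- The coefficient of T^N after both Y and Z are set to T.
diagSum : (ℕ → ℕ → ℕ) → ℕ → ℕ
diagSum f zero    = f 0 0
diagSum f (suc N) = f 0 (suc N) + diagSum (λ b c → f (suc b) c) N

diagSum-cong : ∀ {f g} N → (∀ b c → b + c ≡ N → f b c ≡ g b c) → diagSum f N ≡ diagSum g N
diagSum-cong zero    f≡g = f≡g 0 0 refl
diagSum-cong (suc N) f≡g = cong₂ _+_ (f≡g 0 (suc N) refl)
  (diagSum-cong N λ b c eq → f≡g (suc b) c (cong suc eq))

diagSum-0 : ∀ {f} → (∀ b c → f b c ≡ 0) → ∀ N → diagSum f N ≡ 0
diagSum-0 f≡0 zero    = f≡0 0 0
diagSum-0 f≡0 (suc N) = cong₂ _+_ (f≡0 0 (suc N)) (diagSum-0 (λ b c → f≡0 (suc b) c) N)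

+-swap : ∀ a b c d → (a + b) + (c + d) ≡ (a + c) + (b + d)
+-swap = solve-∀

diagSum-+ : ∀ f g N → diagSum (λ b c → f b c + g b c) N ≡ diagSum f N + diagSum g N
diagSum-+ f g zero    = refl
diagSum-+ f g (suc N) = trans (cong (f 0 (suc N) + g 0 (suc N) +_) (diagSum-+ _ _ N))
  (+-swap (f 0 (suc N)) (g 0 (suc N)) _ _)

diagSum-* : ∀ k f N → diagSum (λ b c → k * f b c) N ≡ k * diagSum f N
diagSum-* k f zero    = refl
diagSum-* k f (suc N) = trans (cong (k * f 0 (suc N) +_) (diagSum-* k _ N)) (sym (*-distribˡ-+ k _ _))

diagSum-last : ∀ f N → diagSum f (suc N) ≡ diagSum (λ b c → f b (suc c)) N + f (suc N) 0
diagSum-last f zero    = refl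
diagSum-last f (suc N) = trans (cong (f 0 (suc (suc N)) +_) (diagSum-last (λ b c → f (suc b) c) N))
  (sym (+-assoc (f 0 (suc (suc N))) _ _))

diagSum-weight : ∀ f N → diagSum (λ b c → (b + c) * f b c) N ≡ N * diagSum f N
diagSum-weight f N = trans (diagSum-cong N λ b c b+c≡N → cong (_* f b c) b+c≡N) (diagSum-* N f N)

shift₂ : (ℕ → ℕ → ℕ) → ℕ → ℕ → ℕ
shift₂ f b c = shift (λ b′ → shift (f b′) c) b

diagSum-shift₂ : ∀ f N → diagSum (shift₂ f) N ≡ shift (shift (diagSum f)) N
diagSum-shift₂ f zero          = refl
diagSum-shift₂ f (suc zero)    = refl
diagSum-shift₂ f (suc (suc N)) = trans (diagSum-last (λ b c → shift (f b) c) N) (+-identityʳ _)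

sumTo-cong : ∀ N {f g} → (∀ k → f k ≡ g k) → sumTo N f ≡ sumTo N g
sumTo-cong zero    f≡g = refl
sumTo-cong (suc N) f≡g = cong₂ _+_ (sumTo-cong N f≡g) (f≡g N)

sumTo-0 : ∀ N {f} → (∀ k → f k ≡ 0) → sumTo N f ≡ 0
sumTo-0 zero    f≡0 = refl
sumTo-0 (suc N) f≡0 = cong₂ _+_ (sumTo-0 N f≡0) (f≡0 N)

sumTo-first : ∀ N f → sumTo (suc N) f ≡ f 0 + sumTo N (f ∘ suc)
sumTo-first zero    f = sym (+-identityʳ (f 0))
sumTo-first (suc N) f = trans (cong (_+ f (suc N)) (sumTo-first N f)) (+-assoc (f 0) _ _)

sumTo-+ : ∀ N f g → sumTo N (λ k → f k + g k) ≡ sumTo N f + sumTo N g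
sumTo-+ zero    f g = refl
sumTo-+ (suc N) f g = trans (cong (_+ (f N + g N)) (sumTo-+ N f g)) (+-swap (sumTo N f) _ _ _)

sumTo-* : ∀ N c f → sumTo N (λ k → c * f k) ≡ c * sumTo N f
sumTo-* zero    c f = sym (*-zeroʳ c)
sumTo-* (suc N) c f = trans (cong (_+ c * f N) (sumTo-* N c f)) (sym (*-distribˡ-+ c _ _))

diagSum-sumTo : ∀ f N M → N < M → diagSum f N ≡ sumTo M (λ b → atDiff (f b) N b)
diagSum-sumTo f N (suc M) N<M = trans (go N N<M) (sym (sumTo-first M _))
  where
  go : ∀ N → N < suc M → diagSum f N ≡ f 0 N + sumTo M (λ b → atDiff (f (suc b)) N (suc b))
  go zero    _           = sym (trans (cong (f 0 0 +_) (sumTo-0 M λ _ → refl)) (+-identityʳ _))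
  go (suc N) (s≤s N<M)   = cong (f 0 (suc N) +_) (diagSum-sumTo (λ b c → f (suc b) c) N M N<M)

-- Connects two records of a homogeneous coefficient: by the sum of the exponents of Y and Z, or by
-- a free exponent of Y with that of Z as a difference. Summands with b beyond the degree are the
-- default 0, so any bound above A will do.
atDiff-diagSum : ∀ f A B M → A < M →
  atDiff (diagSum f) A B ≡ sumTo M (λ b → atDiff (f b) A (B + b))
atDiff-diagSum f A       zero    M A<M = diagSum-sumTo f A M A<M
atDiff-diagSum f zero    (suc B) M A<M = sym (sumTo-0 M λ _ → refl)
atDiff-diagSum f (suc A) (suc B) M A<M = atDiff-diagSum f A B M (<-trans (n<1+n A) A<M)

-- Coefficients of (X D + ε Y Z) p; ε = 0 gives X D and ε = 1 gives D X.
raise : Poly → Poly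
raise p (suc (suc a)) b c = suc b * shift (p a (suc b)) c + suc c * shift (λ b′ → p a b′ (suc c)) b
raise p _             b c = 0

step : ℕ → Poly → Poly
step ε p a b c = (a + ε) * shift₂ (p a) b c + raise p a b c

XD-step : ∀ p a b c → mulX (D p) a b c ≡ step 0 p a b c
XD-step p zero          b       c       = refl
XD-step p (suc zero)    zero    c       = refl
XD-step p (suc zero)    (suc b) zero    = refl
XD-step p (suc zero)    (suc b) (suc c) = +-identityʳ _
XD-step p (suc (suc a)) zero    zero    = eq a
  where
  eq : ∀ a → 0 ≡ suc (suc (a + 0)) * 0 + (1 * 0 + 1 * 0)
  eq = solve-∀
XD-step p (suc (suc a)) zero    (suc c) = eq a c (p a 1 c)
  where
  eq : ∀ a c x → (1 * x) + 0 ≡ suc (suc (a + 0)) * 0 + (1 * x + suc (suc c) * 0)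
  eq = solve-∀
XD-step p (suc (suc a)) (suc b) zero    = eq a b (p a b 1)
  where
  eq : ∀ a b x → 1 * x ≡ suc (suc (a + 0)) * 0 + (suc (suc b) * 0 + 1 * x)
  eq = solve-∀
XD-step p (suc (suc a)) (suc b) (suc c) = eq a b c (p (suc (suc a)) b c) (p a (suc (suc b)) c) (p a b (suc (suc c)))
  where
  eq : ∀ a b c x y z → suc (suc a) * x + suc (suc b) * y + suc (suc c) * z
                     ≡ suc (suc (a + 0)) * x + (suc (suc b) * y + suc (suc c) * z)
  eq = solve-∀

DX-step : ∀ p a b c → D (mulX p) a b c ≡ step 1 p a b c
DX-step p zero          zero    c       = refl
DX-step p zero          (suc b) zero    = refl
DX-step p zero          (suc b) (suc c) = +-identityʳ _
DX-step p (suc zero)    zero    zero    = refl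
DX-step p (suc zero)    zero    (suc c) = refl
DX-step p (suc zero)    (suc b) zero    = refl
DX-step p (suc zero)    (suc b) (suc c) = eq b c (p 1 b c)
  where
  eq : ∀ b c x → 2 * x + suc (suc b) * 0 + suc (suc c) * 0 ≡ 2 * x + 0
  eq = solve-∀
DX-step p (suc (suc a)) zero    zero    = eq a
  where
  eq : ∀ a → 0 ≡ suc (suc (a + 1)) * 0 + (1 * 0 + 1 * 0)
  eq = solve-∀
DX-step p (suc (suc a)) zero    (suc c) = eq a c (p a 1 c)
  where
  eq : ∀ a c x → (1 * x) + 0 ≡ suc (suc (a + 1)) * 0 + (1 * x + suc (suc c) * 0)
  eq = solve-∀
DX-step p (suc (suc a)) (suc b) zero    = eq a b (p a b 1)
  where
  eq : ∀ a b x → 1 * x ≡ suc (suc (a + 1)) * 0 + (suc (suc b) * 0 + 1 * x)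
  eq = solve-∀
DX-step p (suc (suc a)) (suc b) (suc c) = eq a b c (p (suc (suc a)) b c) (p a (suc (suc b)) c) (p a b (suc (suc c)))
  where
  eq : ∀ a b c x y z → suc (suc (suc a)) * x + suc (suc b) * y + suc (suc c) * z
                     ≡ suc (suc (a + 1)) * x + (suc (suc b) * y + suc (suc c) * z)
  eq = solve-∀

-- Coefficient recurrences

triangle : (ℕ → ℕ) → (ℕ → ℕ → ℕ) → ℕ → ℕ → ℕ
triangle α β zero    zero    = 1
triangle α β zero    (suc k) = 0
triangle α β (suc n) zero    = α 0 * triangle α β n 0
triangle α β (suc n) (suc k) = α (suc k) * triangle α β n (suc k) + β n k * triangle α β n k

-- Two families with the same weights agree through `≡-triangle`, so polynomial coefficients and
-- permutation counts are compared without a bijection between monomials and permutations.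
record IsTriangle (α : ℕ → ℕ) (β : ℕ → ℕ → ℕ) (C : ℕ → ℕ → ℕ) : Set where
  field
    base-zero : C 0 0 ≡ 1
    base-suc  : ∀ k → C 0 (suc k) ≡ 0
    step-zero : ∀ n → C (suc n) 0 ≡ α 0 * C n 0
    step-suc  : ∀ n k → C (suc n) (suc k) ≡ α (suc k) * C n (suc k) + β n k * C n k

  ≡-triangle : ∀ n k → C n k ≡ triangle α β n k
  ≡-triangle zero    zero    = base-zero
  ≡-triangle zero    (suc k) = base-suc k
  ≡-triangle (suc n) zero    = trans (step-zero n) (cong (α 0 *_) (≡-triangle n 0))
  ≡-triangle (suc n) (suc k) = trans (step-suc n k)
    (cong₂ _+_ (cong (α (suc k) *_) (≡-triangle n (suc k))) (cong (β n k *_) (≡-triangle n k)))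

double : ℕ → ℕ
double zero    = 0
double (suc n) = suc (suc (double n))

double≡2* : ∀ n → double n ≡ 2 * n
double≡2* zero    = refl
double≡2* (suc n) = trans (cong (suc ∘ suc) (double≡2* n)) (sym (*-suc 2 n))

raise-low : ∀ {p s} → s < 2 → ∀ b c → raise p s b c ≡ 0
raise-low {s = zero}        _ b c = refl
raise-low {s = suc zero}    _ b c = refl
raise-low {s = suc (suc s)} (s≤s (s≤s ())) b c

-- X² Z ∂Y and X² Y ∂Z both preserve b + c and weigh Y^b Z^c by b and by c. With Y and Z identified
-- the weight is b + c = N.
diagSum-raise : ∀ p a N → diagSum (raise p (suc (suc a))) N ≡ N * diagSum (p a) N
diagSum-raise p a N = begin
  diagSum (raise p (suc (suc a))) N
    ≡⟨ diagSum-+ _ _ N ⟩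
  diagSum (λ b c → suc b * shift (p a (suc b)) c) N + diagSum (λ b c → suc c * shift (λ b′ → p a b′ (suc c)) b) N
    ≡⟨ cong₂ _+_ (yPart N) (zPart N) ⟩
  diagSum (λ b c → b * p a b c) N + diagSum (λ b c → c * p a b c) N
    ≡⟨ sym (diagSum-+ _ _ N) ⟩
  diagSum (λ b c → b * p a b c + c * p a b c) N
    ≡⟨ diagSum-cong N (λ b c _ → sym (*-distribʳ-+ (p a b c) b c)) ⟩
  diagSum (λ b c → (b + c) * p a b c) N
    ≡⟨ diagSum-weight (p a) N ⟩
  N * diagSum (p a) N ∎
  where
  open ≡-Reasoning
  yPart : ∀ N → diagSum (λ b c → suc b * shift (p a (suc b)) c) N ≡ diagSum (λ b c → b * p a b c) N
  yPart zero    = refl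
  yPart (suc N) = trans (diagSum-last (λ b c → suc b * shift (p a (suc b)) c) N)
    (trans (cong (diagSum (λ b c → suc b * p a (suc b) c) N +_) (*-zeroʳ (suc (suc N)))) (+-identityʳ _))
  zPart : ∀ N → diagSum (λ b c → suc c * shift (λ b′ → p a b′ (suc c)) b) N ≡ diagSum (λ b c → c * p a b c) N
  zPart zero    = refl
  zPart (suc N) = trans (cong (_+ diagSum (λ b c → suc c * p a b (suc c)) N) (*-zeroʳ (suc (suc N))))
    (trans (sym (+-identityʳ _)) (sym (diagSum-last (λ b c → c * p a b c) N)))

δ : ℕ → ℕ → ℕ
δ k x = if x ≡ᵇ k then 1 else 0

mono : ℕ → ℕ → ℕ → Poly
mono r s t a b c = δ r a * (δ s b * δ t c)

δ-refl : ∀ k → δ k k ≡ 1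
δ-refl zero    = refl
δ-refl (suc k) = δ-refl k

δ-≢ : ∀ {k x} → x ≢ k → δ k x ≡ 0
δ-≢ {zero}  {zero}  x≢k = ⊥-elim (x≢k refl)
δ-≢ {zero}  {suc x} x≢k = refl
δ-≢ {suc k} {zero}  x≢k = refl
δ-≢ {suc k} {suc x} x≢k = δ-≢ (x≢k ∘ cong suc)

mono-≢ : ∀ {r s t} a b c → a ≢ r ⊎ b ≢ s ⊎ c ≢ t → mono r s t a b c ≡ 0
mono-≢ {r} {s} {t} a b c (inj₁ a≢r)        = cong (_* (δ s b * δ t c)) (δ-≢ a≢r)
mono-≢ {r} {s} {t} a b c (inj₂ (inj₁ b≢s)) = trans (cong (λ z → δ r a * (z * δ t c)) (δ-≢ b≢s)) (*-zeroʳ (δ r a))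
mono-≢ {r} {s} {t} a b c (inj₂ (inj₂ c≢t)) = trans (cong (λ z → δ r a * (δ s b * z)) (δ-≢ c≢t))
  (trans (cong (δ r a *_) (*-zeroʳ (δ s b))) (*-zeroʳ (δ r a)))

mono-refl : ∀ r s t → mono r s t r s t ≡ 1
mono-refl r s t rewrite δ-refl r | δ-refl s | δ-refl t = refl

parity : ℕ → Bool
parity zero    = false
parity (suc n) = not (parity n)

double≡+ : ∀ n → double n ≡ n + n
double≡+ zero    = refl
double≡+ (suc n) = cong suc (trans (cong suc (double≡+ n)) (sym (+-suc n n)))

parity-double : ∀ h π → parity (double h + π) ≡ parity π
parity-double zero    π = refl
parity-double (suc h) π = trans (not-involutive _) (parity-double h π)

parity-double₀ : ∀ h → parity (double h) ≡ false
parity-double₀ h = trans (cong parity (sym (+-identityʳ (double h)))) (parity-double h 0)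

-- Of each pair of indices 2j and 2j + 1 only the one congruent to π contributes.
sumTo-parity : ∀ K π → π < 2 → ∀ f → (∀ b → parity π ≡ not (parity b) → f b ≡ 0) →
  sumTo K (λ j → f (double j + π)) ≡ sumTo (double K) f
sumTo-parity zero    π             π<2 f f≡0 = refl
sumTo-parity (suc K) zero          π<2 f f≡0 = trans
  (cong₂ _+_ (sumTo-parity K 0 π<2 f f≡0) (cong f (+-identityʳ (double K))))
  (sym (trans (cong (sumTo (double K) f + f (double K) +_) (f≡0 _ (cong (not ∘ not) (sym (parity-double₀ K)))))
    (+-identityʳ _)))
sumTo-parity (suc K) (suc zero)    π<2 f f≡0 = trans
  (cong₂ _+_ (sumTo-parity K 1 π<2 f f≡0) (cong f (+-comm (double K) 1)))
  (cong (_+ f (suc (double K))) (sym (trans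
    (cong (sumTo (double K) f +_) (f≡0 _ (cong not (sym (parity-double₀ K))))) (+-identityʳ _))))
sumTo-parity (suc K) (suc (suc π)) (s≤s (s≤s ())) f f≡0

atDiff-cancel : ∀ f A B k → atDiff f (A + k) (B + k) ≡ atDiff f A B
atDiff-cancel f A B zero    = cong₂ (atDiff f) (+-identityʳ A) (+-identityʳ B)
atDiff-cancel f A B (suc k) rewrite +-suc A k | +-suc B k = atDiff-cancel f A B k

-- Since π < 2, A < B holds exactly when 2A + π < 2B, so the defaults on the two sides agree.
atDiff-double : ∀ f π → π < 2 → ∀ A B → atDiff (λ j → f (double j + π)) A B ≡ atDiff f (double A + π) (double B)
atDiff-double f π π<2 A       zero    = refl
atDiff-double f zero π<2 zero (suc B) = refl
atDiff-double f (suc zero) π<2 zero (suc B) = refl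
atDiff-double f (suc (suc _)) (s≤s (s≤s ())) zero (suc B)
atDiff-double f π π<2 (suc A) (suc B) = atDiff-double f π π<2 A B

-- Coefficient families: parity, degree bounds, recurrences.

YParity : Bool → Poly → Set
YParity e p = ∀ a b c → e ≡ not (parity b) → p a b c ≡ 0

-- Every term changes the exponent of Y by exactly one: Y Z ∂X, X Y ∂Z and the extra Y Z raise it, X
-- Z ∂Y lowers it.
step-YParity : ∀ ε {e p} → YParity e p → YParity (not e) (step ε p)
step-YParity ε {e} {p} p-parity a b c odd =
  cong₂ _+_ (trans (cong ((a + ε) *_) (shifted a b c odd)) (*-zeroʳ (a + ε))) (raised a b c odd)
  where
  shifted : ∀ a b c → not e ≡ not (parity b) → shift₂ (p a) b c ≡ 0
  shifted a zero    c       odd = refl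
  shifted a (suc b) zero    odd = refl
  shifted a (suc b) (suc c) odd = p-parity a b c (not-injective odd)
  raised : ∀ a b c → not e ≡ not (parity b) → raise p a b c ≡ 0
  raised zero          b c odd = refl
  raised (suc zero)    b c odd = refl
  raised (suc (suc a)) b c odd = cong₂ _+_ (trans (cong (suc b *_) (yTerm c)) (*-zeroʳ (suc b)))
    (trans (cong (suc c *_) (zTerm b odd)) (*-zeroʳ (suc c)))
    where
    yTerm : ∀ c → shift (p a (suc b)) c ≡ 0
    yTerm zero    = refl
    yTerm (suc c) = p-parity a (suc b) c (trans (not-injective odd) (sym (not-involutive (parity b))))
    zTerm : ∀ b → not e ≡ not (parity b) → shift (λ b′ → p a b′ (suc c)) b ≡ 0
    zTerm zero    odd = refl
    zTerm (suc b) odd = p-parity a b (suc c) (not-injective odd)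

-- `F n` is homogeneous of degree 2n + s + t, with exponents of X congruent to s modulo 2. Thus
-- X^(2i+s) Y^b leaves 2n + t - 2i - b as the exponent of Z.
module Family (s t ε : ℕ) (s<2 : s < 2) (t<2 : t < 2) (F : ℕ → Poly)
  (F-zero : ∀ a b c → F 0 a b c ≡ mono s t 0 a b c)
  (F-suc  : ∀ n a b c → F (suc n) a b c ≡ step ε (F n) a b c) where

  open ≡-Reasoning

  -- A term that gained X² cannot have exponent s < 2, so only Y Z ∂X and ε Y Z reach the lowest
  -- power of X. This is column 0 of all three triangles below.
  F-suc-low : ∀ n b c → F (suc n) s b c ≡ (s + ε) * shift₂ (F n s) b c
  F-suc-low n b c = trans (F-suc n s b c)
    (trans (cong ((s + ε) * shift₂ (F n s) b c +_) (raise-low {F n} s<2 b c)) (+-identityʳ _))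

  Y-degree : ∀ n a b c → n + t < b → F n a b c ≡ 0
  Y-degree zero    a b c t<b = trans (F-zero a b c) (mono-≢ a b c (inj₂ (inj₁ λ { refl → <-irrefl refl t<b })))
  Y-degree (suc n) a b c lt = trans (F-suc n a b c)
    (cong₂ _+_ (trans (cong ((a + ε) *_) (shifted a b c lt)) (*-zeroʳ (a + ε))) (raised a b c lt))
    where
    shifted : ∀ a b c → suc n + t < b → shift₂ (F n a) b c ≡ 0
    shifted a (suc b) zero    _         = refl
    shifted a (suc b) (suc c) (s≤s lt) = Y-degree n a b c lt
    raised : ∀ a b c → suc n + t < b → raise (F n) a b c ≡ 0
    raised zero          b       c lt = refl
    raised (suc zero)    b       c lt = refl
    raised (suc (suc a)) (suc b) zero (s≤s lt) = cong₂ _+_ (*-zeroʳ (suc (suc b)))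
      (cong (1 *_) (Y-degree n a b 1 lt))
    raised (suc (suc a)) (suc b) (suc c) (s≤s lt) = cong₂ _+_
      (trans (cong (suc (suc b) *_) (Y-degree n a (suc (suc b)) c (m<n⇒m<1+n (m<n⇒m<1+n lt)))) (*-zeroʳ (suc (suc b))))
      (trans (cong (suc (suc c) *_) (Y-degree n a b (suc (suc c)) lt)) (*-zeroʳ (suc (suc c))))

  Z-degree : ∀ n a b c → n < c → F n a b c ≡ 0
  Z-degree zero    a b c 0<c = trans (F-zero a b c) (mono-≢ a b c (inj₂ (inj₂ λ { refl → <-irrefl refl 0<c })))
  Z-degree (suc n) a b c lt = trans (F-suc n a b c)
    (cong₂ _+_ (trans (cong ((a + ε) *_) (shifted a b c lt)) (*-zeroʳ (a + ε))) (raised a b c lt))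
    where
    shifted : ∀ a b c → suc n < c → shift₂ (F n a) b c ≡ 0
    shifted a zero    c       _        = refl
    shifted a (suc b) (suc c) (s≤s lt) = Z-degree n a b c lt
    raised : ∀ a b c → suc n < c → raise (F n) a b c ≡ 0
    raised zero          b       c lt = refl
    raised (suc zero)    b       c lt = refl
    raised (suc (suc a)) zero    (suc c) (s≤s lt) = cong₂ _+_
      (cong (1 *_) (Z-degree n a 1 c lt)) (*-zeroʳ (suc (suc c)))
    raised (suc (suc a)) (suc b) (suc c) (s≤s lt) = cong₂ _+_
      (trans (cong (suc (suc b) *_) (Z-degree n a (suc (suc b)) c lt)) (*-zeroʳ (suc (suc b))))
      (trans (cong (suc (suc c) *_) (Z-degree n a b (suc (suc c)) (m<n⇒m<1+n (m<n⇒m<1+n lt)))) (*-zeroʳ (suc (suc c))))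

  rowSum : ℕ → ℕ → ℕ
  rowSum n i = atDiff (diagSum (F n (double i + s))) (double n + t) (double i)

  -- Each step raises the exponents of Y and of Z by at most one, so n + t and n are their largest
  -- values. Homogeneity then leaves Z^(n - 2i) beside Y^(n+t), and in `topZ` Y^(n + t - 2i) beside
  -- Z^n.
  topY : ℕ → ℕ → ℕ
  topY n i = atDiff (F n (double i + s) (n + t)) n (double i)

  topZ : ℕ → ℕ → ℕ
  topZ n i = atDiff (λ b → F n (double i + s) b n) (n + t) (double i)

  F-zero-one : F 0 s t 0 ≡ 1
  F-zero-one = trans (F-zero s t 0) (mono-refl s t 0)

  F-zero-high : ∀ k b c → F 0 (double (suc k) + s) b c ≡ 0
  F-zero-high k b c = trans (F-zero _ b c) (mono-≢ (double (suc k) + s) b c (inj₁ λ eq → m≢1+n+m s (sym eq)))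

  -- Y Z ∂X and ε Y Z keep X^(2k+2+s) and have joint weight 2k + 2 + s + ε. The other two terms come
  -- from X^(2k+s) with the same b + c = 2n + t - 2k, which is their joint weight by
  -- `diagSum-raise`.
  rowSum-isTriangle : IsTriangle (λ i → double i + s + ε) (λ n k → double n + t ∸ double k) rowSum
  rowSum-isTriangle = record
    { base-zero = diagSum-base t<2 F-zero-one
    ; base-suc  = λ k → trans (atDiff-cong t (double (suc k)) λ N _ → diagSum-0 (F-zero-high k) N)
        (atDiff-0 t (double (suc k)))
    ; step-zero = λ n → trans (diagSum-cong (double (suc n) + t) λ b c _ → F-suc-low n b c)
        (trans (diagSum-* (s + ε) (shift₂ (F n s)) (double (suc n) + t))
          (cong ((s + ε) *_) (diagSum-shift₂ (F n s) (double (suc n) + t))))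
    ; step-suc  = λ n k → let a = double k + s; A = double (suc n) + t; B = double (suc k) in begin
        atDiff (diagSum (F (suc n) (suc (suc a)))) A B
          ≡⟨ atDiff-cong A B (λ N _ → begin
               diagSum (F (suc n) (suc (suc a))) N
                 ≡⟨ diagSum-cong N (λ b c _ → F-suc n (suc (suc a)) b c) ⟩
               diagSum (step ε (F n) (suc (suc a))) N
                 ≡⟨ diagSum-+ _ _ N ⟩
               diagSum (λ b c → (suc (suc a) + ε) * shift₂ (F n (suc (suc a))) b c) N + diagSum (raise (F n) (suc (suc a))) N
                 ≡⟨ cong₂ _+_ (trans (diagSum-* (suc (suc a) + ε) _ N)
                      (cong ((suc (suc a) + ε) *_) (diagSum-shift₂ (F n (suc (suc a))) N))) (diagSum-raise (F n) a N) ⟩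
               (suc (suc a) + ε) * shift (shift (diagSum (F n (suc (suc a))))) N + N * diagSum (F n a) N ∎) ⟩
        atDiff (λ N → (suc (suc a) + ε) * shift (shift (diagSum (F n (suc (suc a))))) N + N * diagSum (F n a) N) A B
          ≡⟨ atDiff-+ _ _ A B ⟩
        _ ≡⟨ cong₂ _+_ (trans (atDiff-* (suc (suc a) + ε) _ A B)
               (cong ((suc (suc a) + ε) *_) (trans (atDiff-shift _ A B) (atDiff-shift _ A (suc B)))))
               (atDiff-id* (diagSum (F n a)) A B) ⟩
        (suc (suc a) + ε) * rowSum n (suc k) + (double n + t ∸ double k) * rowSum n k ∎
    }
    where
    diagSum-base : ∀ {t′} → t′ < 2 → F 0 s t′ 0 ≡ 1 → diagSum (F 0 s) t′ ≡ 1
    diagSum-base {zero}        _ eq = eq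
    diagSum-base {suc zero}    _ eq = cong₂ _+_ (Z-degree 0 s 0 1 (s≤s z≤n)) eq
    diagSum-base {suc (suc _)} (s≤s (s≤s ())) eq

  -- To reach the new top power of Y a term must gain a Y. That leaves Y Z ∂X, ε Y Z and X Y ∂Z, the
  -- last weighted by the exponent n - 2k of Z in its source; X Z ∂Y would start above the degree
  -- bound.
  topY-isTriangle : IsTriangle (λ i → double i + s + ε) (λ n k → n ∸ double k) topY
  topY-isTriangle = record
    { base-zero = F-zero-one
    ; base-suc  = λ k → refl
    ; step-zero = λ n → F-suc-low n (suc n + t) (suc n)
    ; step-suc  = λ n k → let a = double k + s; A = suc n; B = double (suc k) in begin
        atDiff (F (suc n) (suc (suc a)) (suc n + t)) A B
          ≡⟨ atDiff-cong A B (λ c _ → topStep n a c) ⟩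
        atDiff (λ c → (suc (suc a) + ε) * shift (F n (suc (suc a)) (n + t)) c + suc c * F n a (n + t) (suc c)) A B
          ≡⟨ atDiff-+ _ _ A B ⟩
        _ ≡⟨ cong₂ _+_ (trans (atDiff-* (suc (suc a) + ε) _ A B)
               (cong ((suc (suc a) + ε) *_) (atDiff-shift _ A B)))
             (trans (atDiff-suc (λ c → c * F n a (n + t) c) refl A B) (atDiff-id* (F n a (n + t)) (suc A) B)) ⟩
        (suc (suc a) + ε) * topY n (suc k) + (n ∸ double k) * topY n k ∎
    }
    where
    topStep : ∀ n a c → F (suc n) (suc (suc a)) (suc n + t) c
      ≡ (suc (suc a) + ε) * shift (F n (suc (suc a)) (n + t)) c + suc c * F n a (n + t) (suc c)
    topStep n a c = trans (F-suc n _ _ c) (cong ((suc (suc a) + ε) * shift (F n (suc (suc a)) (n + t)) c +_)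
      (cong (_+ suc c * F n a (n + t) (suc c)) (trans (cong (suc (suc n + t) *_) (vanish c)) (*-zeroʳ (suc (suc n + t))))))
      where
      vanish : ∀ c → shift (F n a (suc (suc (n + t)))) c ≡ 0
      vanish zero    = refl
      vanish (suc c) = Y-degree n a _ c (m<n⇒m<1+n (n<1+n _))

  -- As for `topY` with Y and Z exchanged: the raising term is now X Z ∂Y, and its source has Y to
  -- the power n + t - 2k.
  topZ-isTriangle : IsTriangle (λ i → double i + s + ε) (λ n k → n + t ∸ double k) topZ
  topZ-isTriangle = record
    { base-zero = F-zero-one
    ; base-suc  = λ k → trans (atDiff-cong t (double (suc k)) λ b _ → F-zero-high k b 0) (atDiff-0 t (double (suc k)))
    ; step-zero = λ n → F-suc-low n (suc n + t) (suc n)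
    ; step-suc  = λ n k → let a = double k + s; A = suc n + t; B = double (suc k) in begin
        atDiff (λ b → F (suc n) (suc (suc a)) b (suc n)) A B
          ≡⟨ atDiff-cong A B (λ b _ → topStep n a b) ⟩
        atDiff (λ b → (suc (suc a) + ε) * shift (λ b′ → F n (suc (suc a)) b′ n) b + suc b * F n a (suc b) n) A B
          ≡⟨ atDiff-+ _ _ A B ⟩
        _ ≡⟨ cong₂ _+_ (trans (atDiff-* (suc (suc a) + ε) _ A B)
               (cong ((suc (suc a) + ε) *_) (atDiff-shift _ A B)))
             (trans (atDiff-suc (λ b → b * F n a b n) refl A B) (atDiff-id* (λ b → F n a b n) (suc A) B)) ⟩
        (suc (suc a) + ε) * topZ n (suc k) + (n + t ∸ double k) * topZ n k ∎
    }
    where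
    topStep : ∀ n a b → F (suc n) (suc (suc a)) b (suc n)
      ≡ (suc (suc a) + ε) * shift (λ b′ → F n (suc (suc a)) b′ n) b + suc b * F n a (suc b) n
    topStep n a b = trans (F-suc n _ b _) (cong₂ _+_ (cong ((suc (suc a) + ε) *_) (unshift b))
      (trans (cong (suc b * F n a (suc b) n +_) (trans (cong (suc (suc n) *_) (vanish b)) (*-zeroʳ (suc (suc n))))) (+-identityʳ _)))
      where
      unshift : ∀ b → shift₂ (F n (suc (suc a))) b (suc n) ≡ shift (λ b′ → F n (suc (suc a)) b′ n) b
      unshift zero    = refl
      unshift (suc b) = refl
      vanish : ∀ b → shift (λ b′ → F n a b′ (suc (suc n))) b ≡ 0
      vanish zero    = refl
      vanish (suc b) = Z-degree n a b _ (m<n⇒m<1+n (n<1+n _))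

  Y-parity : ∀ n → YParity (parity (n + t)) (F n)
  Y-parity zero    a b c odd = trans (F-zero a b c)
    (mono-≢ a b c (inj₂ (inj₁ λ { refl → not-¬ refl odd })))
  Y-parity (suc n) a b c odd = trans (F-suc n a b c) (step-YParity ε (Y-parity n) a b c odd)

  coeff : ℕ → ℕ → ℕ → ℕ
  coeff n i b = atDiff (F n (double i + s) b) (double n + t) (double i + b)

  -- At X^s Y^0 nothing arrives: Y Z ∂X and ε Y Z bring a Y, the other terms bring X².
  coeff-base : ∀ n → coeff (suc n) 0 0 ≡ 0
  coeff-base n = trans (atDiff-cong (double (suc n) + t) 0 λ c _ → trans (F-suc-low n 0 c) (*-zeroʳ (s + ε)))
    (atDiff-0 (double (suc n) + t) 0)

  -- A monomial free of Y comes only from X Z ∂Y applied to Y^1, with factor 1. Up to an index shift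
  -- this is the equality of the two sums in (vii), and of those in (ix).
  coeff-one : ∀ n i → coeff n i 1 ≡ coeff (suc n) (suc i) 0
  coeff-one n i = sym (begin
    atDiff (F (suc n) (suc (suc a)) 0) (suc (suc A)) (suc (suc (double i + 0)))
      ≡⟨ atDiff-cong (suc (suc A)) (suc (suc (double i + 0))) (λ c _ → trans (F-suc n (suc (suc a)) 0 c) (only-raised c)) ⟩
    atDiff (shift (F n a 1)) (suc (suc A)) (suc (suc (double i + 0)))
      ≡⟨ atDiff-shift (F n a 1) A (double i + 0) ⟩
    atDiff (F n a 1) A (suc (double i + 0))
      ≡⟨ cong (atDiff (F n a 1) A) (sym (+-suc (double i) 0)) ⟩
    atDiff (F n a 1) A (double i + 1) ∎)
    where
    a = double i + s
    A = double n + t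
    only-raised : ∀ c → step ε (F n) (suc (suc a)) 0 c ≡ shift (F n a 1) c
    only-raised c = trans (cong₂ (λ x y → x + (1 * shift (F n a 1) c + y)) (*-zeroʳ (suc (suc a) + ε)) (*-zeroʳ (suc c)))
      (trans (+-identityʳ _) (*-identityˡ _))

  -- By parity only the exponents b = 2j + π of Y occur, where π is the parity of n + t; j is the
  -- index used in the theorem and h its value at the top exponent.
  module Reindex (n h π : ℕ) (π<2 : π < 2) (n+t≡2h+π : n + t ≡ double h + π) where

    total≡ : double n + t ≡ n + (n + t)
    total≡ = trans (cong (_+ t) (double≡+ n)) (+-assoc n n t)

    Σ-coeff≡rowSum : ∀ i → sumTo (n + 1) (λ j → coeff n i (double j + π)) ≡ rowSum n i
    Σ-coeff≡rowSum i = begin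
      sumTo (n + 1) (λ j → coeff n i (double j + π))
        ≡⟨ cong (λ M → sumTo M (λ j → coeff n i (double j + π))) (+-comm n 1) ⟩
      sumTo (suc n) (λ j → coeff n i (double j + π))
        ≡⟨ sumTo-parity (suc n) π π<2 (coeff n i) (λ b odd → trans
             (atDiff-cong (double n + t) (double i + b) λ c _ → Y-parity n _ b c (trans (cong parity n+t≡2h+π) (trans (parity-double h π) odd)))
             (atDiff-0 (double n + t) (double i + b))) ⟩
      sumTo (double (suc n)) (coeff n i)
        ≡⟨ sym (atDiff-diagSum (F n (double i + s)) (double n + t) (double i) (double (suc n)) bound) ⟩
      rowSum n i ∎
      where
      bound : double n + t < double (suc n)
      bound = subst (_≤ double (suc n)) (+-suc (double n) t)
        (subst (double n + suc t ≤_) (+-comm (double n) 2) (+-monoʳ-≤ (double n) t<2))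

    coeff≡topY : ∀ i → coeff n i (double h + π) ≡ topY n i
    coeff≡topY i rewrite sym n+t≡2h+π | total≡ = atDiff-cancel _ n (double i) (n + t)

    -- j = h - i means b = n + t - 2i, which leaves exactly n as the exponent of Z.
    coeff≡topZ : ∀ i → atDiff (λ j → coeff n i (double j + π)) h i ≡ topZ n i
    coeff≡topZ i = begin
      atDiff (λ j → coeff n i (double j + π)) h i
        ≡⟨ atDiff-double (coeff n i) π π<2 h i ⟩
      atDiff (coeff n i) (double h + π) (double i)
        ≡⟨ cong (λ A → atDiff (coeff n i) A (double i)) (sym n+t≡2h+π) ⟩
      atDiff (coeff n i) (n + t) (double i)
        ≡⟨ atDiff-cong (n + t) (double i) (λ b eq → atDiff-≤ (F n (double i + s) b) _ (double i + b) n
             (trans (cong (n +_) (trans (+-comm (double i) b) eq)) (sym total≡))) ⟩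
      topZ n i ∎

-- From integer exponents to the coefficient families.

atZ-⊖ : ∀ f A B → atZ f (A ℤ.⊖ B) ≡ atDiff f A B
atZ-⊖ f A       zero    = refl
atZ-⊖ f zero    (suc B) = refl
atZ-⊖ f (suc A) (suc B) = trans (cong (atZ f) (ℤ.[1+m]⊖[1+n]≡m⊖n A B)) (atZ-⊖ f A B)

atZ-minus : ∀ f A B → atZ f (ℤ.+ A ℤ.- ℤ.+ B) ≡ atDiff f A B
atZ-minus f A B = trans (cong (atZ f) (ℤ.m-n≡m⊖n A B)) (atZ-⊖ f A B)

coeffZ-minus : ∀ (p : Poly) a b A B → coeffZ p a b (ℤ.+ A ℤ.- ℤ.+ B) ≡ atDiff (p a b) A B
coeffZ-minus p a b A B = trans (coeffZ≡atZ (ℤ.+ A ℤ.- ℤ.+ B)) (atZ-minus (p a b) A B)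
  where
  coeffZ≡atZ : ∀ z → coeffZ p a b z ≡ atZ (p a b) z
  coeffZ≡atZ (ℤ.+ c)    = refl
  coeffZ≡atZ -[1+ c ] = refl

double+≡ : ∀ h π → double h + π ≡ π + h * 2
double+≡ h π = trans (+-comm (double h) π) (cong (_+_ π) (trans (double≡2* h) (*-comm 2 h)))

%2-double : ∀ h π → (double h + π) % 2 ≡ π % 2
%2-double h π = trans (cong (_% 2) (double+≡ h π)) ([m+kn]%n≡m%n π h 2)

/2-double : ∀ h π → π < 2 → (double h + π) / 2 ≡ h
/2-double h π π<2 = trans (cong (_/ 2) (double+≡ h π))
  (trans (+-distrib-/-∣ʳ π (n∣m*n h)) (cong₂ _+_ (small π π<2) (m*n/n≡m h 2)))
  where
  small : ∀ π → π < 2 → π / 2 ≡ 0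
  small zero       _ = refl
  small (suc zero) _ = refl
  small (suc (suc _)) (s≤s (s≤s ()))

isEven-double : ∀ h π → isEven (double h + π) ≡ (π % 2 ≡ᵇ 0)
isEven-double h π = cong (_≡ᵇ 0) (%2-double h π)

halving : ∀ n → ∃₂ λ h π → π < 2 × n ≡ double h + π
halving zero    = 0 , 0 , s≤s z≤n , refl
halving (suc n) with halving n
... | h , zero     , _ , refl = h , 1 , s≤s (s≤s z≤n) , sym (+-suc (double h) 0)
... | h , suc zero , _ , refl = suc h , 0 , s≤s z≤n , cong suc (+-suc (double h) 0)
... | h , suc (suc _) , s≤s (s≤s ()) , _

atDiff-args : (p : Poly) → ∀ {a a′ b b′ A A′ B B′} → a ≡ a′ → b ≡ b′ → A ≡ A′ → B ≡ B′ →
  atDiff (p a b) A B ≡ atDiff (p a′ b′) A′ B′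
atDiff-args p refl refl refl refl = refl

XDpow-step : ∀ n a b c → XDpow (suc n) a b c ≡ step 0 (XDpow n) a b c
XDpow-step n = XD-step (XDpow n)

DXpow-step : ∀ q n a b c → DXpow (suc n) q a b c ≡ step 1 (DXpow n q) a b c
DXpow-step q n = DX-step (DXpow n q)

varX-mono : ∀ a b c → varX a b c ≡ mono 1 0 0 a b c
varX-mono zero          b       c       = refl
varX-mono (suc zero)    zero    zero    = refl
varX-mono (suc zero)    zero    (suc c) = refl
varX-mono (suc zero)    (suc b) c       = refl
varX-mono (suc (suc a)) b       c       = refl

varY-mono : ∀ a b c → varY a b c ≡ mono 0 1 0 a b c
varY-mono zero    zero          c       = refl
varY-mono zero    (suc zero)    zero    = refl
varY-mono zero    (suc zero)    (suc c) = refl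
varY-mono zero    (suc (suc b)) c       = refl
varY-mono (suc a) b             c       = refl

0<2 : 0 < 2
0<2 = s≤s z≤n

1<2 : 1 < 2
1<2 = s≤s (s≤s z≤n)

module CoeffA = Family 1 0 0 1<2 0<2 XDpow varX-mono XDpow-step
module CoeffC = Family 1 0 1 1<2 0<2 (λ n → DXpow n varX) varX-mono (DXpow-step varX)
module CoeffD = Family 0 1 1 0<2 1<2 (λ n → DXpow n varY) varY-mono (DXpow-step varY)

oddX-coeff : ∀ (p : Poly) m π → π < 2 → ∀ i j →
  (if isEven (double m + π)
    then coeffZ p (2 * i + 1) (2 * j)     (zexp ((double m + π) / 2) i j 0)
    else coeffZ p (2 * i + 1) (2 * j + 1) (zexp ((double m + π) / 2) i j 1))
  ≡ atDiff (p (double i + 1) (double j + π)) (double (double m + π) + 0) (double i + (double j + π))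
oddX-coeff p m π π<2 i j rewrite isEven-double m π | /2-double m π π<2 = go π π<2
  where
  go : ∀ π → π < 2 →
    (if π % 2 ≡ᵇ 0
      then coeffZ p (2 * i + 1) (2 * j)     (zexp m i j 0)
      else coeffZ p (2 * i + 1) (2 * j + 1) (zexp m i j 1))
    ≡ atDiff (p (double i + 1) (double j + π)) (double (double m + π) + 0) (double i + (double j + π))
  go zero _ rewrite double≡2* i | double≡2* j | double≡2* (double m + 0) | double≡2* m =
    trans (coeffZ-minus p (2 * i + 1) (2 * j) (4 * m + 0) (2 * i + 2 * j))
      (atDiff-args p refl (sym (+-identityʳ (2 * j))) (top m) (bottom i j))
    where
    top : ∀ m → 4 * m + 0 ≡ 2 * (2 * m + 0) + 0
    top = solve-∀
    bottom : ∀ i j → 2 * i + 2 * j ≡ 2 * i + (2 * j + 0)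
    bottom = solve-∀
  go (suc zero) _ rewrite double≡2* i | double≡2* j | double≡2* (double m + 1) | double≡2* m =
    trans (coeffZ-minus p (2 * i + 1) (2 * j + 1) (4 * m + 1) (2 * i + 2 * j))
      (atDiff-args p refl refl (top m) (bottom i j))
    where
    -- Minuend and subtrahend in `coeff` are one larger than in `zexp`; `atDiff` cancels the common
    -- `suc` by computation.
    top : ∀ m → suc (4 * m + 1) ≡ 2 * (2 * m + 1) + 0
    top = solve-∀
    bottom : ∀ i j → suc (2 * i + 2 * j) ≡ 2 * i + (2 * j + 1)
    bottom = solve-∀
  go (suc (suc _)) (s≤s (s≤s ()))

aCoef≡ : ∀ m π → π < 2 → ∀ i j → aCoef (double m + π) i j ≡ CoeffA.coeff (double m + π) i (double j + π)
aCoef≡ m π π<2 = oddX-coeff (XDpow (double m + π)) m π π<2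

cCoef≡ : ∀ m π → π < 2 → ∀ i j → cCoef (double m + π) i j ≡ CoeffC.coeff (double m + π) i (double j + π)
cCoef≡ m π π<2 = oddX-coeff (DXpow (double m + π) varX) m π π<2

dCoef-even : ∀ m i j → dCoef (double m + 0) i j ≡ CoeffD.coeff (double m + 0) i (double j + 1)
dCoef-even m i j rewrite isEven-double m 0 | /2-double m 0 0<2 =
  trans (coeffZ-minus (DXpow (double m + 0) varY) (2 * i) (2 * j + 1) (4 * m + 0) (2 * i + 2 * j))
    (atDiff-args (DXpow (double m + 0) varY) (trans (sym (double≡2* i)) (sym (+-identityʳ (double i))))
      (cong (_+ 1) (sym (double≡2* j)))
      (trans (top m) (trans (cong suc (trans (cong (λ x → 2 * x) (sym (trans (+-identityʳ (double m)) (double≡2* m))))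
        (sym (double≡2* (double m + 0))))) (sym (+-comm (double (double m + 0)) 1))))
      (trans (bottom i j) (cong₂ (λ x y → x + (y + 1)) (sym (double≡2* i)) (sym (double≡2* j)))))
  where
  top : ∀ m → suc (4 * m + 0) ≡ suc (2 * (2 * m))
  top = solve-∀
  bottom : ∀ i j → suc (2 * i + 2 * j) ≡ 2 * i + (2 * j + 1)
  bottom = solve-∀

dCoef-odd : ∀ m i j → dCoef (double m + 1) i j ≡ CoeffD.coeff (double m + 1) i (double j + 0)
dCoef-odd m i j rewrite isEven-double m 1 | /2-double m 1 1<2 =
  trans (coeffZ-minus (DXpow (double m + 1) varY) (2 * i) (2 * j) (4 * m + 3) (2 * i + 2 * j))
    (atDiff-args (DXpow (double m + 1) varY) (trans (sym (double≡2* i)) (sym (+-identityʳ (double i))))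
      (trans (sym (double≡2* j)) (sym (+-identityʳ (double j))))
      (trans (top m) (cong (λ x → x + 1) (trans (cong (λ x → 2 * (x + 1)) (sym (double≡2* m))) (sym (double≡2* (double m + 1))))))
      (trans (bottom i j) (cong₂ (λ x y → x + (y + 0)) (sym (double≡2* i)) (sym (double≡2* j)))))
  where
  top : ∀ m → 4 * m + 3 ≡ 2 * (2 * m + 1) + 1
  top = solve-∀
  bottom : ∀ i j → 2 * i + 2 * j ≡ 2 * i + (2 * j + 0)
  bottom = solve-∀

-- With t = 1 the parity of n + 1 governs the exponents of Y: n = 2m gives h = m and π = 1, while n
-- = 2m + 1 gives h = m + 1 and π = 0. In both cases h is `halfUp n`.
dCoef-view : ∀ n → ∃₂ λ h π → π < 2 × n + 1 ≡ double h + π × (∀ i j → dCoef n i j ≡ CoeffD.coeff n i (double j + π))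
dCoef-view n with halving n
... | m , zero         , _             , refl = m , 1 , 1<2 , cong (_+ 1) (+-identityʳ (double m)) , dCoef-even m
... | m , suc zero     , _             , refl = suc m , 0 , 0<2 , eq (double m) , dCoef-odd m
  where
  eq : ∀ x → x + 1 + 1 ≡ suc (suc x) + 0
  eq = solve-∀
... | m , suc (suc _)  , s≤s (s≤s ()) , _

a-rowSum : ∀ n i → sumTo (n + 1) (λ j → aCoef n i j) ≡ CoeffA.rowSum n i
a-rowSum n i with halving n
... | h , π , π<2 , refl = trans (sumTo-cong (double h + π + 1) (aCoef≡ h π π<2 i))
  (CoeffA.Reindex.Σ-coeff≡rowSum _ h π π<2 (+-identityʳ _) i)

c-rowSum : ∀ n i → sumTo (n + 1) (λ j → cCoef n i j) ≡ CoeffC.rowSum n i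
c-rowSum n i with halving n
... | h , π , π<2 , refl = trans (sumTo-cong (double h + π + 1) (cCoef≡ h π π<2 i))
  (CoeffC.Reindex.Σ-coeff≡rowSum _ h π π<2 (+-identityʳ _) i)

d-rowSum : ∀ n i → sumTo (n + 1) (λ j → dCoef n i j) ≡ CoeffD.rowSum n i
d-rowSum n i with dCoef-view n
... | h , π , π<2 , eq , dCoef≡ = trans (sumTo-cong (n + 1) (dCoef≡ i))
  (CoeffD.Reindex.Σ-coeff≡rowSum n h π π<2 eq i)

a-topY : ∀ n i → aCoef n i (half n) ≡ CoeffA.topY n i
a-topY n i with halving n
... | h , π , π<2 , refl = trans (cong (aCoef (double h + π) i) (/2-double h π π<2))
  (trans (aCoef≡ h π π<2 i h) (CoeffA.Reindex.coeff≡topY _ h π π<2 (+-identityʳ _) i))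

c-topY : ∀ n i → cCoef n i (half n) ≡ CoeffC.topY n i
c-topY n i with halving n
... | h , π , π<2 , refl = trans (cong (cCoef (double h + π) i) (/2-double h π π<2))
  (trans (cCoef≡ h π π<2 i h) (CoeffC.Reindex.coeff≡topY _ h π π<2 (+-identityʳ _) i))

d-topY : ∀ n i → dCoef n i (halfUp n) ≡ CoeffD.topY n i
d-topY n i with dCoef-view n
... | h , π , π<2 , eq , dCoef≡ = trans (cong (dCoef n i) (trans (cong (_/ 2) eq) (/2-double h π π<2)))
  (trans (dCoef≡ i h) (CoeffD.Reindex.coeff≡topY n h π π<2 eq i))

a-topZ : ∀ n i → atZ (aCoef n i) (ℤ.+ half n ℤ.- ℤ.+ i) ≡ CoeffA.topZ n i
a-topZ n i with halving n
... | h , π , π<2 , refl = trans (atZ-minus _ (half (double h + π)) i)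
  (trans (cong (λ A → atDiff (aCoef (double h + π) i) A i) (/2-double h π π<2))
    (trans (atDiff-cong h i λ j _ → aCoef≡ h π π<2 i j) (CoeffA.Reindex.coeff≡topZ _ h π π<2 (+-identityʳ _) i)))

c-topZ : ∀ n i → atZ (cCoef n i) (ℤ.+ half n ℤ.- ℤ.+ i) ≡ CoeffC.topZ n i
c-topZ n i with halving n
... | h , π , π<2 , refl = trans (atZ-minus _ (half (double h + π)) i)
  (trans (cong (λ A → atDiff (cCoef (double h + π) i) A i) (/2-double h π π<2))
    (trans (atDiff-cong h i λ j _ → cCoef≡ h π π<2 i j) (CoeffC.Reindex.coeff≡topZ _ h π π<2 (+-identityʳ _) i)))

d-topZ : ∀ n i → atZ (dCoef n i) (ℤ.+ halfUp n ℤ.- ℤ.+ i) ≡ CoeffD.topZ n i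
d-topZ n i with dCoef-view n
... | h , π , π<2 , eq , dCoef≡ = trans (atZ-minus _ (halfUp n) i)
  (trans (cong (λ A → atDiff (dCoef n i) A i) (trans (cong (_/ 2) eq) (/2-double h π π<2)))
    (trans (atDiff-cong h i λ j _ → dCoef≡ i j) (CoeffD.Reindex.coeff≡topZ n h π π<2 eq i)))

-- Sums over fibres, arrangements by insertion of the largest letter

sumOver : (X → ℕ) → List X → ℕ
sumOver f xs = sum (map f xs)

sumOver-++ : ∀ (f : X → ℕ) xs ys → sumOver f (xs ++ ys) ≡ sumOver f xs + sumOver f ys
sumOver-++ f xs ys = trans (cong sum (map-++ f xs ys)) (sum-++ (map f xs) (map f ys))

sumOver-concatMap : ∀ (f : Y → ℕ) (F : X → List Y) xs →
  sumOver f (concatMap F xs) ≡ sumOver (λ x → sumOver f (F x)) xs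
sumOver-concatMap f F []       = refl
sumOver-concatMap f F (x ∷ xs) = trans (sumOver-++ f (F x) _) (cong (sumOver f (F x) +_) (sumOver-concatMap f F xs))

sumOver-cong-∈ : ∀ {f g : X → ℕ} xs → (∀ {x} → x ∈ xs → f x ≡ g x) → sumOver f xs ≡ sumOver g xs
sumOver-cong-∈ []       f≡g = refl
sumOver-cong-∈ (x ∷ xs) f≡g = cong₂ _+_ (f≡g (here refl)) (sumOver-cong-∈ xs (f≡g ∘ there))

sumOver-map : ∀ (f : Y → ℕ) (g : X → Y) xs → sumOver f (map g xs) ≡ sumOver (f ∘ g) xs
sumOver-map f g []       = refl
sumOver-map f g (x ∷ xs) = cong (f (g x) +_) (sumOver-map f g xs)

sumOver-+ : ∀ (f g : X → ℕ) xs → sumOver (λ x → f x + g x) xs ≡ sumOver f xs + sumOver g xs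
sumOver-+ f g []       = refl
sumOver-+ f g (x ∷ xs) = trans (cong (f x + g x +_) (sumOver-+ f g xs)) (+-swap (f x) (g x) _ _)

sumOver-* : ∀ c (f : X → ℕ) xs → sumOver (λ x → c * f x) xs ≡ c * sumOver f xs
sumOver-* c f []       = sym (*-zeroʳ c)
sumOver-* c f (x ∷ xs) = trans (cong (c * f x +_) (sumOver-* c f xs)) (sym (*-distribˡ-+ c _ _))

sumOver-0 : ∀ (xs : List X) → sumOver (λ _ → 0) xs ≡ 0
sumOver-0 []       = refl
sumOver-0 (x ∷ xs) = sumOver-0 xs

sumOver-↭ : ∀ (f : X → ℕ) {xs ys} → xs ↭ ys → sumOver f xs ≡ sumOver f ys
sumOver-↭ f p = sum-↭ (map⁺ f p)

count≡sumOver : ∀ (p : X → Bool) xs → count p xs ≡ sumOver (λ x → if p x then 1 else 0) xs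
count≡sumOver p []       = refl
count≡sumOver p (x ∷ xs) = cong ((if p x then 1 else 0) +_) (count≡sumOver p xs)

unique-⇔⇒↭ : ∀ {xs ys : List X} → Unique xs → Unique ys → (∀ {x} → x ∈ xs ⇔ x ∈ ys) → xs ↭ ys
unique-⇔⇒↭ xs! ys! eq = ∼bag⇒↭ (unique∧set⇒bag xs! ys! eq)

concatMap-unique : ∀ {F : X → List Y} {xs} → Unique xs → (∀ {x} → x ∈ xs → Unique (F x)) →
  (∀ {x x′ y} → x ∈ xs → x′ ∈ xs → y ∈ F x → y ∈ F x′ → x ≡ x′) → Unique (concatMap F xs)
concatMap-unique []                F! inj = []
concatMap-unique {F = F} {x ∷ xs} (x∉ ∷ xs!) F! inj = Unique.++⁺ (F! (here refl))
  (concatMap-unique xs! (F! ∘ there) (λ x∈ x′∈ → inj (there x∈) (there x′∈))) disjoint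
  where
  disjoint : ∀ {y} → ¬ (y ∈ F x × y ∈ concatMap F xs)
  disjoint (y∈Fx , y∈rest) with find (∈-concatMap⁻ F y∈rest)
  ... | x′ , x′∈ , y∈Fx′ = All.lookup x∉ x′∈ (inj (here refl) (there x′∈) y∈Fx y∈Fx′)

-- The words that pass a filter and the words built by recursion are listed in different orders, so
-- only membership in duplicate-free lists is compared. `g` forgets the last construction step and
-- `F x` lists its fibre over x.
sumOver-fibres : ∀ (g : Y → X) (F : X → List Y) {xs ys} → Unique xs → Unique ys → (∀ {x} → x ∈ xs → Unique (F x)) →
  (∀ {x y} → x ∈ xs → y ∈ F x → y ∈ ys × g y ≡ x) →
  (∀ {y} → y ∈ ys → g y ∈ xs × y ∈ F (g y)) →
  ∀ f → sumOver f ys ≡ sumOver (λ x → sumOver f (F x)) xs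
sumOver-fibres g F {xs} {ys} xs! ys! F! up down f = trans
  (sumOver-↭ f (unique-⇔⇒↭ ys! (concatMap-unique xs! F!
    (λ x∈ x′∈ y∈ y∈′ → trans (sym (proj₂ (up x∈ y∈))) (proj₂ (up x′∈ y∈′)))) (mk⇔ to from)))
  (sumOver-concatMap f F xs)
  where
  to : ∀ {y} → y ∈ ys → y ∈ concatMap F xs
  to y∈ = ∈-concatMap⁺ F (lose (proj₁ (down y∈)) (proj₂ (down y∈)))
  from : ∀ {y} → y ∈ concatMap F xs → y ∈ ys
  from y∈ with find (∈-concatMap⁻ F y∈)
  ... | x , x∈ , y∈Fx = proj₁ (up x∈ y∈Fx)

∈-words⁻ : ∀ k (xs : List X) {w} → w ∈ words k xs → length w ≡ k × All (_∈ xs) w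
∈-words⁻ zero    xs (here refl) = refl , []
∈-words⁻ (suc k) xs w∈ with find (∈-concatMap⁻ (λ x → map (x ∷_) (words k xs)) {xs} w∈)
... | x , x∈ , w∈′ with ∈-map⁻ (x ∷_) w∈′
... | v , v∈ , refl with ∈-words⁻ k xs v∈
... | len , v⊆ = cong suc len , x∈ ∷ v⊆

∈-words⁺ : ∀ k (xs : List X) {w} → length w ≡ k → All (_∈ xs) w → w ∈ words k xs
∈-words⁺ zero    xs {[]}    len  []        = here refl
∈-words⁺ (suc k) xs {x ∷ w} len  (x∈ ∷ w⊆) = ∈-concatMap⁺ (λ x → map (x ∷_) (words k xs))
  (lose x∈ (∈-map⁺ (x ∷_) (∈-words⁺ k xs (suc-injective len) w⊆)))

words-unique : ∀ k {xs : List X} → Unique xs → Unique (words k xs)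
words-unique zero    xs! = [] ∷ []
words-unique (suc k) {xs} xs! = concatMap-unique xs!
  (λ _ → Unique.map⁺ (λ { refl → refl }) (words-unique k xs!)) same-head
  where
  same-head : ∀ {x x′ w} → _ → _ → w ∈ map (x ∷_) (words k xs) → w ∈ map (x′ ∷_) (words k xs) → x ≡ x′
  same-head {x} {x′} _ _ w∈ w∈′ with ∈-map⁻ (x ∷_) w∈ | ∈-map⁻ (x′ ∷_) w∈′
  ... | _ , _ , refl | _ , _ , refl = refl

-- Two equations determine a filter, so the facts about `filterᵇ` apply to each local `filterB`.
filter-char : ∀ (p : X → Bool) (fil : List X → List X) → fil [] ≡ [] →
  (∀ w ws → fil (w ∷ ws) ≡ (if p w then w ∷ fil ws else fil ws)) → ∀ ws → fil ws ≡ filterᵇ p ws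
filter-char p fil nil cons []       = nil
filter-char p fil nil cons (w ∷ ws) with p w | cons w ws
... | true  | eq = trans eq (cong (w ∷_) (filter-char p fil nil cons ws))
... | false | eq = trans eq (filter-char p fil nil cons ws)

-- The underscores are solved by the local functions filterB of Defs, which cannot be named here.
mutual
  permsFilter : ℕ → List (List ℕ) → List (List ℕ)
  permsFilter = _

  perms≡permsFilter : ∀ n → perms n ≡ permsFilter n (words n (range n))
  perms≡permsFilter n with words n (range n)
  ... | ws = refl

signedRange : ℕ → List ℤ
signedRange n = map ℤ.+_ (range n) ++ map ℤ.-_ (map ℤ.+_ (range n))

mutual
  signedPermsFilter : ℕ → List (List ℤ) → List (List ℤ)
  signedPermsFilter = _

  signedPerms≡signedPermsFilter : ∀ n → signedPerms n ≡ signedPermsFilter n (words n (signedRange n))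
  signedPerms≡signedPermsFilter n with words n (signedRange n)
  ... | ws = refl

mutual
  matchingsFilter : ℕ → List (List ℕ) → List (List ℕ)
  matchingsFilter = _

  matchings≡matchingsFilter : ∀ n → matchings n ≡ matchingsFilter n (words (2 * n) (range (2 * n)))
  matchings≡matchingsFilter n with words (2 * n) (range (2 * n))
  ... | ws = refl

matchings≡filter : ∀ n → matchings n ≡ filterᵇ (isFPFInv (2 * n)) (words (2 * n) (range (2 * n)))
matchings≡filter n = trans (matchings≡matchingsFilter n)
  (filter-char (isFPFInv (2 * n)) (matchingsFilter n) refl (λ _ _ → refl) (words (2 * n) (range (2 * n))))

T-not⁻ : ∀ {b} → T (not b) → ¬ T b
T-not⁻ {false} _ ()

T-not⁺ : ∀ {b} → ¬ T b → T (not b)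
T-not⁺ {false} _  = _
T-not⁺ {true}  ¬t = ¬t _

fresh⁻ : ∀ x ys → T (not (any (x ≡ᵇ_) ys)) → All (x ≢_) ys
fresh⁻ x []       _ = []
fresh⁻ x (y ∷ ys) t with x ≡ᵇ y in eq
... | false = (λ { refl → subst T eq (≡⇒≡ᵇ x x refl) }) ∷ fresh⁻ x ys t

fresh⁺ : ∀ x ys → All (x ≢_) ys → T (not (any (x ≡ᵇ_) ys))
fresh⁺ x []       _           = _
fresh⁺ x (y ∷ ys) (x≢y ∷ x∉) with x ≡ᵇ y in eq
... | false = fresh⁺ x ys x∉
... | true  = x≢y (≡ᵇ⇒≡ x y (subst T (sym eq) _))

distinct⁻ : ∀ xs → T (distinct xs) → Unique xs
distinct⁻ []       _ = []
distinct⁻ (x ∷ xs) t with Equivalence.to T-∧ t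
... | t₁ , t₂ = fresh⁻ x xs t₁ ∷ distinct⁻ xs t₂

distinct⁺ : ∀ xs → Unique xs → T (distinct xs)
distinct⁺ []       _           = _
distinct⁺ (x ∷ xs) (x∉ ∷ xs!) = Equivalence.from T-∧ (fresh⁺ x xs x∉ , distinct⁺ xs xs!)

∈-range⁻ : ∀ {n x} → x ∈ range n → 1 ≤ x × x ≤ n
∈-range⁻ {n} x∈ with ∈-map⁻ suc x∈
... | k , k∈ , refl = s≤s z≤n , ∈-upTo⁻ k∈

∈-range⁺ : ∀ {n x} → 1 ≤ x → x ≤ n → x ∈ range n
∈-range⁺ (s≤s _) x≤n = ∈-map⁺ suc (∈-upTo⁺ x≤n)

range-unique : ∀ n → Unique (range n)
range-unique n = Unique.map⁺ suc-injective (Unique.upTo⁺ n)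

inserts : X → List X → List (List X)
inserts c []      = [ [ c ] ]
inserts c (x ∷ w) = (c ∷ x ∷ w) ∷ map (x ∷_) (inserts c w)

data Insert (c : X) : List X → List X → Set where
  here  : ∀ {w} → Insert c w (c ∷ w)
  there : ∀ {x w u} → Insert c w u → Insert c (x ∷ w) (x ∷ u)

inserts⁻ : ∀ {c : X} w {u} → u ∈ inserts c w → Insert c w u
inserts⁻ []      (here refl) = here
inserts⁻ (x ∷ w) (here refl) = here
inserts⁻ (x ∷ w) (there u∈) with ∈-map⁻ (x ∷_) u∈
... | _ , v∈ , refl = there (inserts⁻ w v∈)

inserts⁺ : ∀ {c : X} {w u} → Insert c w u → u ∈ inserts c w
inserts⁺ {w = []}    here      = here refl
inserts⁺ {w = x ∷ w} here      = here refl
inserts⁺ {w = x ∷ w} (there i) = there (∈-map⁺ (x ∷_) (inserts⁺ i))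

inserts-unique : ∀ {c : X} w → c ∉ w → Unique (inserts c w)
inserts-unique []      c∉ = [] ∷ []
inserts-unique (x ∷ w) c∉ = All.tabulate other-head ∷ Unique.map⁺ (λ { refl → refl }) (inserts-unique w (c∉ ∘ there))
  where
  other-head : ∀ {u} → u ∈ map (x ∷_) (inserts _ w) → _ ∷ x ∷ w ≢ u
  other-head u∈ refl with ∈-map⁻ (x ∷_) u∈
  ... | _ , _ , refl = c∉ (here refl)

Insert-length : ∀ {c : X} {w u} → Insert c w u → length u ≡ suc (length w)
Insert-length here      = refl
Insert-length (there i) = cong suc (Insert-length i)

Insert-All⁺ : ∀ {P : X → Set} {c w u} → Insert c w u → P c → All P w → All P u
Insert-All⁺ here      pc pw        = pc ∷ pw
Insert-All⁺ (there i) pc (px ∷ pw) = px ∷ Insert-All⁺ i pc pw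

Insert-∈ : ∀ {c : X} {w u} → Insert c w u → c ∈ u
Insert-∈ here      = here refl
Insert-∈ (there i) = there (Insert-∈ i)

-- Permutations and signed permutations differ only in how many letters have absolute value n + 1:
-- `new n` has one element for the former and two for the latter.
module Arrangements {X : Set} (∥_∥ : X → ℕ) (letters new : ℕ → List X)
  (letters-unique : ∀ n → Unique (letters n)) (new-unique : ∀ n → Unique (new n))
  (∈-letters⁻ : ∀ {n x} → x ∈ letters n → 1 ≤ ∥ x ∥ × ∥ x ∥ ≤ n)
  (∈-letters⁺ : ∀ {n x} → 1 ≤ ∥ x ∥ → ∥ x ∥ ≤ n → x ∈ letters n)
  (∈-new⁻ : ∀ {n x} → x ∈ new n → ∥ x ∥ ≡ suc n)
  (∈-new⁺ : ∀ {n x} → ∥ x ∥ ≡ suc n → x ∈ new n) where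

  arrangements : ℕ → List (List X)
  arrangements n = filterᵇ (λ w → distinct (map ∥_∥ w)) (words n (letters n))

  Distinct : List X → Set
  Distinct = AllPairs (λ x y → ∥ x ∥ ≢ ∥ y ∥)

  record Arrangement (n : ℕ) (w : List X) : Set where
    constructor arrangement
    field
      length≡  : length w ≡ n
      bounded  : All (λ x → 1 ≤ ∥ x ∥ × ∥ x ∥ ≤ n) w
      pairwise : Distinct w
  open Arrangement

  arrangements⁻ : ∀ {n w} → w ∈ arrangements n → Arrangement n w
  arrangements⁻ {n} {w} w∈ with ∈-filter⁻ (λ w → T? (distinct (map ∥_∥ w))) {xs = words n (letters n)} w∈
  ... | w∈ , t with ∈-words⁻ n (letters n) w∈
  ... | len , w⊆ = arrangement len (All.map ∈-letters⁻ w⊆) (AllPairs.map⁻ (distinct⁻ (map ∥_∥ w) t))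

  arrangements⁺ : ∀ {n w} → Arrangement n w → w ∈ arrangements n
  arrangements⁺ {n} {w} (arrangement len b d) = ∈-filter⁺ (λ w → T? (distinct (map ∥_∥ w)))
    (∈-words⁺ n (letters n) len (All.map (λ (1≤ , ≤n) → ∈-letters⁺ 1≤ ≤n) b))
    (distinct⁺ (map ∥_∥ w) (AllPairs.map⁺ d))

  arrangements-unique : ∀ n → Unique (arrangements n)
  arrangements-unique n = Unique.filter⁺ _ (words-unique n (letters-unique n))

  other? : ∀ m x → Dec (∥ x ∥ ≢ m)
  other? m x = ¬? (∥ x ∥ ≟ m)

  remove : ℕ → List X → List X
  remove m = filter (other? m)

  remove-fresh : ∀ m {w} → All (λ x → ∥ x ∥ ≢ m) w → remove m w ≡ w
  remove-fresh m = filter-all (other? m)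

  remove-Insert : ∀ {c w u} → Insert c w u → All (λ x → ∥ x ∥ ≢ ∥ c ∥) w → remove ∥ c ∥ u ≡ w
  remove-Insert {c} here      fresh        = trans (filter-reject (other? ∥ c ∥) (λ ≢ → ≢ refl)) (remove-fresh ∥ c ∥ fresh)
  remove-Insert {c} (there i) (x≢ ∷ fresh) = trans (filter-accept (other? ∥ c ∥) x≢) (cong (_ ∷_) (remove-Insert i fresh))

  Insert-remove : ∀ {c u} → Distinct u → c ∈ u → Insert c (remove ∥ c ∥ u) u
  Insert-remove {c} {_ ∷ u} (c∉ ∷ d) (here refl) = subst (λ w → Insert c w (c ∷ u))
    (sym (trans (filter-reject (other? ∥ c ∥) (λ ≢ → ≢ refl)) (remove-fresh ∥ c ∥ (All.map (λ ≢ eq → ≢ (sym eq)) c∉)))) here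
  Insert-remove {c} {x ∷ u} (x∉ ∷ d) (there c∈) = subst (λ w → Insert c w (x ∷ u))
    (sym (filter-accept (other? ∥ c ∥) (All.lookup x∉ c∈))) (there (Insert-remove d c∈))

  Insert-Distinct : ∀ {c w u} → Insert c w u → All (λ x → ∥ x ∥ ≢ ∥ c ∥) w → Distinct w → Distinct u
  Insert-Distinct here      fresh        d        = All.map (λ ≢ eq → ≢ (sym eq)) fresh ∷ d
  Insert-Distinct (there i) (x≢ ∷ fresh) (x∉ ∷ d) = Insert-All⁺ i x≢ x∉ ∷ Insert-Distinct i fresh d

  -- Pigeonhole, by deleting the letter of absolute value n + 1 if there is one. Hence an
  -- arrangement of length n + 1 must contain that letter, which makes `remove` undo an insertion.
  bounded-length : ∀ n {w} → All (λ x → 1 ≤ ∥ x ∥ × ∥ x ∥ ≤ n) w → Distinct w → length w ≤ n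
  find-max : ∀ n {w} → All (λ x → 1 ≤ ∥ x ∥ × ∥ x ∥ ≤ suc n) w →
    (∃ λ c → c ∈ w × ∥ c ∥ ≡ suc n) ⊎ All (λ x → 1 ≤ ∥ x ∥ × ∥ x ∥ ≤ n) w
  find-max n {w} b with any? (λ x → ∥ x ∥ ≟ suc n) w
  ... | yes c∈ = inj₁ (find c∈)
  ... | no  c∉ = inj₂ (All.zipWith (λ ((1≤ , ≤n) , ≢) → 1≤ , ≤-pred (≤∧≢⇒< ≤n ≢)) (b , All.¬Any⇒All¬ w c∉))

  remove-bounded : ∀ n {w} → All (λ x → 1 ≤ ∥ x ∥ × ∥ x ∥ ≤ suc n) w → All (λ x → 1 ≤ ∥ x ∥ × ∥ x ∥ ≤ n) (remove (suc n) w)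
  remove-bounded n {w} b = All.zipWith (λ ((1≤ , ≤n) , ≢) → 1≤ , ≤-pred (≤∧≢⇒< ≤n ≢))
    (All.filter⁺ _ b , All.all-filter _ w)

  bounded-length zero    []                 d = z≤n
  bounded-length zero    ((1≤ , ≤0) ∷ _) d = contradiction (≤-trans 1≤ ≤0) λ ()
  bounded-length (suc n) {w} b d with find-max n b
  ... | inj₂ b′ = m≤n⇒m≤1+n (bounded-length n b′ d)
  ... | inj₁ (c , c∈ , eq) = subst (_≤ suc n) (sym (Insert-length (Insert-remove d c∈)))
    (s≤s (subst (λ m → length (remove m w) ≤ n) (sym eq) (bounded-length n (remove-bounded n b) (AllPairs.filter⁺ _ d))))

  insertions : ℕ → List X → List (List X)
  insertions n w = concatMap (λ c → inserts c w) (new n)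

  Fresh : ℕ → List X → Set
  Fresh n = All (λ x → ∥ x ∥ ≢ suc n)

  fresh : ∀ {n w} → Arrangement n w → Fresh n w
  fresh a = All.map (λ (_ , ≤n) eq → <-irrefl eq (s≤s ≤n)) (bounded a)

  -- Two insertions into w with the same result use the same letter: the first letter occurs in the
  -- result and, being fresh, is not in w, so it is the second one.
  insertions-unique : ∀ n {w} → Fresh n w → Unique (insertions n w)
  insertions-unique n {w} fr = concatMap-unique (new-unique n)
    (λ c∈ → inserts-unique w (λ c∈w → All.lookup fr c∈w (∈-new⁻ c∈)))
    (λ c∈ _ u∈ u∈′ → same c∈ (inserts⁻ w u∈) (inserts⁻ w u∈′))
    where
    same : ∀ {c c′ u} → c ∈ new n → Insert c w u → Insert c′ w u → c ≡ c′
    same {c} {c′} c∈ i i′ with All.lookup (Insert-All⁺ {P = λ x → x ≡ c′ ⊎ x ∈ w} i′ (inj₁ refl) (All.tabulate inj₂)) (Insert-∈ i)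
    ... | inj₁ eq  = eq
    ... | inj₂ c∈w = ⊥-elim (All.lookup fr c∈w (∈-new⁻ c∈))

  sumOver-arrangements : ∀ n f → sumOver f (arrangements (suc n)) ≡
    sumOver (λ w → sumOver (λ c → sumOver f (inserts c w)) (new n)) (arrangements n)
  sumOver-arrangements n f = trans
    (sumOver-fibres (remove (suc n)) (insertions n) (arrangements-unique n) (arrangements-unique (suc n))
      (λ w∈ → insertions-unique n (fresh (arrangements⁻ w∈))) up down f)
    (sumOver-cong-∈ (arrangements n) (λ {w} _ → sumOver-concatMap f (λ c → inserts c w) (new n)))
    where
    up : ∀ {w u} → w ∈ arrangements n → u ∈ insertions n w → u ∈ arrangements (suc n) × remove (suc n) u ≡ w
    up {w} {u} w∈ u∈ with find (∈-concatMap⁻ (λ c → inserts c w) {new n} u∈)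
    ... | c , c∈ , u∈c = arrangements⁺ (arrangement
            (trans (Insert-length i) (cong suc (length≡ a)))
            (Insert-All⁺ i (subst (1 ≤_) (sym eq) (s≤s z≤n) , ≤-reflexive eq) (All.map (λ (1≤ , ≤n) → 1≤ , m≤n⇒m≤1+n ≤n) (bounded a)))
            (Insert-Distinct i fr (pairwise a)))
        , subst (λ m → remove m u ≡ w) eq (remove-Insert i fr)
      where
      a = arrangements⁻ w∈
      i = inserts⁻ w u∈c
      eq = ∈-new⁻ c∈
      fr = subst (λ m → All (λ x → ∥ x ∥ ≢ m) w) (sym eq) (fresh a)
    down : ∀ {u} → u ∈ arrangements (suc n) → remove (suc n) u ∈ arrangements n × u ∈ insertions n (remove (suc n) u)
    down {u} u∈ with arrangements⁻ u∈
    ... | arrangement len b d with find-max n b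
    ...   | inj₂ b′ = ⊥-elim (<-irrefl refl (subst (_≤ n) len (bounded-length n b′ d)))
    ...   | inj₁ (c , c∈ , eq) = arrangements⁺ (arrangement
              (suc-injective (trans (sym (Insert-length i)) len)) (remove-bounded n b) (AllPairs.filter⁺ _ d))
          , ∈-concatMap⁺ (λ c → inserts c (remove (suc n) u)) (lose (∈-new⁺ eq) (inserts⁺ i))
      where
      i : Insert c (remove (suc n) u) u
      i = subst (λ m → Insert c (remove m u) u) eq (Insert-remove d c∈)

⟦_⟧ : Bool → ℕ
⟦ b ⟧ = if b then 1 else 0

*-δ : ∀ (α : ℕ → ℕ) k p → α p * δ k p ≡ α k * δ k p
*-δ α k p with p ≟ k
... | yes refl = refl
... | no  p≢k  rewrite δ-≢ p≢k = trans (*-zeroʳ (α p)) (sym (*-zeroʳ (α k)))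

-- The step is required for all f, that is, for the distribution of the statistic as a whole; `δ k`
-- extracts column k. `lpk-step` and `ipk-step` have this form and serve a second time in `XD^-φ`
-- and `XD^-θ`.
count-isTriangle : ∀ {α β} (L : ℕ → List X) (stat : ℕ → X → ℕ) →
  (∀ f → sumOver (f ∘ stat 0) (L 0) ≡ f 0) →
  (∀ n f → sumOver (f ∘ stat (suc n)) (L (suc n)) ≡
    sumOver (λ w → α (stat n w) * f (stat n w) + β n (stat n w) * f (suc (stat n w))) (L n)) →
  IsTriangle α β (λ n k → sumOver (δ k ∘ stat n) (L n))
count-isTriangle {α = α} {β} L stat base step = record
  { base-zero = base (δ 0)
  ; base-suc  = λ k → base (δ (suc k))
  ; step-zero = λ n → trans (step n (δ 0)) (trans
      (sumOver-cong-∈ (L n) λ {w} _ → trans (cong₂ _+_ (*-δ α 0 (stat n w)) (*-zeroʳ (β n (stat n w)))) (+-identityʳ _))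
      (sumOver-* (α 0) (δ 0 ∘ stat n) (L n)))
  ; step-suc  = λ n k → trans (step n (δ (suc k))) (trans
      (sumOver-cong-∈ (L n) λ {w} _ → cong₂ _+_ (*-δ α (suc k) (stat n w)) (*-δ (β n) k (stat n w)))
      (trans (sumOver-+ (λ w → α (suc k) * δ (suc k) (stat n w)) (λ w → β n k * δ k (stat n w)) (L n))
        (cong₂ _+_ (sumOver-* (α (suc k)) (δ (suc k) ∘ stat n) (L n)) (sumOver-* (β n k) (δ k ∘ stat n) (L n)))))
  }

-- Permutations and signed permutations as arrangements.

∈-singleton⁻ : ∀ {n x} → x ∈ [ suc n ] → x ≡ suc n
∈-singleton⁻ (here eq) = eq

module Perms = Arrangements id range (λ n → [ suc n ]) range-unique (λ n → [] ∷ [])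
  ∈-range⁻ ∈-range⁺ ∈-singleton⁻ here

perms≡ : ∀ n → perms n ≡ Perms.arrangements n
perms≡ n = trans (perms≡permsFilter n) (filter-char (λ w → distinct (map id w)) (permsFilter n) refl
  (λ w ws → cong (λ v → if distinct v then w ∷ permsFilter n ws else permsFilter n ws) (sym (map-id w)))
  (words n (range n)))

∈-signed⁻ : ∀ {n x} → x ∈ signedRange n → 1 ≤ ∣ x ∣ × ∣ x ∣ ≤ n
∈-signed⁻ {n} x∈ with ∈-++⁻ (map ℤ.+_ (range n)) x∈
... | inj₁ x∈⁺ with ∈-map⁻ ℤ.+_ x∈⁺
...   | k , k∈ , refl = ∈-range⁻ k∈
∈-signed⁻ {n} x∈ | inj₂ x∈⁻ with ∈-map⁻ ℤ.-_ x∈⁻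
... | y , y∈ , refl with ∈-map⁻ ℤ.+_ y∈
...   | k , k∈ , refl = subst (λ m → 1 ≤ m × m ≤ n) (sym (ℤ.∣-i∣≡∣i∣ (ℤ.+ k))) (∈-range⁻ k∈)

∈-signed⁺ : ∀ {n x} → 1 ≤ ∣ x ∣ → ∣ x ∣ ≤ n → x ∈ signedRange n
∈-signed⁺ {n} {ℤ.+ k}      1≤ ≤n = ∈-++⁺ˡ (∈-map⁺ ℤ.+_ (∈-range⁺ 1≤ ≤n))
∈-signed⁺ {n} { -[1+ k ] } 1≤ ≤n = ∈-++⁺ʳ (map ℤ.+_ (range n)) (∈-map⁺ ℤ.-_ (∈-map⁺ ℤ.+_ (∈-range⁺ 1≤ ≤n)))

signed-unique : ∀ n → Unique (signedRange n)
signed-unique n = Unique.++⁺ pos! (Unique.map⁺ ℤ.neg-injective pos!) disjoint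
  where
  pos! = Unique.map⁺ ℤ.+-injective (range-unique n)
  disjoint : ∀ {x} → ¬ (x ∈ map ℤ.+_ (range n) × x ∈ map ℤ.-_ (map ℤ.+_ (range n)))
  disjoint (x∈⁺ , x∈⁻) with ∈-map⁻ ℤ.-_ x∈⁻
  ... | y , y∈ , refl with ∈-map⁻ ℤ.+_ y∈
  ...   | k , k∈ , refl with k | ∈-range⁻ k∈ | ∈-map⁻ ℤ.+_ x∈⁺
  ...     | zero  | () , _ | _
  ...     | suc _ | _      | _ , _ , ()

∈-±⁻ : ∀ {n x} → x ∈ ℤ.+ suc n ∷ -[1+ n ] ∷ [] → ∣ x ∣ ≡ suc n
∈-±⁻ (here refl)         = refl
∈-±⁻ (there (here refl)) = refl

∈-±⁺ : ∀ {n x} → ∣ x ∣ ≡ suc n → x ∈ ℤ.+ suc n ∷ -[1+ n ] ∷ []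
∈-±⁺ {x = ℤ.+ _}    refl = here refl
∈-±⁺ {x = -[1+ _ ]} refl = there (here refl)

±-unique : ∀ n → Unique (ℤ.+ suc n ∷ -[1+ n ] ∷ [])
±-unique n = ((λ ()) ∷ []) ∷ [] ∷ []

module SignedPerms = Arrangements ∣_∣ signedRange (λ n → ℤ.+ suc n ∷ -[1+ n ] ∷ []) signed-unique ±-unique
  ∈-signed⁻ ∈-signed⁺ ∈-±⁻ ∈-±⁺

-- Peaks and descents

<⇒<ᵇ≡true : ∀ {m n} → m < n → (m <ᵇ n) ≡ true
<⇒<ᵇ≡true m<n = Equivalence.to T-≡ (<⇒<ᵇ m<n)

≤⇒<ᵇ≡false : ∀ {m n} → n ≤ m → (m <ᵇ n) ≡ false
≤⇒<ᵇ≡false {m} {n} n≤m = ¬-not λ eq → <⇒≱ (<ᵇ⇒< m n (Equivalence.from T-≡ eq)) n≤m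

peaks-drop : ∀ x y w → (x <ᵇ y) ≡ false → peaks (x ∷ y ∷ w) ≡ peaks (y ∷ w)
peaks-drop x y []      _   = refl
peaks-drop x y (z ∷ w) x≮y rewrite x≮y = refl

peaks-top : ∀ {m x y} w → x < m → y < m → peaks (x ∷ m ∷ y ∷ w) ≡ suc (peaks (y ∷ w))
peaks-top {m} {x} {y} w x<m y<m rewrite <⇒<ᵇ≡true x<m | <⇒<ᵇ≡true y<m =
  cong suc (peaks-drop m y w (≤⇒<ᵇ≡false (<⇒≤ y<m)))

peaks-low : ∀ {m y} x w → y < m → peaks (x ∷ y ∷ m ∷ w) ≡ peaks (y ∷ m ∷ w)
peaks-low {m} {y} x w y<m rewrite ≤⇒<ᵇ≡false (<⇒≤ y<m) | ∧-zeroʳ (x <ᵇ y) = refl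

peak⇒≮ : ∀ x y z → ((x <ᵇ y) ∧ (z <ᵇ y)) ≡ true → (y <ᵇ z) ≡ false
peak⇒≮ x y z isPeak = ≤⇒<ᵇ≡false (<⇒≤ (<ᵇ⇒< z y (proj₂ (Equivalence.to T-∧ (Equivalence.from T-≡ isPeak)))))

-- Inserting a new maximum creates a peak, except next to an old peak (two places) or at the end.
peaks-insert : ∀ m x w → x < m → All (_< m) w → ∀ (f : ℕ → ℕ) → ∃ λ e →
  length w ≡ double (peaks (x ∷ w)) + e ×
  sumOver (λ u → f (peaks (x ∷ u))) (inserts m w) ≡
    suc (double (peaks (x ∷ w))) * f (peaks (x ∷ w)) + e * f (suc (peaks (x ∷ w)))
peaks-insert m x [] x<m _ f = 0 , refl , eq (f 0)
  where
  eq : ∀ a → a + 0 ≡ 1 * a + 0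
  eq = solve-∀
peaks-insert m x (y ∷ []) x<m (y<m ∷ []) f = 1 , refl , trans
  (cong₂ (λ p q → f p + (f q + 0)) (peaks-top [] x<m y<m) (peaks-low x [] y<m)) (eq (f 0) (f 1))
  where
  eq : ∀ a b → b + (a + 0) ≡ 1 * a + 1 * b
  eq = solve-∀
peaks-insert m x (y ∷ z ∷ w) x<m (y<m ∷ z<m ∷ w<m) f
  with peaks-insert m y (z ∷ w) y<m (z<m ∷ w<m) f | peaks-insert m z w z<m w<m (f ∘ suc)
     | (x <ᵇ y) ∧ (z <ᵇ y) in isPeak
... | e , len , sum≡ | _ | false = suc e , trans (cong suc len) (sym (+-suc _ e)) , (begin
  f (peaks (x ∷ m ∷ y ∷ z ∷ w)) + sumOver (λ u → f (peaks (x ∷ u))) (map (y ∷_) (inserts m (z ∷ w)))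
    ≡⟨ cong₂ _+_ (cong f (peaks-top (z ∷ w) x<m y<m)) (sumOver-map _ (y ∷_) (inserts m (z ∷ w))) ⟩
  f (suc p) + sumOver (λ u → f (peaks (x ∷ y ∷ u))) (inserts m (z ∷ w))
    ≡⟨ cong (f (suc p) +_) (cong₂ _+_ (cong f (peaks-low x (z ∷ w) y<m)) (begin
         sumOver (λ u → f (peaks (x ∷ y ∷ u))) (map (z ∷_) (inserts m w))
           ≡⟨ sumOver-map _ (z ∷_) (inserts m w) ⟩
         sumOver (λ u → f (peaks (x ∷ y ∷ z ∷ u))) (inserts m w)
           ≡⟨ sumOver-cong-∈ (inserts m w) (λ {u} _ → cong (λ b → f (⟦ b ⟧ + peaks (y ∷ z ∷ u))) isPeak) ⟩
         sumOver (λ u → f (peaks (y ∷ z ∷ u))) (inserts m w)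
           ≡⟨ sym (sumOver-map _ (z ∷_) (inserts m w)) ⟩
         sumOver (λ u → f (peaks (y ∷ u))) (map (z ∷_) (inserts m w)) ∎)) ⟩
  f (suc p) + sumOver (λ u → f (peaks (y ∷ u))) (inserts m (z ∷ w))
    ≡⟨ cong (f (suc p) +_) sum≡ ⟩
  f (suc p) + (suc (double p) * f p + e * f (suc p))
    ≡⟨ eq (double p) e (f p) (f (suc p)) ⟩
  suc (double p) * f p + suc e * f (suc p) ∎)
  where
  open ≡-Reasoning
  p = peaks (y ∷ z ∷ w)
  eq : ∀ d e a b → b + (suc d * a + e * b) ≡ suc d * a + suc e * b
  eq = solve-∀
-- `y` is a peak: `m` on either side of it merely replaces this peak. The remaining places lie
-- behind `z`, with one peak already counted; hence the recursion at `f ∘ suc`.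
peaks-insert m x (y ∷ z ∷ w) x<m (y<m ∷ z<m ∷ w<m) f | _ | e , len , sum≡ | true = e , trans (cong (suc ∘ suc) len) (cong (λ r → double (suc r) + e) (sym (peaks-drop y z w y≮z))) , (begin
  f (peaks (x ∷ m ∷ y ∷ z ∷ w)) + sumOver (λ u → f (peaks (x ∷ u))) (map (y ∷_) (inserts m (z ∷ w)))
    ≡⟨ cong₂ _+_ (cong f (trans (peaks-top (z ∷ w) x<m y<m) (cong suc (peaks-drop y z w y≮z))))
         (sumOver-map _ (y ∷_) (inserts m (z ∷ w))) ⟩
  f (suc q) + (f (peaks (x ∷ y ∷ m ∷ z ∷ w)) + sumOver (λ u → f (peaks (x ∷ y ∷ u))) (map (z ∷_) (inserts m w)))
    ≡⟨ cong (f (suc q) +_) (cong₂ _+_ (cong f (trans (peaks-low x (z ∷ w) y<m) (peaks-top w y<m z<m)))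
         (sumOver-map _ (z ∷_) (inserts m w))) ⟩
  f (suc q) + (f (suc q) + sumOver (λ u → f (peaks (x ∷ y ∷ z ∷ u))) (inserts m w))
    ≡⟨ cong (λ t → f (suc q) + (f (suc q) + t)) (sumOver-cong-∈ (inserts m w) λ {u} _ →
         trans (cong (λ b → f (⟦ b ⟧ + peaks (y ∷ z ∷ u))) isPeak) (cong (f ∘ suc) (peaks-drop y z u y≮z))) ⟩
  f (suc q) + (f (suc q) + sumOver (λ u → f (suc (peaks (z ∷ u)))) (inserts m w))
    ≡⟨ cong (λ t → f (suc q) + (f (suc q) + t)) sum≡ ⟩
  f (suc q) + (f (suc q) + (suc (double q) * f (suc q) + e * f (suc (suc q))))
    ≡⟨ eq (double q) e (f (suc q)) (f (suc (suc q))) ⟩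
  suc (suc (suc (double q))) * f (suc q) + e * f (suc (suc q))
    ≡⟨ cong (λ r → suc (double (suc r)) * f (suc r) + e * f (suc (suc r))) (sym (peaks-drop y z w y≮z)) ⟩
  suc (double (suc (peaks (y ∷ z ∷ w)))) * f (suc (peaks (y ∷ z ∷ w))) + e * f (suc (suc (peaks (y ∷ z ∷ w)))) ∎)
  where
  open ≡-Reasoning
  q = peaks (z ∷ w)
  y≮z = peak⇒≮ x y z isPeak
  eq : ∀ d e a b → a + (a + (suc d * a + e * b)) ≡ suc (suc (suc d)) * a + e * b
  eq = solve-∀

descents : (X → X → Bool) → List X → ℕ
descents lt (x ∷ rest@(y ∷ _)) = ⟦ lt y x ⟧ + descents lt rest
descents lt _                  = 0

module _ (lt : X → X → Bool) where

  open ≡-Reasoning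

  -- A new maximum behind x adds a descent unless it lands inside an old descent or at the end: d +
  -- 1 neutral places and e others.
  descents-insert-max : ∀ m x w → lt m x ≡ false → All (λ y → lt y m ≡ true × lt m y ≡ false) w → ∀ (f : ℕ → ℕ) → ∃ λ e →
    length w ≡ descents lt (x ∷ w) + e ×
    sumOver (λ u → f (descents lt (x ∷ u))) (inserts m w) ≡
      suc (descents lt (x ∷ w)) * f (descents lt (x ∷ w)) + e * f (suc (descents lt (x ∷ w)))
  descents-insert-max m x [] m≮x [] f rewrite m≮x = 0 , refl , eq (f 0)
    where
    eq : ∀ a → a + 0 ≡ 1 * a + 0
    eq = solve-∀
  descents-insert-max m x (y ∷ w) m≮x ((y<m , m≮y) ∷ w<m) f
    rewrite m≮x | y<m | sumOver-map (λ u → f (descents lt (x ∷ u))) (y ∷_) (inserts m w)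
    with lt y x | descents-insert-max m y w m≮y w<m (λ d → f (⟦ lt y x ⟧ + d))
  ... | true  | e , len , sum≡ = e , cong suc len , trans (cong (f (suc d) +_) sum≡) (eq d e (f (suc d)) (f (suc (suc d))))
    where
    d = descents lt (y ∷ w)
    eq : ∀ d e a b → a + (suc d * a + e * b) ≡ suc (suc d) * a + e * b
    eq = solve-∀
  ... | false | e , len , sum≡ = suc e , trans (cong suc len) (sym (+-suc _ e)) ,
      trans (cong (f (suc d) +_) sum≡) (eq d e (f d) (f (suc d)))
    where
    d = descents lt (y ∷ w)
    eq : ∀ d e a b → b + (suc d * a + e * b) ≡ suc d * a + suc e * b
    eq = solve-∀

  -- A new minimum behind x adds a descent unless it lands inside an old descent. At the end it adds
  -- one too, whence `suc e`.
  descents-insert-min : ∀ m x w → lt m x ≡ true → All (λ y → lt y m ≡ false × lt m y ≡ true) w → ∀ (f : ℕ → ℕ) → ∃ λ e →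
    length w ≡ descents lt (x ∷ w) + e ×
    sumOver (λ u → f (descents lt (x ∷ u))) (inserts m w) ≡
      descents lt (x ∷ w) * f (descents lt (x ∷ w)) + suc e * f (suc (descents lt (x ∷ w)))
  descents-insert-min m x [] m<x [] f rewrite m<x = 0 , refl , eq (f 1)
    where
    eq : ∀ a → a + 0 ≡ 1 * a
    eq = solve-∀
  descents-insert-min m x (y ∷ w) m<x ((y≮m , m<y) ∷ w≮m) f
    rewrite m<x | y≮m | sumOver-map (λ u → f (descents lt (x ∷ u))) (y ∷_) (inserts m w)
    with lt y x | descents-insert-min m y w m<y w≮m (λ d → f (⟦ lt y x ⟧ + d))
  ... | true  | e , len , sum≡ = e , cong suc len , trans (cong (f (suc d) +_) sum≡) (eq d e (f (suc d)) (f (suc (suc d))))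
    where
    d = descents lt (y ∷ w)
    eq : ∀ d e a b → a + (d * a + suc e * b) ≡ suc d * a + suc e * b
    eq = solve-∀
  ... | false | e , len , sum≡ = suc e , trans (cong suc len) (sym (+-suc _ e)) ,
      trans (cong (f (suc d) +_) sum≡) (eq d e (f d) (f (suc d)))
    where
    d = descents lt (y ∷ w)
    eq : ∀ d e a b → b + (d * a + suc e * b) ≡ d * a + suc (suc e) * b
    eq = solve-∀

-- Insertion recurrences for peaks and descents.

sumOver-perms : ∀ n f → sumOver f (perms (suc n)) ≡ sumOver (λ w → sumOver f (inserts (suc n) w)) (perms n)
sumOver-perms n f = begin
  sumOver f (perms (suc n))
    ≡⟨ cong (sumOver f) (perms≡ (suc n)) ⟩
  sumOver f (Perms.arrangements (suc n))
    ≡⟨ Perms.sumOver-arrangements n f ⟩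
  sumOver (λ w → sumOver f (inserts (suc n) w) + 0) (Perms.arrangements n)
    ≡⟨ sumOver-cong-∈ (Perms.arrangements n) (λ _ → +-identityʳ _) ⟩
  sumOver (λ w → sumOver f (inserts (suc n) w)) (Perms.arrangements n)
    ≡⟨ cong (sumOver _) (sym (perms≡ n)) ⟩
  sumOver (λ w → sumOver f (inserts (suc n) w)) (perms n) ∎
  where open ≡-Reasoning

∈-perms⇒length : ∀ {n w} → w ∈ perms n → length w ≡ n
∈-perms⇒length {n} {w} w∈ = Perms.Arrangement.length≡ (Perms.arrangements⁻ (subst (w ∈_) (perms≡ n) w∈))

∈-perms⇒< : ∀ {n w} → w ∈ perms n → All (_< suc n) w
∈-perms⇒< {n} {w} w∈ = All.map (s≤s ∘ proj₂) (Perms.Arrangement.bounded (Perms.arrangements⁻ (subst (w ∈_) (perms≡ n) w∈)))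

∸-remainder : ∀ {n} d e → n ≡ d + e → n ∸ d ≡ e
∸-remainder d e refl = m+n∸m≡n d e

-- The 0 put in front plays the part of x in `peaks-insert`, so all n + 1 places are covered.
lpk-step : ∀ n (f : ℕ → ℕ) → sumOver (λ w → f (lpk w)) (perms (suc n)) ≡
  sumOver (λ w → suc (double (lpk w)) * f (lpk w) + (n ∸ double (lpk w)) * f (suc (lpk w))) (perms n)
lpk-step n f = trans (sumOver-perms n (λ w → f (lpk w))) (sumOver-cong-∈ (perms n) split)
  where
  split : ∀ {w} → w ∈ perms n → sumOver (λ w → f (lpk w)) (inserts (suc n) w) ≡
    suc (double (lpk w)) * f (lpk w) + (n ∸ double (lpk w)) * f (suc (lpk w))
  split {w} w∈ with peaks-insert (suc n) 0 w (s≤s z≤n) (∈-perms⇒< w∈) f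
  ... | e , len , sum≡ rewrite ∸-remainder {n} (double (lpk w)) e (trans (sym (∈-perms⇒length {n} w∈)) len) = sum≡

-- `peaks-insert` covers the places behind the first letter. The place in front of it gives no
-- interior peak and adds one to the neutral places.
ipk-step : ∀ n (f : ℕ → ℕ) → sumOver (λ w → f (ipk w)) (perms (suc (suc n))) ≡
  sumOver (λ w → suc (suc (double (ipk w))) * f (ipk w) + (n ∸ double (ipk w)) * f (suc (ipk w))) (perms (suc n))
ipk-step n f = trans (sumOver-perms (suc n) (λ w → f (ipk w))) (sumOver-cong-∈ (perms (suc n)) split)
  where
  split : ∀ {w} → w ∈ perms (suc n) → sumOver (λ w → f (ipk w)) (inserts (suc (suc n)) w) ≡
    suc (suc (double (ipk w))) * f (ipk w) + (n ∸ double (ipk w)) * f (suc (ipk w))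
  split {[]}    w∈ with () ← ∈-perms⇒length {suc n} w∈
  split {x ∷ w} w∈ with ∈-perms⇒< w∈
  ... | x<m ∷ w<m with peaks-insert (suc (suc n)) x w x<m w<m f
  ...   | e , len , sum≡ rewrite ∸-remainder {n} (double (ipk (x ∷ w))) e (trans (suc-injective (sym (∈-perms⇒length {suc n} w∈))) len) =
    trans (cong₂ _+_ (cong f (peaks-drop (suc (suc n)) x w (≤⇒<ᵇ≡false (<⇒≤ x<m)))) (trans (sumOver-map _ (x ∷_) (inserts (suc (suc n)) w)) sum≡))
      (sym (+-assoc (f (peaks (x ∷ w))) _ _))

lpk-bound : ∀ {n w} → w ∈ perms n → double (lpk w) ≤ n
lpk-bound {n} {w} w∈ with peaks-insert (suc n) 0 w (s≤s z≤n) (∈-perms⇒< w∈) id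
... | e , len , _ = subst (double (lpk w) ≤_) (trans (sym len) (∈-perms⇒length w∈)) (m≤m+n _ e)

ipk-bound : ∀ {n w} → w ∈ perms (suc n) → double (ipk w) ≤ n
ipk-bound {n} {[]}    w∈ with () ← ∈-perms⇒length {suc n} w∈
ipk-bound {n} {x ∷ w} w∈ with ∈-perms⇒< w∈
... | x<m ∷ w<m with peaks-insert (suc (suc n)) x w x<m w<m id
...   | e , len , _ = subst (double (ipk (x ∷ w)) ≤_) (trans (sym len) (suc-injective (∈-perms⇒length w∈))) (m≤m+n _ e)

des≡descents : ∀ w → des w ≡ descents _<ᵇ_ w
des≡descents []          = refl
des≡descents (x ∷ [])    = refl
des≡descents (x ∷ y ∷ w) = cong (⟦ y <ᵇ x ⟧ +_) (des≡descents (y ∷ w))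

desℤ≡descents : ∀ w → desℤ w ≡ descents _<ℤᵇ_ w
desℤ≡descents []          = refl
desℤ≡descents (x ∷ [])    = refl
desℤ≡descents (x ∷ y ∷ w) = cong (⟦ y <ℤᵇ x ⟧ +_) (desℤ≡descents (y ∷ w))

-- A maximum placed in front of a nonempty word adds a descent, so `suc e` = n - des places do,
-- against the e places behind the first letter.
des-step : ∀ n (f : ℕ → ℕ) → sumOver (λ w → f (des w)) (perms (suc n)) ≡
  sumOver (λ w → suc (des w) * f (des w) + (n ∸ des w) * f (suc (des w))) (perms n)
des-step n f = trans (sumOver-perms n (λ w → f (des w))) (sumOver-cong-∈ (perms n) split)
  where
  split : ∀ {w} → w ∈ perms n → sumOver (λ w → f (des w)) (inserts (suc n) w) ≡
    suc (des w) * f (des w) + (n ∸ des w) * f (suc (des w))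
  split {[]}    w∈ rewrite sym (∈-perms⇒length {n} w∈) = sym (+-identityʳ (f 0 + 0))
  split {x ∷ w} w∈ rewrite des≡descents (x ∷ w) with ∈-perms⇒< {n} w∈
  ... | x<m ∷ w<m with descents-insert-max _<ᵇ_ (suc n) x w (≤⇒<ᵇ≡false (<⇒≤ x<m))
                         (All.map (λ y<m → <⇒<ᵇ≡true y<m , ≤⇒<ᵇ≡false (<⇒≤ y<m)) w<m) f
  ...   | e , len , sum≡
      rewrite ∸-remainder {n} (descents _<ᵇ_ (x ∷ w)) (suc e) (trans (sym (∈-perms⇒length {n} w∈)) (trans (cong suc len) (sym (+-suc _ e)))) =
    trans (cong₂ _+_ (cong (λ b → f (⟦ b ⟧ + descents _<ᵇ_ (x ∷ w))) (<⇒<ᵇ≡true x<m))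
        (trans (sumOver-map (λ u → f (des u)) (x ∷_) (inserts (suc n) w))
          (trans (sumOver-cong-∈ (inserts (suc n) w) (λ {u} _ → cong f (des≡descents (x ∷ u)))) sum≡)))
      (eq (descents _<ᵇ_ (x ∷ w)) e (f (descents _<ᵇ_ (x ∷ w))) (f (suc (descents _<ᵇ_ (x ∷ w)))))
    where
    eq : ∀ d e a b → b + (suc d * a + e * b) ≡ suc d * a + suc e * b
    eq = solve-∀

signedPerms≡ : ∀ n → signedPerms n ≡ SignedPerms.arrangements n
signedPerms≡ n = trans (signedPerms≡signedPermsFilter n)
  (filter-char (λ w → distinct (map ∣_∣ w)) (signedPermsFilter n) refl (λ _ _ → refl)
    (words n (signedRange n)))

≤⇒≤ᵇ≡true : ∀ {m n} → m ≤ n → (m ≤ᵇ n) ≡ true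
≤⇒≤ᵇ≡true m≤n = Equivalence.to T-≡ (≤⇒≤ᵇ m≤n)

>⇒≤ᵇ≡false : ∀ {m n} → n < m → (m ≤ᵇ n) ≡ false
>⇒≤ᵇ≡false {m} {n} n<m = ¬-not λ eq → <⇒≱ n<m (≤ᵇ⇒≤ m n (Equivalence.from T-≡ eq))

<ℤᵇ-max : ∀ n x → ∣ x ∣ ≤ n → (x <ℤᵇ (ℤ.+ suc n)) ≡ true × ((ℤ.+ suc n) <ℤᵇ x) ≡ false
<ℤᵇ-max n (ℤ.+ k)  k≤n = cong not (>⇒≤ᵇ≡false {suc n} (s≤s k≤n)) , cong not (≤⇒≤ᵇ≡true (m≤n⇒m≤1+n k≤n))
<ℤᵇ-max n -[1+ k ] _   = refl , refl

<ℤᵇ-min : ∀ n x → ∣ x ∣ ≤ n → (x <ℤᵇ -[1+ n ]) ≡ false × (-[1+ n ] <ℤᵇ x) ≡ true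
<ℤᵇ-min n (ℤ.+ k)  _   = refl , refl
<ℤᵇ-min n -[1+ k ] k<n = cong not (≤⇒≤ᵇ≡true (<⇒≤ k<n)) , cong not (>⇒≤ᵇ≡false k<n)

double-+ : ∀ m n → double (m + n) ≡ double m + double n
double-+ zero    n = refl
double-+ (suc m) n = cong (suc ∘ suc) (double-+ m n)

-- Each place accepts the letters n + 1 and -(n + 1). With d descents and n = d + e, the maximum has
-- d + 1 neutral places and e others, the minimum d and e + 1. In total 2d + 1 choices keep d and 2e
-- + 1 = 2n + 1 - 2d raise it.
desB-step : ∀ n (f : ℕ → ℕ) → sumOver (λ w → f (desB w)) (signedPerms (suc n)) ≡
  sumOver (λ w → suc (double (desB w)) * f (desB w) + (suc (double n) ∸ double (desB w)) * f (suc (desB w))) (signedPerms n)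
desB-step n f = begin
  sumOver (λ w → f (desB w)) (signedPerms (suc n))
    ≡⟨ cong (sumOver (λ w → f (desB w))) (signedPerms≡ (suc n)) ⟩
  sumOver (λ w → f (desB w)) (SignedPerms.arrangements (suc n))
    ≡⟨ SignedPerms.sumOver-arrangements n (λ w → f (desB w)) ⟩
  _ ≡⟨ sumOver-cong-∈ (SignedPerms.arrangements n) split ⟩
  sumOver splitting (SignedPerms.arrangements n)
    ≡⟨ cong (sumOver splitting) (sym (signedPerms≡ n)) ⟩
  sumOver splitting (signedPerms n) ∎
  where
  open ≡-Reasoning
  splitting : List ℤ → ℕ
  splitting w = suc (double (desB w)) * f (desB w) + (suc (double n) ∸ double (desB w)) * f (suc (desB w))
  to-descents : ∀ c w → sumOver (λ w → f (desB w)) (inserts c w) ≡ sumOver (λ u → f (descents _<ℤᵇ_ (ℤ.+ 0 ∷ u))) (inserts c w)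
  to-descents c w = sumOver-cong-∈ (inserts c w) λ {u} _ → cong f (desℤ≡descents (ℤ.+ 0 ∷ u))
  split : ∀ {w} → w ∈ SignedPerms.arrangements n →
    sumOver (λ c → sumOver (λ w → f (desB w)) (inserts c w)) (ℤ.+ suc n ∷ -[1+ n ] ∷ []) ≡ splitting w
  split {w} w∈ rewrite desℤ≡descents (ℤ.+ 0 ∷ w) | to-descents (ℤ.+ suc n) w | to-descents -[1+ n ] w
    with SignedPerms.arrangements⁻ w∈
  ... | a with All.map proj₂ (SignedPerms.Arrangement.bounded a)
  ... | bound
    with descents-insert-max _<ℤᵇ_ (ℤ.+ suc n) (ℤ.+ 0) w refl (All.map (λ {x} → <ℤᵇ-max n x) bound) f
       | descents-insert-min _<ℤᵇ_ -[1+ n ] (ℤ.+ 0) w refl (All.map (λ {x} → <ℤᵇ-min n x) bound) f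
  ... | e , len , sum≡ | e′ , len′ , sum≡′ with +-cancelˡ-≡ (descents _<ℤᵇ_ (ℤ.+ 0 ∷ w)) e e′ (trans (sym len) len′)
  ... | refl rewrite ∸-remainder {suc (double n)} (double (descents _<ℤᵇ_ (ℤ.+ 0 ∷ w))) (suc (double e))
          (trans (cong (suc ∘ double) (trans (sym (SignedPerms.Arrangement.length≡ a)) len))
            (trans (cong suc (double-+ _ e)) (sym (+-suc _ (double e))))) =
    trans (cong₂ (λ p q → p + (q + 0)) sum≡ sum≡′) (trans (eq d e (f d) (f (suc d)))
      (sym (cong₂ (λ p q → suc p * f d + suc q * f (suc d)) (double≡+ d) (double≡+ e))))
    where
    d = descents _<ℤᵇ_ (ℤ.+ 0 ∷ w)
    eq : ∀ d e a b → suc d * a + e * b + (d * a + suc e * b + 0) ≡ suc (d + d) * a + suc (e + e) * b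
    eq = solve-∀

-- The combinatorial numbers as triangles.

Ptnk-triangle : ∀ n k → Ptnk n k ≡ triangle (λ k → suc (double k)) (λ n k → n ∸ double k) n k
Ptnk-triangle n k = trans (count≡sumOver (λ w → lpk w ≡ᵇ k) (perms n))
  (IsTriangle.≡-triangle (count-isTriangle perms (λ _ → lpk) (λ f → +-identityʳ (f 0)) lpk-step) n k)

-- The recurrence of `Ptnk` started one row later, from the single permutation of [1]: β sees n + 1
-- while α is unchanged. These are the weights of `topZ` for the d-family.
Ptnk-suc-triangle : ∀ n k → Ptnk (suc n) k ≡ triangle (λ k → suc (double k)) (λ n k → suc n ∸ double k) n k
Ptnk-suc-triangle n k = trans (count≡sumOver (λ w → lpk w ≡ᵇ k) (perms (suc n)))
  (IsTriangle.≡-triangle (count-isTriangle (perms ∘ suc) (λ _ → lpk) (λ f → +-identityʳ (f 0)) (lpk-step ∘ suc)) n k)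

Pnk-suc-triangle : ∀ n k → Pnk (suc n) k ≡ triangle (λ k → suc (suc (double k))) (λ n k → n ∸ double k) n k
Pnk-suc-triangle n k = trans (count≡sumOver (λ w → ipk w ≡ᵇ k) (perms (suc n)))
  (IsTriangle.≡-triangle (count-isTriangle (perms ∘ suc) (λ _ → ipk) (λ f → +-identityʳ (f 0)) ipk-step) n k)

Bnk-triangle : ∀ n k → Bnk n k ≡ triangle (λ k → suc (double k)) (λ n k → suc (double n) ∸ double k) n k
Bnk-triangle n k = trans (count≡sumOver (λ w → desB w ≡ᵇ k) (signedPerms n))
  (IsTriangle.≡-triangle (count-isTriangle signedPerms (λ _ → desB) (λ f → +-identityʳ (f 0)) desB-step) n k)

-- The factor 2^n doubles both weights k + 1 and n - k of the Eulerian recurrence, which yields the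
-- weights of the row sums of c.
eulerian-triangle : ∀ n k → 2 ^ n * eulerian n k ≡ triangle (λ k → suc (suc (double k))) (λ n k → double n ∸ double k) n k
eulerian-triangle n k = trans (cong (2 ^ n *_) (count≡sumOver (λ w → des w ≡ᵇ k) (perms n))) (IsTriangle.≡-triangle scaled n k)
  where
  desCount : ℕ → ℕ → ℕ
  desCount n k = sumOver (λ w → δ k (des w)) (perms n)
  open IsTriangle (count-isTriangle {α = suc} {_∸_} perms (λ _ → des) (λ f → +-identityʳ (f 0)) des-step)
  double-∸ : ∀ n k → double (n ∸ k) ≡ double n ∸ double k
  double-∸ n       zero    = refl
  double-∸ zero    (suc k) = refl
  double-∸ (suc n) (suc k) = double-∸ n k
  eq₀ : ∀ t a → 2 * t * (1 * a) ≡ 2 * (t * a)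
  eq₀ = solve-∀
  eq : ∀ t k m a b → 2 * t * (suc (suc k) * a + m * b) ≡ suc (suc (suc (suc (k + k)))) * (t * a) + (m + m) * (t * b)
  eq = solve-∀
  scaled : IsTriangle (λ k → suc (suc (double k))) (λ n k → double n ∸ double k) (λ n k → 2 ^ n * desCount n k)
  scaled = record
    { base-zero = refl
    ; base-suc  = λ _ → refl
    ; step-zero = λ n → trans (cong (2 ^ suc n *_) (step-zero n)) (eq₀ (2 ^ n) (desCount n 0))
    ; step-suc  = λ n k → trans (cong (2 ^ suc n *_) (step-suc n k))
        (trans (eq (2 ^ n) k (n ∸ k) (desCount n (suc k)) (desCount n k))
          (cong₂ (λ a b → suc (suc (suc (suc a))) * (2 ^ n * desCount n (suc k)) + b * (2 ^ n * desCount n k))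
            (sym (double≡+ k)) (trans (sym (double≡+ (n ∸ k))) (double-∸ n k))))
    }

-- Perfect matchings

abstract
  tabulate₁ : ℕ → (ℕ → ℕ) → List ℕ
  tabulate₁ m f = applyUpTo (f ∘ suc) m

  length-tabulate₁ : ∀ m f → length (tabulate₁ m f) ≡ m
  length-tabulate₁ m f = length-applyUpTo (f ∘ suc) m

  at-tabulate₁ : ∀ {m x} f → 1 ≤ x → x ≤ m → at (tabulate₁ m f) x ≡ f x
  at-tabulate₁ {suc m} {suc zero}    f _ _           = refl
  at-tabulate₁ {suc m} {suc (suc x)} f _ (s≤s x≤m) = at-tabulate₁ (f ∘ suc) (s≤s z≤n) x≤m

at-extensional : ∀ v w → length v ≡ length w → (∀ x → 1 ≤ x → x ≤ length v → at v x ≡ at w x) → v ≡ w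
at-extensional []      []      _   _    = refl
at-extensional (a ∷ v) (b ∷ w) len at≡ = cong₂ _∷_ (at≡ 1 (s≤s z≤n) (s≤s z≤n))
  (at-extensional v w (suc-injective len) λ { (suc x) _ x≤ → at≡ (suc (suc x)) (s≤s z≤n) (s≤s x≤) })

All⇒at : ∀ {P : ℕ → Set} {w} → All P w → ∀ x → 1 ≤ x → x ≤ length w → P (at w x)
All⇒at (px ∷ pw) (suc zero)    _ _         = px
All⇒at (px ∷ pw) (suc (suc x)) _ (s≤s x≤) = All⇒at pw (suc x) (s≤s z≤n) x≤

at⇒All : ∀ {P : ℕ → Set} w → (∀ x → 1 ≤ x → x ≤ length w → P (at w x)) → All P w
at⇒All []      _   = []
at⇒All (a ∷ w) pat = pat 1 (s≤s z≤n) (s≤s z≤n) ∷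
  at⇒All w λ { (suc x) _ x≤ → pat (suc (suc x)) (s≤s z≤n) (s≤s x≤) }

-- Only arguments in 1..m are constrained, so a function for m + 2 can be restricted to m without
-- being changed.
record Involutive (m : ℕ) (f : ℕ → ℕ) : Set where
  constructor involutive
  field
    positive   : ∀ x → 1 ≤ x → x ≤ m → 1 ≤ f x
    bounded    : ∀ x → 1 ≤ x → x ≤ m → f x ≤ m
    involution : ∀ x → 1 ≤ x → x ≤ m → f (f x) ≡ x
    no-fixed   : ∀ x → 1 ≤ x → x ≤ m → f x ≢ x
open Involutive

isPaired : List ℕ → ℕ → Bool
isPaired w x = (at w (at w x) ≡ᵇ x) ∧ not (at w x ≡ᵇ x)

matchingWords : ℕ → List (List ℕ)
matchingWords m = filterᵇ (isFPFInv m) (words m (range m))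

matchingWords⁻ : ∀ {m w} → w ∈ matchingWords m → length w ≡ m × Involutive m (at w)
matchingWords⁻ {m} {w} w∈ with ∈-filter⁻ (λ w → T? (isFPFInv m w)) {xs = words m (range m)} w∈
... | w∈ , t with ∈-words⁻ m (range m) w∈
... | refl , w⊆ = refl , involutive
  (λ x 1≤ ≤m → proj₁ (∈-range⁻ (All⇒at w⊆ x 1≤ ≤m)))
  (λ x 1≤ ≤m → proj₂ (∈-range⁻ (All⇒at w⊆ x 1≤ ≤m)))
  (λ x 1≤ ≤m → ≡ᵇ⇒≡ (at w (at w x)) x (proj₁ (Equivalence.to T-∧ (test x 1≤ ≤m))))
  (λ x 1≤ ≤m eq → T-not⁻ (proj₂ (Equivalence.to T-∧ (test x 1≤ ≤m))) (≡⇒≡ᵇ (at w x) x eq))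
  where
  test : ∀ x → 1 ≤ x → x ≤ length w → T (isPaired w x)
  test x 1≤ ≤m = All.lookup (All.all⁺ (isPaired w) (range (length w)) t) (∈-range⁺ 1≤ ≤m)

matchingWords⁺ : ∀ {m w} → length w ≡ m → Involutive m (at w) → w ∈ matchingWords m
matchingWords⁺ {m} {w} refl inv = ∈-filter⁺ (λ w → T? (isFPFInv m w))
  (∈-words⁺ m (range m) refl (at⇒All w λ x 1≤ ≤m → ∈-range⁺ (positive inv x 1≤ ≤m) (bounded inv x 1≤ ≤m)))
  (All.all⁻ (isPaired w) (All.tabulate λ {x} x∈ → let 1≤ , ≤m = ∈-range⁻ x∈ in Equivalence.from T-∧
    (≡⇒≡ᵇ (at w (at w x)) x (involution inv x 1≤ ≤m) , T-not⁺ (no-fixed inv x 1≤ ≤m ∘ ≡ᵇ⇒≡ (at w x) x))))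

Involutive-cong : ∀ {m f g} → (∀ x → 1 ≤ x → x ≤ m → f x ≡ g x) → Involutive m f → Involutive m g
Involutive-cong {m} {f} {g} f≡g inv = involutive
  (λ x 1≤ ≤m → subst (1 ≤_) (f≡g x 1≤ ≤m) (positive inv x 1≤ ≤m))
  (λ x 1≤ ≤m → subst (_≤ m) (f≡g x 1≤ ≤m) (bounded inv x 1≤ ≤m))
  (λ x 1≤ ≤m → trans (cong g (sym (f≡g x 1≤ ≤m)))
    (trans (sym (f≡g (f x) (positive inv x 1≤ ≤m) (bounded inv x 1≤ ≤m))) (involution inv x 1≤ ≤m)))
  (λ x 1≤ ≤m eq → no-fixed inv x 1≤ ≤m (trans (f≡g x 1≤ ≤m) eq))

abstract
  swap : ℕ → ℕ → ℕ → ℕ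
  swap i j x with x ≟ i | x ≟ j
  ... | yes _ | _     = j
  ... | no  _ | yes _ = i
  ... | no  _ | no  _ = x

  swap-left : ∀ i j → swap i j i ≡ j
  swap-left i j with i ≟ i
  ... | yes _   = refl
  ... | no  i≢i = ⊥-elim (i≢i refl)

  swap-right : ∀ i j → swap i j j ≡ i
  swap-right i j with j ≟ i | j ≟ j
  ... | yes eq | _       = eq
  ... | no  _  | yes _   = refl
  ... | no  _  | no  j≢j = ⊥-elim (j≢j refl)

  swap-other : ∀ i j {x} → x ≢ i → x ≢ j → swap i j x ≡ x
  swap-other i j {x} x≢i x≢j with x ≟ i | x ≟ j
  ... | yes eq | _      = ⊥-elim (x≢i eq)
  ... | no  _  | yes eq = ⊥-elim (x≢j eq)
  ... | no  _  | no  _  = refl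

  swap-involutive : ∀ i j x → swap i j (swap i j x) ≡ x
  swap-involutive i j x with x ≟ i | x ≟ j
  ... | yes refl | _        = swap-right i j
  ... | no  _    | yes refl = swap-left i j
  ... | no  x≢i  | no  x≢j  = swap-other i j x≢i x≢j

  swap-preserves : ∀ (P : ℕ → Set) i j x → P i → P j → P x → P (swap i j x)
  swap-preserves P i j x pi pj px with x ≟ i | x ≟ j
  ... | yes _ | _     = pj
  ... | no  _ | yes _ = pi
  ... | no  _ | no  _ = px

conjugate : ℕ → ℕ → (ℕ → ℕ) → ℕ → ℕ
conjugate i j f x = swap i j (f (swap i j x))

conjugate-involutive : ∀ i j f x → conjugate i j (conjugate i j f) x ≡ f x
conjugate-involutive i j f x = trans (swap-involutive i j _) (cong f (swap-involutive i j x))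

conjugate-Involutive : ∀ {m f} i j → 1 ≤ i → i ≤ m → 1 ≤ j → j ≤ m → Involutive m f → Involutive m (conjugate i j f)
conjugate-Involutive {m} {f} i j 1≤i i≤m 1≤j j≤m inv = involutive
  (λ x 1≤ ≤m → pos (f (t x)) (positive inv (t x) (pos x 1≤) (bnd x ≤m)))
  (λ x 1≤ ≤m → bnd (f (t x)) (bounded inv (t x) (pos x 1≤) (bnd x ≤m)))
  (λ x 1≤ ≤m → trans (cong (t ∘ f) (swap-involutive i j (f (t x))))
    (trans (cong t (involution inv (t x) (pos x 1≤) (bnd x ≤m))) (swap-involutive i j x)))
  (λ x 1≤ ≤m eq → no-fixed inv (t x) (pos x 1≤) (bnd x ≤m) (trans (sym (swap-involutive i j (f (t x)))) (cong t eq)))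
  where
  t = swap i j
  pos : ∀ x → 1 ≤ x → 1 ≤ t x
  pos x = swap-preserves (1 ≤_) i j x 1≤i 1≤j
  bnd : ∀ x → x ≤ m → t x ≤ m
  bnd x = swap-preserves (_≤ m) i j x i≤m j≤m

abstract
  addBlock : ℕ → (ℕ → ℕ) → ℕ → ℕ
  addBlock m f x with x ≟ suc m | x ≟ suc (suc m)
  ... | yes _ | _     = suc (suc m)
  ... | no  _ | yes _ = suc m
  ... | no  _ | no  _ = f x

  addBlock-fst : ∀ m f → addBlock m f (suc m) ≡ suc (suc m)
  addBlock-fst m f with suc m ≟ suc m
  ... | yes _ = refl
  ... | no  ≢ = ⊥-elim (≢ refl)

  addBlock-snd : ∀ m f → addBlock m f (suc (suc m)) ≡ suc m
  addBlock-snd m f with suc (suc m) ≟ suc m | suc (suc m) ≟ suc (suc m)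
  ... | yes eq | _     = ⊥-elim (<-irrefl (sym eq) (n<1+n _))
  ... | no  _  | yes _ = refl
  ... | no  _  | no  ≢ = ⊥-elim (≢ refl)

  addBlock-old : ∀ m f {x} → x ≤ m → addBlock m f x ≡ f x
  addBlock-old m f {x} x≤m with x ≟ suc m | x ≟ suc (suc m)
  ... | yes refl | _        = ⊥-elim (<-irrefl refl x≤m)
  ... | no  _    | yes refl = ⊥-elim (<-irrefl refl (<-trans (n<1+n _) x≤m))
  ... | no  _    | no  _    = refl

data Position (m : ℕ) : ℕ → Set where
  old : ∀ {x} → x ≤ m → Position m x
  fst : Position m (suc m)
  snd : Position m (suc (suc m))

position : ∀ {m x} → x ≤ suc (suc m) → Position m x
position {m} {x} x≤ with x ≟ suc (suc m) | x ≟ suc m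
... | yes refl | _        = snd
... | no  _    | yes refl = fst
... | no  ≢₂   | no  ≢₁   = old (≤-pred (≤∧≢⇒< (≤-pred (≤∧≢⇒< x≤ ≢₂)) ≢₁))

addBlock-Involutive : ∀ {m f} → Involutive m f → Involutive (suc (suc m)) (addBlock m f)
addBlock-Involutive {m} {f} inv = involutive
  (λ x 1≤ ≤m → pos 1≤ (position ≤m)) (λ x 1≤ ≤m → bnd 1≤ (position ≤m))
  (λ x 1≤ ≤m → inv′ 1≤ (position ≤m)) (λ x 1≤ ≤m → nf 1≤ (position ≤m))
  where
  pos : ∀ {x} → 1 ≤ x → Position m x → 1 ≤ addBlock m f x
  pos 1≤ (old {x} x≤m) = subst (1 ≤_) (sym (addBlock-old m f x≤m)) (positive inv x 1≤ x≤m)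
  pos 1≤ fst = subst (1 ≤_) (sym (addBlock-fst m f)) (s≤s z≤n)
  pos 1≤ snd = subst (1 ≤_) (sym (addBlock-snd m f)) (s≤s z≤n)
  bnd : ∀ {x} → 1 ≤ x → Position m x → addBlock m f x ≤ suc (suc m)
  bnd 1≤ (old {x} x≤m) = subst (_≤ suc (suc m)) (sym (addBlock-old m f x≤m)) (m≤n⇒m≤1+n (m≤n⇒m≤1+n (bounded inv x 1≤ x≤m)))
  bnd 1≤ fst = ≤-reflexive (addBlock-fst m f)
  bnd 1≤ snd = subst (_≤ suc (suc m)) (sym (addBlock-snd m f)) (n≤1+n (suc m))
  inv′ : ∀ {x} → 1 ≤ x → Position m x → addBlock m f (addBlock m f x) ≡ x
  inv′ 1≤ (old {x} x≤m) = trans (cong (addBlock m f) (addBlock-old m f x≤m))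
    (trans (addBlock-old m f (bounded inv x 1≤ x≤m)) (involution inv x 1≤ x≤m))
  inv′ 1≤ fst = trans (cong (addBlock m f) (addBlock-fst m f)) (addBlock-snd m f)
  inv′ 1≤ snd = trans (cong (addBlock m f) (addBlock-snd m f)) (addBlock-fst m f)
  nf : ∀ {x} → 1 ≤ x → Position m x → addBlock m f x ≢ x
  nf 1≤ (old {x} x≤m) eq = no-fixed inv x 1≤ x≤m (trans (sym (addBlock-old m f x≤m)) eq)
  nf 1≤ fst eq = <-irrefl (trans (sym eq) (addBlock-fst m f)) (n<1+n _)
  nf 1≤ snd eq = <-irrefl (trans (sym (addBlock-snd m f)) eq) (n<1+n _)

-- Once m + 1 and m + 2 are paired with each other, no x ≤ m can be sent to either, because g would
-- send that value back to x.
restrict-Involutive : ∀ {m g} → Involutive (suc (suc m)) g → g (suc (suc m)) ≡ suc m → Involutive m g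
restrict-Involutive {m} {g} inv gb = involutive
  (λ x 1≤ ≤m → positive inv x 1≤ (up ≤m))
  (λ x 1≤ ≤m → old-value x 1≤ ≤m (position (bounded inv x 1≤ (up ≤m))) refl)
  (λ x 1≤ ≤m → involution inv x 1≤ (up ≤m))
  (λ x 1≤ ≤m → no-fixed inv x 1≤ (up ≤m))
  where
  up : ∀ {x} → x ≤ m → x ≤ suc (suc m)
  up x≤m = m≤n⇒m≤1+n (m≤n⇒m≤1+n x≤m)
  ga : g (suc m) ≡ suc (suc m)
  ga = trans (cong g (sym gb)) (involution inv (suc (suc m)) (s≤s z≤n) ≤-refl)
  old-value : ∀ x → 1 ≤ x → x ≤ m → ∀ {y} → Position m y → g x ≡ y → g x ≤ m
  old-value x 1≤ ≤m (old y≤m) refl = y≤m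
  old-value x 1≤ ≤m fst eq = ⊥-elim (<-irrefl (trans (sym (involution inv x 1≤ (up ≤m))) (trans (cong g eq) ga)) (s≤s (m≤n⇒m≤1+n ≤m)))
  old-value x 1≤ ≤m snd eq = ⊥-elim (<-irrefl (trans (sym (involution inv x 1≤ (up ≤m))) (trans (cong g eq) gb)) (s≤s ≤m))

addBlock-restrict : ∀ {m g} → Involutive (suc (suc m)) g → g (suc (suc m)) ≡ suc m →
  ∀ x → x ≤ suc (suc m) → addBlock m g x ≡ g x
addBlock-restrict {m} {g} inv gb x x≤ = go (position x≤)
  where
  go : ∀ {x} → Position m x → addBlock m g x ≡ g x
  go (old x≤m) = addBlock-old m g x≤m
  go fst = trans (addBlock-fst m g) (sym (trans (cong g (sym gb)) (involution inv (suc (suc m)) (s≤s z≤n) ≤-refl)))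
  go snd = trans (addBlock-snd m g) (sym gb)

-- Every matching of [m+2] arises exactly once from a matching of [m] by adding the block
-- {m+1, m+2} and exchanging m+1 with some j ≤ m+1: j is the partner of m+2.
extend : ℕ → (ℕ → ℕ) → ℕ → ℕ → ℕ
extend m f j = conjugate j (suc m) (addBlock m f)

extension : ℕ → List ℕ → ℕ → List ℕ
extension m w j = tabulate₁ (suc (suc m)) (extend m (at w) j)

extensions : ℕ → List ℕ → List (List ℕ)
extensions m w = map (extension m w) (range (suc m))

-- The inverse of `extend`: exchanging m + 1 with the partner of m + 2 makes {m + 1, m + 2} a block,
-- which `restriction` then cuts off.
restrict : ℕ → (ℕ → ℕ) → ℕ → ℕ
restrict m g = conjugate (g (suc (suc m))) (suc m) g

restriction : ℕ → List ℕ → List ℕ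
restriction m y = tabulate₁ m (restrict m (at y))

-- The exchange does not move m + 2, whose partner m + 1 becomes j. So j can be read off the
-- extension, which makes the extensions of one matching distinct.
extend-last : ∀ m f j → j ≤ suc m → extend m f j (suc (suc m)) ≡ j
extend-last m f j j≤ = trans (cong (λ x → swap j (suc m) (addBlock m f x))
    (swap-other j (suc m) (λ { refl → <-irrefl refl j≤ }) (λ eq → <-irrefl (sym eq) (n<1+n _))))
  (trans (cong (swap j (suc m)) (addBlock-snd m f)) (swap-right j (suc m)))

map-unique : ∀ (f : X → Y) {xs} → (∀ {x y} → x ∈ xs → y ∈ xs → f x ≡ f y → x ≡ y) → Unique xs → Unique (map f xs)
map-unique f inj []         = []
map-unique f inj (x∉ ∷ xs!) = All.map⁺ (All.tabulate λ y∈ eq → All.lookup x∉ y∈ (inj (here refl) (there y∈) eq))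
  ∷ map-unique f (λ x∈ y∈ → inj (there x∈) (there y∈)) xs!

conjugate-cong : ∀ m {f g} i j → i ≤ m → j ≤ m → (∀ x → x ≤ m → f x ≡ g x) → ∀ x → x ≤ m → conjugate i j f x ≡ conjugate i j g x
conjugate-cong m i j i≤m j≤m f≡g x x≤m = cong (swap i j) (f≡g (swap i j x) (swap-preserves (_≤ m) i j x i≤m j≤m x≤m))

matchingWords-unique : ∀ m → Unique (matchingWords m)
matchingWords-unique m = Unique.filter⁺ (λ w → T? (isFPFInv m w)) (words-unique m (range-unique m))

extension-last : ∀ m w j → j ≤ suc m → at (extension m w j) (suc (suc m)) ≡ j
extension-last m w j j≤ = trans (at-tabulate₁ (extend m (at w) j) (s≤s z≤n) ≤-refl) (extend-last m (at w) j j≤)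

extensions-unique : ∀ m w → Unique (extensions m w)
extensions-unique m w = map-unique (extension m w) (λ {i} {j} i∈ j∈ eq →
  trans (sym (extension-last m w i (proj₂ (∈-range⁻ i∈))))
    (trans (cong (λ y → at y (suc (suc m))) eq) (extension-last m w j (proj₂ (∈-range⁻ j∈)))))
  (range-unique (suc m))

extension-matching : ∀ {m w j} → w ∈ matchingWords m → 1 ≤ j → j ≤ suc m → extension m w j ∈ matchingWords (suc (suc m))
extension-matching {m} {w} {j} w∈ 1≤j j≤ = matchingWords⁺ (length-tabulate₁ (suc (suc m)) (extend m (at w) j))
  (Involutive-cong (λ x 1≤ ≤m → sym (at-tabulate₁ (extend m (at w) j) 1≤ ≤m))
    (conjugate-Involutive j (suc m) 1≤j (m≤n⇒m≤1+n j≤) (s≤s z≤n) (n≤1+n (suc m))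
      (addBlock-Involutive (proj₂ (matchingWords⁻ w∈)))))

restrict-extend : ∀ {m w j x} → 1 ≤ j → j ≤ suc m → 1 ≤ x → x ≤ m → restrict m (at (extension m w j)) x ≡ at w x
restrict-extend {m} {w} {j} {x} 1≤j j≤ 1≤x x≤m = begin
  conjugate (at (extension m w j) (suc (suc m))) (suc m) (at (extension m w j)) x
    ≡⟨ cong (λ i → conjugate i (suc m) (at (extension m w j)) x) (extension-last m w j j≤) ⟩
  conjugate j (suc m) (at (extension m w j)) x
    ≡⟨ cong (swap j (suc m)) (at-tabulate₁ (extend m (at w) j)
         (swap-preserves (1 ≤_) j (suc m) x 1≤j (s≤s z≤n) 1≤x)
         (swap-preserves (_≤ suc (suc m)) j (suc m) x (m≤n⇒m≤1+n j≤) (n≤1+n (suc m)) (m≤n⇒m≤1+n (m≤n⇒m≤1+n x≤m)))) ⟩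
  conjugate j (suc m) (extend m (at w) j) x
    ≡⟨ conjugate-involutive j (suc m) (addBlock m (at w)) x ⟩
  addBlock m (at w) x
    ≡⟨ addBlock-old m (at w) x≤m ⟩
  at w x ∎
  where open ≡-Reasoning

restriction-extension : ∀ {m w j} → length w ≡ m → 1 ≤ j → j ≤ suc m → restriction m (extension m w j) ≡ w
restriction-extension {m} {w} {j} len 1≤j j≤ = at-extensional (restriction m (extension m w j)) w
  (trans len′ (sym len)) λ x 1≤x x≤ →
    trans (at-tabulate₁ (restrict m (at (extension m w j))) 1≤x (subst (x ≤_) len′ x≤))
      (restrict-extend {w = w} 1≤j j≤ 1≤x (subst (x ≤_) len′ x≤))
  where
  len′ : length (restriction m (extension m w j)) ≡ m
  len′ = length-tabulate₁ m (restrict m (at (extension m w j)))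

module _ {m g} (inv : Involutive (suc (suc m)) g) where

  partner : ℕ
  partner = g (suc (suc m))

  partner-positive : 1 ≤ partner
  partner-positive = positive inv (suc (suc m)) (s≤s z≤n) ≤-refl

  partner-bounded : partner ≤ suc m
  partner-bounded = ≤-pred (≤∧≢⇒< (bounded inv (suc (suc m)) (s≤s z≤n) ≤-refl)
    (no-fixed inv (suc (suc m)) (s≤s z≤n) ≤-refl))

  restrict-inv : Involutive (suc (suc m)) (restrict m g)
  restrict-inv = conjugate-Involutive partner (suc m) partner-positive (m≤n⇒m≤1+n partner-bounded)
    (s≤s z≤n) (n≤1+n (suc m)) inv

  restrict-last : restrict m g (suc (suc m)) ≡ suc m
  restrict-last = trans
    (cong (swap partner (suc m) ∘ g) (swap-other partner (suc m)
      (no-fixed inv (suc (suc m)) (s≤s z≤n) ≤-refl ∘ sym) (λ eq → <-irrefl (sym eq) (n<1+n (suc m)))))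
    (swap-left partner (suc m))

  extend-restrict : ∀ x → x ≤ suc (suc m) → extend m (restrict m g) partner x ≡ g x
  extend-restrict x x≤ = trans
    (conjugate-cong (suc (suc m)) partner (suc m) (m≤n⇒m≤1+n partner-bounded) (n≤1+n (suc m))
      (addBlock-restrict restrict-inv restrict-last) x x≤)
    (conjugate-involutive partner (suc m) g x)

addBlock-cong : ∀ m {f g} → (∀ x → 1 ≤ x → x ≤ m → f x ≡ g x) → ∀ x → 1 ≤ x → x ≤ suc (suc m) → addBlock m f x ≡ addBlock m g x
addBlock-cong m {f} {g} f≡g x 1≤x x≤ with position x≤
... | old x≤m = trans (addBlock-old m f x≤m) (trans (f≡g x 1≤x x≤m) (sym (addBlock-old m g x≤m)))
... | fst     = trans (addBlock-fst m f) (sym (addBlock-fst m g))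
... | snd     = trans (addBlock-snd m f) (sym (addBlock-snd m g))

restriction-matching : ∀ {m y} → y ∈ matchingWords (suc (suc m)) →
  restriction m y ∈ matchingWords m × y ∈ extensions m (restriction m y)
restriction-matching {m} {y} y∈ = matchingWords⁺ (length-tabulate₁ m (restrict m (at y)))
    (Involutive-cong (λ x 1≤ ≤m → sym (at-tabulate₁ (restrict m (at y)) 1≤ ≤m))
      (restrict-Involutive (restrict-inv inv) (restrict-last inv)))
  , subst (_∈ extensions m (restriction m y)) (sym y≡) (∈-map⁺ (extension m (restriction m y))
      (∈-range⁺ (partner-positive inv) (partner-bounded inv)))
  where
  j = at y (suc (suc m))
  len : length y ≡ suc (suc m)
  len = proj₁ (matchingWords⁻ y∈)
  inv : Involutive (suc (suc m)) (at y)
  inv = proj₂ (matchingWords⁻ y∈)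
  t-positive : ∀ x → 1 ≤ x → 1 ≤ swap j (suc m) x
  t-positive x = swap-preserves (1 ≤_) j (suc m) x (partner-positive inv) (s≤s z≤n)
  t-bounded : ∀ x → x ≤ suc (suc m) → swap j (suc m) x ≤ suc (suc m)
  t-bounded x = swap-preserves (_≤ suc (suc m)) j (suc m) x (m≤n⇒m≤1+n (partner-bounded inv)) (n≤1+n (suc m))
  y≡ : y ≡ extension m (restriction m y) j
  y≡ = at-extensional y (extension m (restriction m y) j)
    (trans len (sym (length-tabulate₁ (suc (suc m)) (extend m (at (restriction m y)) j))))
    λ x 1≤x x≤ → let x≤m = subst (x ≤_) len x≤ in sym (trans
      (at-tabulate₁ (extend m (at (restriction m y)) j) 1≤x x≤m)
      (trans (cong (swap j (suc m)) (addBlock-cong m (λ x → at-tabulate₁ (restrict m (at y)))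
          (swap j (suc m) x) (t-positive x 1≤x) (t-bounded x x≤m)))
        (extend-restrict inv x x≤m)))

sumOver-matchingWords : ∀ m f → sumOver f (matchingWords (suc (suc m))) ≡
  sumOver (λ w → sumOver (λ j → f (extension m w j)) (range (suc m))) (matchingWords m)
sumOver-matchingWords m f = trans
  (sumOver-fibres (restriction m) (extensions m) (matchingWords-unique m) (matchingWords-unique (suc (suc m)))
    (λ {w} _ → extensions-unique m w) up restriction-matching f)
  (sumOver-cong-∈ (matchingWords m) λ {w} _ → sumOver-map f (extension m w) (range (suc m)))
  where
  up : ∀ {w y} → w ∈ matchingWords m → y ∈ extensions m w → y ∈ matchingWords (suc (suc m)) × restriction m y ≡ w
  up {w} w∈ y∈ with ∈-map⁻ (extension m w) y∈
  ... | j , j∈ , refl = extension-matching {w = w} w∈ (proj₁ (∈-range⁻ j∈)) (proj₂ (∈-range⁻ j∈)) ,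
    restriction-extension {w = w} (proj₁ (matchingWords⁻ w∈)) (proj₁ (∈-range⁻ j∈)) (proj₂ (∈-range⁻ j∈))

-- Odd blocks under extension of a matching.

odd : ℕ → Bool
odd x = not (isEven x)

odd-fst : ∀ n → odd (suc (double n)) ≡ true
odd-fst n = cong not (trans (cong isEven (+-comm 1 (double n))) (isEven-double n 1))

odd-snd : ∀ n → odd (suc (suc (double n))) ≡ false
odd-snd n = cong not (trans (cong isEven (sym (+-identityʳ (double (suc n))))) (isEven-double (suc n) 0))

sumOver-range-suc : ∀ h m → sumOver h (range (suc m)) ≡ sumOver h (range m) + h (suc m)
sumOver-range-suc h m = trans (cong (sumOver h) (trans (cong (map suc) (sym (upTo-∷ʳ m))) (map-++ suc (upTo m) [ m ])))
  (trans (sumOver-++ h (range m) [ suc m ]) (cong (sumOver h (range m) +_) (+-identityʳ _)))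

sumOver-range-cong : ∀ m {g h} → (∀ x → 1 ≤ x → x ≤ m → g x ≡ h x) → sumOver g (range m) ≡ sumOver h (range m)
sumOver-range-cong m g≡h = sumOver-cong-∈ (range m) λ x∈ → g≡h _ (proj₁ (∈-range⁻ x∈)) (proj₂ (∈-range⁻ x∈))

sumOver-range-δ : ∀ (h : ℕ → ℕ) m {k} → 1 ≤ k → k ≤ m → sumOver (λ x → δ k x * h x) (range m) ≡ h k
sumOver-range-δ h zero    1≤k k≤ = ⊥-elim (<⇒≱ 1≤k k≤)
sumOver-range-δ h (suc m) {k} 1≤k k≤ with k ≟ suc m
... | yes refl = trans (sumOver-range-suc (λ x → δ (suc m) x * h x) m) (cong₂ _+_
  (trans (sumOver-range-cong m (λ x _ x≤m → cong (_* h x) (δ-≢ {suc m} {x} (λ { refl → <-irrefl refl x≤m })))) (sumOver-0 (range m)))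
  (trans (cong (_* h (suc m)) (δ-refl (suc m))) (+-identityʳ (h (suc m)))))
... | no  k≢   = trans (sumOver-range-suc (λ x → δ k x * h x) m) (trans (cong₂ _+_
  (sumOver-range-δ h m 1≤k (≤-pred (≤∧≢⇒< k≤ k≢))) (cong (_* h (suc m)) (δ-≢ {k} {suc m} (k≢ ∘ sym)))) (+-identityʳ (h k)))

sumOver-range-1 : ∀ m → sumOver (λ _ → 1) (range m) ≡ m
sumOver-range-1 zero    = refl
sumOver-range-1 (suc m) = trans (sumOver-range-suc (λ _ → 1) m) (trans (cong (_+ 1) (sumOver-range-1 m)) (+-comm m 1))

sumOver-range-odd : ∀ n → sumOver (λ x → ⟦ odd x ⟧) (range (double n)) ≡ n
sumOver-range-odd zero    = refl
sumOver-range-odd (suc n) = trans (sumOver-range-suc (λ x → ⟦ odd x ⟧) (suc (double n)))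
  (trans (cong₂ _+_ (sumOver-range-suc (λ x → ⟦ odd x ⟧) (double n)) (cong ⟦_⟧ (odd-snd n)))
    (trans (+-identityʳ _) (trans (cong₂ _+_ (sumOver-range-odd n) (cong ⟦_⟧ (odd-fst n))) (+-comm n 1))))

≢-⊔ : ∀ {x i j} → x ≢ i → x ≢ j → x ≢ i ⊔ j
≢-⊔ {x} {i} {j} x≢i x≢j eq with ⊔-sel i j
... | inj₁ ≡i = x≢i (trans eq ≡i)
... | inj₂ ≡j = x≢j (trans eq ≡j)

oddOpener : (ℕ → ℕ) → ℕ → ℕ
oddOpener f x = ⟦ (x <ᵇ f x) ∧ odd x ⟧

-- The n odd elements of [2n] are odd openers or odd closers, so n - `oddBlocks` is the number of
-- odd closers. This is the statistic that satisfies the recurrence.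
oddCloser : (ℕ → ℕ) → ℕ → ℕ
oddCloser f x = ⟦ (f x <ᵇ x) ∧ odd x ⟧

module _ {m f} (inv : Involutive m f) where

  range-↭ : map f (range m) ↭ range m
  range-↭ = unique-⇔⇒↭
    (map-unique f (λ x∈ y∈ eq → trans (sym (inverse x∈)) (trans (cong f eq) (inverse y∈))) (range-unique m))
    (range-unique m) (mk⇔ to from)
    where
    inverse : ∀ {x} → x ∈ range m → f (f x) ≡ x
    inverse x∈ = involution inv _ (proj₁ (∈-range⁻ x∈)) (proj₂ (∈-range⁻ x∈))
    closed : ∀ {x} → x ∈ range m → f x ∈ range m
    closed x∈ = ∈-range⁺ (positive inv _ (proj₁ (∈-range⁻ x∈)) (proj₂ (∈-range⁻ x∈))) (bounded inv _ (proj₁ (∈-range⁻ x∈)) (proj₂ (∈-range⁻ x∈)))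
    to : ∀ {y} → y ∈ map f (range m) → y ∈ range m
    to y∈ with ∈-map⁻ f y∈
    ... | x , x∈ , refl = closed x∈
    from : ∀ {y} → y ∈ range m → y ∈ map f (range m)
    from {y} y∈ = subst (_∈ map f (range m)) (inverse y∈) (∈-map⁺ f (closed y∈))

  opener+closer : ∀ x → 1 ≤ x → x ≤ m → oddOpener f x + oddCloser f x ≡ ⟦ odd x ⟧
  opener+closer x 1≤x x≤m with <-cmp x (f x)
  ... | tri< x<fx _ _ rewrite <⇒<ᵇ≡true x<fx | ≤⇒<ᵇ≡false (<⇒≤ x<fx) = +-identityʳ _
  ... | tri≈ _ eq _ = ⊥-elim (no-fixed inv x 1≤x x≤m (sym eq))
  ... | tri> _ _ fx<x rewrite <⇒<ᵇ≡true fx<x | ≤⇒<ᵇ≡false (<⇒≤ fx<x) = refl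

  odd-max : ∀ x → 1 ≤ x → x ≤ m → ⟦ odd (x ⊔ f x) ⟧ ≡ oddCloser f x + oddCloser f (f x)
  odd-max x 1≤x x≤m rewrite involution inv x 1≤x x≤m with <-cmp x (f x)
  ... | tri< x<fx _ _ rewrite <⇒<ᵇ≡true x<fx | ≤⇒<ᵇ≡false (<⇒≤ x<fx) | m≤n⇒m⊔n≡n (<⇒≤ x<fx) = refl
  ... | tri≈ _ eq _ = ⊥-elim (no-fixed inv x 1≤x x≤m (sym eq))
  ... | tri> _ _ fx<x rewrite <⇒<ᵇ≡true fx<x | ≤⇒<ᵇ≡false (<⇒≤ fx<x) | m≥n⇒m⊔n≡m (<⇒≤ fx<x) = sym (+-identityʳ _)

  -- A block with odd larger element is met twice, once from each of its elements.
  sumOver-odd-max : sumOver (λ x → ⟦ odd (x ⊔ f x) ⟧) (range m) ≡ double (sumOver (oddCloser f) (range m))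
  sumOver-odd-max = trans (sumOver-range-cong m odd-max)
    (trans (sumOver-+ (oddCloser f) (oddCloser f ∘ f) (range m))
      (trans (cong (sumOver (oddCloser f) (range m) +_) (trans (sym (sumOver-map (oddCloser f) f (range m))) (sumOver-↭ (oddCloser f) range-↭)))
        (sym (double≡+ _))))

  extend-new : ∀ x → extend m f (suc m) x ≡ addBlock m f x
  extend-new x = trans (swap-self (addBlock m f (swap (suc m) (suc m) x))) (cong (addBlock m f) (swap-self x))
    where
    swap-self : ∀ x → swap (suc m) (suc m) x ≡ x
    swap-self x with x ≟ suc m
    ... | yes refl = swap-left (suc m) (suc m)
    ... | no  x≢   = swap-other (suc m) (suc m) x≢ x≢

  module _ {j} (1≤j : 1 ≤ j) (j≤m : j ≤ m) where

    new≢ : ∀ {x} → x ≤ m → x ≢ suc m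
    new≢ x≤m refl = <-irrefl refl x≤m

    -- For j ≤ m the block {j, f j} is broken into {j, m + 2} and {f j, m + 1}; all other blocks
    -- stay.
    extend-self : extend m f j j ≡ suc (suc m)
    extend-self = trans (cong (swap j (suc m) ∘ addBlock m f) (swap-left j (suc m)))
      (trans (cong (swap j (suc m)) (addBlock-fst m f))
        (swap-other j (suc m) (λ { refl → <-irrefl refl (<-trans (n<1+n _) j≤m) }) (λ eq → <-irrefl (sym eq) (n<1+n (suc m)))))

    extend-partner : extend m f j (f j) ≡ suc m
    extend-partner = trans (cong (swap j (suc m) ∘ addBlock m f) (swap-other j (suc m) (no-fixed inv j 1≤j j≤m) (new≢ (bounded inv j 1≤j j≤m))))
      (trans (cong (swap j (suc m)) (trans (addBlock-old m f (bounded inv j 1≤j j≤m)) (involution inv j 1≤j j≤m))) (swap-left j (suc m)))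

    extend-other : ∀ x → 1 ≤ x → x ≤ m → x ≢ j → x ≢ f j → extend m f j x ≡ f x
    extend-other x 1≤x x≤m x≢j x≢fj = trans (cong (swap j (suc m) ∘ addBlock m f) (swap-other j (suc m) x≢j (new≢ x≤m)))
      (trans (cong (swap j (suc m)) (addBlock-old m f x≤m))
        (swap-other j (suc m) (λ eq → x≢fj (trans (sym (involution inv x 1≤x x≤m)) (cong f eq))) (new≢ (bounded inv x 1≤x x≤m))))

    extend-first : extend m f j (suc m) ≡ f j
    extend-first = trans (cong (swap j (suc m) ∘ addBlock m f) (swap-right j (suc m)))
      (trans (cong (swap j (suc m)) (addBlock-old m f j≤m)) (swap-other j (suc m) (no-fixed inv j 1≤j j≤m) (new≢ (bounded inv j 1≤j j≤m))))

    -- In the block {j, f j} only the larger element turns from a closer into an opener.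
    oddOpener-extend : ∀ x → 1 ≤ x → x ≤ m →
      oddOpener (extend m f j) x ≡ oddOpener f x + δ (j ⊔ f j) x * ⟦ odd x ⟧
    oddOpener-extend x 1≤x x≤m with x ≟ j
    ... | yes refl rewrite extend-self | <⇒<ᵇ≡true {x} {suc (suc m)} (s≤s (m≤n⇒m≤1+n x≤m)) = self (<-cmp x (f x))
      where
      self : _ → ⟦ odd x ⟧ ≡ oddOpener f x + δ (x ⊔ f x) x * ⟦ odd x ⟧
      self (tri< x<fx _ _) rewrite <⇒<ᵇ≡true x<fx | m≤n⇒m⊔n≡n (<⇒≤ x<fx) | δ-≢ {f x} {x} (λ eq → <-irrefl eq x<fx) = sym (+-identityʳ _)
      self (tri≈ _ eq _) = ⊥-elim (no-fixed inv x 1≤x x≤m (sym eq))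
      self (tri> _ _ fx<x) rewrite ≤⇒<ᵇ≡false (<⇒≤ fx<x) | m≥n⇒m⊔n≡m (<⇒≤ fx<x) | δ-refl x = sym (+-identityʳ _)
    ... | no x≢j with x ≟ f j
    ...   | yes refl rewrite extend-partner | <⇒<ᵇ≡true {f j} {suc m} (s≤s x≤m) | involution inv j 1≤j j≤m = partner′ (<-cmp (f j) j)
      where
      partner′ : _ → ⟦ odd (f j) ⟧ ≡ ⟦ (f j <ᵇ j) ∧ odd (f j) ⟧ + δ (j ⊔ f j) (f j) * ⟦ odd (f j) ⟧
      partner′ (tri< fj<j _ _) rewrite <⇒<ᵇ≡true fj<j | m≥n⇒m⊔n≡m (<⇒≤ fj<j) | δ-≢ {j} {f j} (λ eq → <-irrefl eq fj<j) = sym (+-identityʳ _)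
      partner′ (tri≈ _ eq _) = ⊥-elim (no-fixed inv j 1≤j j≤m eq)
      partner′ (tri> _ _ j<fj) rewrite ≤⇒<ᵇ≡false (<⇒≤ j<fj) | m≤n⇒m⊔n≡n (<⇒≤ j<fj) | δ-refl (f j) = sym (+-identityʳ _)
    ...   | no x≢fj rewrite extend-other x 1≤x x≤m x≢j x≢fj | δ-≢ {j ⊔ f j} {x} (≢-⊔ x≢j x≢fj) = sym (+-identityʳ _)

matchings≡ : ∀ n → matchings n ≡ matchingWords (double n)
matchings≡ n = trans (matchings≡filter n) (cong matchingWords (sym (double≡2* n)))

oddBlocks-sumOver : ∀ m w → oddBlocks m w ≡ sumOver (oddOpener (at w)) (range m)
oddBlocks-sumOver m w = count≡sumOver (λ x → (x <ᵇ at w x) ∧ odd x) (range m)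

module _ (n : ℕ) {w} (w∈ : w ∈ matchingWords (double n)) where

  open ≡-Reasoning

  private
    m = double n
    f = at w
    inv : Involutive m f
    inv = proj₂ (matchingWords⁻ w∈)
    closers : ℕ
    closers = sumOver (oddCloser f) (range m)

  -- As m = 2n, the even element m + 2 never counts, and the odd element m + 1 counts exactly when
  -- it opens its block.
  oddBlocks-extend : ∀ j → oddBlocks (suc (suc m)) (extension m w j) ≡
    sumOver (oddOpener (extend m f j)) (range m) + ⟦ suc m <ᵇ extend m f j (suc m) ⟧
  oddBlocks-extend j = begin
    oddBlocks (suc (suc m)) (extension m w j)
      ≡⟨ oddBlocks-sumOver (suc (suc m)) (extension m w j) ⟩
    sumOver (oddOpener (at (extension m w j))) (range (suc (suc m)))
      ≡⟨ sumOver-range-cong (suc (suc m)) (λ x 1≤x x≤ → cong (λ y → ⟦ (x <ᵇ y) ∧ odd x ⟧) (at-tabulate₁ (extend m f j) 1≤x x≤)) ⟩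
    sumOver (oddOpener g) (range (suc (suc m)))
      ≡⟨ sumOver-range-suc (oddOpener g) (suc m) ⟩
    sumOver (oddOpener g) (range (suc m)) + oddOpener g (suc (suc m))
      ≡⟨ cong₂ _+_ (sumOver-range-suc (oddOpener g) m)
           (cong ⟦_⟧ (trans (cong ((suc (suc m) <ᵇ g (suc (suc m))) ∧_) (odd-snd n)) (∧-zeroʳ _))) ⟩
    sumOver (oddOpener g) (range m) + oddOpener g (suc m) + 0
      ≡⟨ +-identityʳ _ ⟩
    sumOver (oddOpener g) (range m) + oddOpener g (suc m)
      ≡⟨ cong (λ b → sumOver (oddOpener g) (range m) + ⟦ b ⟧)
           (trans (cong ((suc m <ᵇ g (suc m)) ∧_) (odd-fst n)) (∧-identityʳ _)) ⟩
    sumOver (oddOpener g) (range m) + ⟦ suc m <ᵇ g (suc m) ⟧ ∎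
    where g = extend m f j

  -- m + 1 closes its block {f j, m + 1}, so the only possible gain is the larger element of {j, f
  -- j}, which now opens a block.
  oddBlocks-extend-old : ∀ j → 1 ≤ j → j ≤ m →
    oddBlocks (suc (suc m)) (extension m w j) ≡ oddBlocks m w + ⟦ odd (j ⊔ f j) ⟧
  oddBlocks-extend-old j 1≤j j≤m = begin
    oddBlocks (suc (suc m)) (extension m w j)
      ≡⟨ oddBlocks-extend j ⟩
    sumOver (oddOpener (extend m f j)) (range m) + ⟦ suc m <ᵇ extend m f j (suc m) ⟧
      ≡⟨ cong₂ _+_ (sumOver-range-cong m (oddOpener-extend inv 1≤j j≤m))
           (cong ⟦_⟧ (trans (cong (suc m <ᵇ_) (extend-first inv 1≤j j≤m)) (≤⇒<ᵇ≡false (m≤n⇒m≤1+n (bounded inv j 1≤j j≤m))))) ⟩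
    sumOver (λ x → oddOpener f x + δ (j ⊔ f j) x * ⟦ odd x ⟧) (range m) + 0
      ≡⟨ +-identityʳ _ ⟩
    sumOver (λ x → oddOpener f x + δ (j ⊔ f j) x * ⟦ odd x ⟧) (range m)
      ≡⟨ sumOver-+ (oddOpener f) (λ x → δ (j ⊔ f j) x * ⟦ odd x ⟧) (range m) ⟩
    sumOver (oddOpener f) (range m) + sumOver (λ x → δ (j ⊔ f j) x * ⟦ odd x ⟧) (range m)
      ≡⟨ cong₂ _+_ (sym (oddBlocks-sumOver m w)) (sumOver-range-δ (λ x → ⟦ odd x ⟧) m
           (≤-trans 1≤j (m≤m⊔n j (f j))) (⊔-lub j≤m (bounded inv j 1≤j j≤m))) ⟩
    oddBlocks m w + ⟦ odd (j ⊔ f j) ⟧ ∎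

  oddBlocks-extend-new : oddBlocks (suc (suc m)) (extension m w (suc m)) ≡ suc (oddBlocks m w)
  oddBlocks-extend-new = begin
    oddBlocks (suc (suc m)) (extension m w (suc m))
      ≡⟨ oddBlocks-extend (suc m) ⟩
    sumOver (oddOpener (extend m f (suc m))) (range m) + ⟦ suc m <ᵇ extend m f (suc m) (suc m) ⟧
      ≡⟨ cong₂ _+_
           (sumOver-range-cong m (λ x 1≤x x≤m → cong (λ y → ⟦ (x <ᵇ y) ∧ odd x ⟧) (trans (extend-new inv x) (addBlock-old m f x≤m))))
           (cong ⟦_⟧ (trans (cong (suc m <ᵇ_) (trans (extend-new inv (suc m)) (addBlock-fst m f))) (<⇒<ᵇ≡true {suc m} (n<1+n (suc m))))) ⟩
    sumOver (oddOpener f) (range m) + 1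
      ≡⟨ +-comm _ 1 ⟩
    suc (sumOver (oddOpener f) (range m))
      ≡⟨ cong suc (sym (oddBlocks-sumOver m w)) ⟩
    suc (oddBlocks m w) ∎

  oddBlocks+closers : oddBlocks m w + closers ≡ n
  oddBlocks+closers = begin
    oddBlocks m w + closers
      ≡⟨ cong (_+ closers) (oddBlocks-sumOver m w) ⟩
    sumOver (oddOpener f) (range m) + closers
      ≡⟨ sym (sumOver-+ (oddOpener f) (oddCloser f) (range m)) ⟩
    sumOver (λ x → oddOpener f x + oddCloser f x) (range m)
      ≡⟨ sumOver-range-cong m (opener+closer inv) ⟩
    sumOver (λ x → ⟦ odd x ⟧) (range m)
      ≡⟨ sumOver-range-odd n ⟩
    n ∎

  oddBlocks-bound : oddBlocks m w ≤ n
  oddBlocks-bound = subst (oddBlocks m w ≤_) oddBlocks+closers (m≤m+n _ closers)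

  n∸oddBlocks : n ∸ oddBlocks m w ≡ closers
  n∸oddBlocks = ∸-remainder (oddBlocks m w) closers (sym oddBlocks+closers)

  1+n∸oddBlocks : suc n ∸ oddBlocks m w ≡ suc closers
  1+n∸oddBlocks = ∸-remainder (oddBlocks m w) (suc closers) (trans (cong suc (sym oddBlocks+closers)) (sym (+-suc _ closers)))

  -- With c odd closers there are 2c elements j in blocks with odd larger element: that closer is
  -- lost, but m + 1 becomes one. The choice j = m + 1 keeps c as well. For the other 2n - 2c
  -- elements m + 1 is one more odd closer.
  extensions-split : ∀ (φ : ℕ → ℕ) → let c = n ∸ oddBlocks m w in
    sumOver (λ j → φ (suc n ∸ oddBlocks (suc (suc m)) (extension m w j))) (range (suc m)) ≡
    suc (double c) * φ c + (double n ∸ double c) * φ (suc c)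
  extensions-split φ = begin
    sumOver (λ j → φ (suc n ∸ oddBlocks (suc (suc m)) (extension m w j))) (range (suc m))
      ≡⟨ sumOver-range-suc _ m ⟩
    sumOver (λ j → φ (suc n ∸ oddBlocks (suc (suc m)) (extension m w j))) (range m)
      + φ (suc n ∸ oddBlocks (suc (suc m)) (extension m w (suc m)))
      ≡⟨ cong₂ _+_ (sumOver-range-cong m λ j 1≤j j≤m → trans
             (cong (λ k → φ (suc n ∸ k)) (oddBlocks-extend-old j 1≤j j≤m)) (by-parity (odd (j ⊔ f j))))
           (cong φ (trans (cong (suc n ∸_) oddBlocks-extend-new) n∸oddBlocks)) ⟩
    sumOver (λ j → φ closers * ⟦ odd (j ⊔ f j) ⟧ + φ (suc closers) * ⟦ not (odd (j ⊔ f j)) ⟧) (range m) + φ closers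
      ≡⟨ cong (_+ φ closers) (trans (sumOver-+ (λ j → φ closers * ⟦ odd (j ⊔ f j) ⟧) (λ j → φ (suc closers) * ⟦ not (odd (j ⊔ f j)) ⟧) (range m))
           (cong₂ _+_ (sumOver-* (φ closers) (λ j → ⟦ odd (j ⊔ f j) ⟧) (range m)) (sumOver-* (φ (suc closers)) (λ j → ⟦ not (odd (j ⊔ f j)) ⟧) (range m)))) ⟩
    φ closers * odds + φ (suc closers) * evens + φ closers
      ≡⟨ cong₂ (λ a b → φ closers * a + φ (suc closers) * b + φ closers) odds≡ evens≡ ⟩
    φ closers * double closers + φ (suc closers) * (m ∸ double closers) + φ closers
      ≡⟨ rearrange (φ closers) (φ (suc closers)) (double closers) (m ∸ double closers) ⟩
    suc (double closers) * φ closers + (m ∸ double closers) * φ (suc closers)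
      ≡⟨ cong (λ c → suc (double c) * φ c + (m ∸ double c) * φ (suc c)) (sym n∸oddBlocks) ⟩
    _ ∎
    where
    odds evens : ℕ
    odds  = sumOver (λ j → ⟦ odd (j ⊔ f j) ⟧) (range m)
    evens = sumOver (λ j → ⟦ not (odd (j ⊔ f j)) ⟧) (range m)
    odds≡ : odds ≡ double closers
    odds≡ = sumOver-odd-max inv
    ⟦b⟧+⟦not-b⟧ : ∀ b → ⟦ b ⟧ + ⟦ not b ⟧ ≡ 1
    ⟦b⟧+⟦not-b⟧ true  = refl
    ⟦b⟧+⟦not-b⟧ false = refl
    evens≡ : evens ≡ m ∸ double closers
    evens≡ = sym (∸-remainder (double closers) evens (sym (trans (cong (_+ evens) (sym odds≡))
      (trans (sym (sumOver-+ (λ j → ⟦ odd (j ⊔ f j) ⟧) (λ j → ⟦ not (odd (j ⊔ f j)) ⟧) (range m)))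
        (trans (sumOver-range-cong m (λ j _ _ → ⟦b⟧+⟦not-b⟧ (odd (j ⊔ f j)))) (sumOver-range-1 m))))))
    by-parity : ∀ b → φ (suc n ∸ (oddBlocks m w + ⟦ b ⟧)) ≡ φ closers * ⟦ b ⟧ + φ (suc closers) * ⟦ not b ⟧
    by-parity true  = trans (cong φ (trans (cong (suc n ∸_) (+-comm (oddBlocks m w) 1)) n∸oddBlocks)) (unit (φ closers) (φ (suc closers)))
      where
      unit : ∀ a b → a ≡ a * 1 + b * 0
      unit = solve-∀
    by-parity false = trans (cong φ (trans (cong (suc n ∸_) (+-identityʳ (oddBlocks m w))) 1+n∸oddBlocks)) (unit (φ closers) (φ (suc closers)))
      where
      unit : ∀ a b → b ≡ a * 0 + b * 1
      unit = solve-∀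
    rearrange : ∀ a b d e → a * d + b * e + a ≡ suc d * a + e * b
    rearrange = solve-∀

oddBlocks-step : ∀ n (φ : ℕ → ℕ) → let stat = λ k w → k ∸ oddBlocks (double k) w in
  sumOver (λ w → φ (stat (suc n) w)) (matchingWords (double (suc n))) ≡
  sumOver (λ w → suc (double (stat n w)) * φ (stat n w) + (double n ∸ double (stat n w)) * φ (suc (stat n w))) (matchingWords (double n))
oddBlocks-step n φ = trans (sumOver-matchingWords (double n) (λ w → φ (suc n ∸ oddBlocks (double (suc n)) w)))
  (sumOver-cong-∈ (matchingWords (double n)) λ w∈ → extensions-split n w∈ φ)

-- The smallest exponent of Y

infix  4 _≐_
infixl 6 _⊕_
infixl 7 _•_

_≐_ : Poly → Poly → Set
p ≐ q = ∀ a b c → p a b c ≡ q a b c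

_⊕_ : Poly → Poly → Poly
(p ⊕ q) a b c = p a b c + q a b c

_•_ : ℕ → Poly → Poly
(k • p) a b c = k * p a b c

≐-trans : ∀ {p q r} → p ≐ q → q ≐ r → p ≐ r
≐-trans p≐q q≐r a b c = trans (p≐q a b c) (q≐r a b c)

≐-sym : ∀ {p q} → p ≐ q → q ≐ p
≐-sym p≐q a b c = sym (p≐q a b c)

⊕-cong : ∀ {p p′ q q′} → p ≐ p′ → q ≐ q′ → p ⊕ q ≐ p′ ⊕ q′
⊕-cong p≐ q≐ a b c = cong₂ _+_ (p≐ a b c) (q≐ a b c)

•-cong : ∀ k {p q} → p ≐ q → k • p ≐ k • q
•-cong k p≐q a b c = cong (k *_) (p≐q a b c)

mulY mulZ : Poly → Poly
mulY p a zero    c = 0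
mulY p a (suc b) c = p a b c
mulZ p a b zero    = 0
mulZ p a b (suc c) = p a b c

-- Polynomials are compared pointwise, so respecting `_≐_` is made part of linearity.
record Linear (L : Poly → Poly) : Set where
  field
    L-cong : ∀ {p q} → p ≐ q → L p ≐ L q
    L-⊕    : ∀ p q → L (p ⊕ q) ≐ L p ⊕ L q
    L-•    : ∀ k p → L (k • p) ≐ k • L p
open Linear

∘-linear : ∀ {L K} → Linear L → Linear K → Linear (L ∘ K)
∘-linear {L} {K} l k = record
  { L-cong = λ p≐q → L-cong l (L-cong k p≐q)
  ; L-⊕    = λ p q → ≐-trans (L-cong l (L-⊕ k p q)) (L-⊕ l (K p) (K q))
  ; L-•    = λ m p → ≐-trans (L-cong l (L-• k m p)) (L-• l m (K p))
  }

⊕-linear : ∀ {L K} → Linear L → Linear K → Linear (λ p → L p ⊕ K p)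
⊕-linear {L} {K} l k = record
  { L-cong = λ p≐q → ⊕-cong (L-cong l p≐q) (L-cong k p≐q)
  ; L-⊕    = λ p q a b c → trans (cong₂ _+_ (L-⊕ l p q a b c) (L-⊕ k p q a b c)) (+-swap (L p a b c) (L q a b c) (K p a b c) (K q a b c))
  ; L-•    = λ m p a b c → trans (cong₂ _+_ (L-• l m p a b c) (L-• k m p a b c)) (sym (*-distribˡ-+ m (L p a b c) (K p a b c)))
  }

mulX-linear : Linear mulX
mulX-linear = record
  { L-cong = λ { p≐q zero b c → refl ; p≐q (suc a) b c → p≐q a b c }
  ; L-⊕    = λ { p q zero b c → refl ; p q (suc a) b c → refl }
  ; L-•    = λ { k p zero b c → sym (*-zeroʳ k) ; k p (suc a) b c → refl }
  }

mulY-linear : Linear mulY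
mulY-linear = record
  { L-cong = λ { p≐q a zero c → refl ; p≐q a (suc b) c → p≐q a b c }
  ; L-⊕    = λ { p q a zero c → refl ; p q a (suc b) c → refl }
  ; L-•    = λ { k p a zero c → sym (*-zeroʳ k) ; k p a (suc b) c → refl }
  }

mulZ-linear : Linear mulZ
mulZ-linear = record
  { L-cong = λ { p≐q a b zero → refl ; p≐q a b (suc c) → p≐q a b c }
  ; L-⊕    = λ { p q a b zero → refl ; p q a b (suc c) → refl }
  ; L-•    = λ { k p a b zero → sym (*-zeroʳ k) ; k p a b (suc c) → refl }
  }

*-swap : ∀ m k x → m * (k * x) ≡ k * (m * x)
*-swap = solve-∀

dX-linear : Linear dX
dX-linear = record
  { L-cong = λ { p≐q a zero c → refl ; p≐q a (suc b) zero → refl ; p≐q a (suc b) (suc c) → cong (suc a *_) (p≐q (suc a) b c) }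
  ; L-⊕    = λ { p q a zero c → refl ; p q a (suc b) zero → refl ; p q a (suc b) (suc c) → *-distribˡ-+ (suc a) (p (suc a) b c) (q (suc a) b c) }
  ; L-•    = λ { k p a zero c → sym (*-zeroʳ k) ; k p a (suc b) zero → sym (*-zeroʳ k) ; k p a (suc b) (suc c) → *-swap (suc a) k (p (suc a) b c) }
  }

dY-linear : Linear dY
dY-linear = record
  { L-cong = λ { p≐q zero b c → refl ; p≐q (suc a) b zero → refl ; p≐q (suc a) b (suc c) → cong (suc b *_) (p≐q a (suc b) c) }
  ; L-⊕    = λ { p q zero b c → refl ; p q (suc a) b zero → refl ; p q (suc a) b (suc c) → *-distribˡ-+ (suc b) (p a (suc b) c) (q a (suc b) c) }
  ; L-•    = λ { k p zero b c → sym (*-zeroʳ k) ; k p (suc a) b zero → sym (*-zeroʳ k) ; k p (suc a) b (suc c) → *-swap (suc b) k (p a (suc b) c) }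
  }

dZ-linear : Linear dZ
dZ-linear = record
  { L-cong = λ { p≐q zero b c → refl ; p≐q (suc a) zero c → refl ; p≐q (suc a) (suc b) c → cong (suc c *_) (p≐q a b (suc c)) }
  ; L-⊕    = λ { p q zero b c → refl ; p q (suc a) zero c → refl ; p q (suc a) (suc b) c → *-distribˡ-+ (suc c) (p a b (suc c)) (q a b (suc c)) }
  ; L-•    = λ { k p zero b c → sym (*-zeroʳ k) ; k p (suc a) zero c → sym (*-zeroʳ k) ; k p (suc a) (suc b) c → *-swap (suc c) k (p a b (suc c)) }
  }

D-linear : Linear D
D-linear = ⊕-linear (⊕-linear dX-linear dY-linear) dZ-linear

mulXY : ∀ p → mulX (mulY p) ≐ mulY (mulX p)
mulXY p zero    zero    c = refl
mulXY p zero    (suc b) c = refl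
mulXY p (suc a) zero    c = refl
mulXY p (suc a) (suc b) c = refl

mulXZ : ∀ p → mulX (mulZ p) ≐ mulZ (mulX p)
mulXZ p zero    b zero    = refl
mulXZ p zero    b (suc c) = refl
mulXZ p (suc a) b zero    = refl
mulXZ p (suc a) b (suc c) = refl

mulYZ : ∀ p → mulY (mulZ p) ≐ mulZ (mulY p)
mulYZ p a zero    zero    = refl
mulYZ p a zero    (suc c) = refl
mulYZ p a (suc b) zero    = refl
mulYZ p a (suc b) (suc c) = refl

dX-mulX : ∀ p → dX (mulX p) ≐ mulX (dX p) ⊕ mulY (mulZ p)
dX-mulX p zero    zero    c       = refl
dX-mulX p zero    (suc b) zero    = refl
dX-mulX p zero    (suc b) (suc c) = +-identityʳ _
dX-mulX p (suc a) zero    c       = refl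
dX-mulX p (suc a) (suc b) zero    = refl
dX-mulX p (suc a) (suc b) (suc c) = +-comm (p (suc a) b c) _

dX-mulY : ∀ p → dX (mulY p) ≐ mulY (dX p)
dX-mulY p a zero          c       = refl
dX-mulY p a (suc zero)    zero    = refl
dX-mulY p a (suc zero)    (suc c) = *-zeroʳ (suc a)
dX-mulY p a (suc (suc b)) zero    = refl
dX-mulY p a (suc (suc b)) (suc c) = refl

dX-mulZ : ∀ p → dX (mulZ p) ≐ mulZ (dX p)
dX-mulZ p a zero    zero          = refl
dX-mulZ p a zero    (suc c)       = refl
dX-mulZ p a (suc b) zero          = refl
dX-mulZ p a (suc b) (suc zero)    = *-zeroʳ (suc a)
dX-mulZ p a (suc b) (suc (suc c)) = refl

dY-mulX : ∀ p → dY (mulX p) ≐ mulX (dY p)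
dY-mulX p zero          b c       = refl
dY-mulX p (suc zero)    b zero    = refl
dY-mulX p (suc zero)    b (suc c) = *-zeroʳ (suc b)
dY-mulX p (suc (suc a)) b zero    = refl
dY-mulX p (suc (suc a)) b (suc c) = refl

dY-mulY : ∀ p → dY (mulY p) ≐ mulY (dY p) ⊕ mulX (mulZ p)
dY-mulY p zero    zero    c       = refl
dY-mulY p zero    (suc b) c       = refl
dY-mulY p (suc a) zero    zero    = refl
dY-mulY p (suc a) zero    (suc c) = +-identityʳ _
dY-mulY p (suc a) (suc b) zero    = refl
dY-mulY p (suc a) (suc b) (suc c) = +-comm (p a (suc b) c) _

dY-mulZ : ∀ p → dY (mulZ p) ≐ mulZ (dY p)
dY-mulZ p zero    b zero          = refl
dY-mulZ p zero    b (suc c)       = refl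
dY-mulZ p (suc a) b zero          = refl
dY-mulZ p (suc a) b (suc zero)    = *-zeroʳ (suc b)
dY-mulZ p (suc a) b (suc (suc c)) = refl

dZ-mulX : ∀ p → dZ (mulX p) ≐ mulX (dZ p)
dZ-mulX p zero          b       c = refl
dZ-mulX p (suc zero)    zero    c = refl
dZ-mulX p (suc zero)    (suc b) c = *-zeroʳ (suc c)
dZ-mulX p (suc (suc a)) zero    c = refl
dZ-mulX p (suc (suc a)) (suc b) c = refl

dZ-mulY : ∀ p → dZ (mulY p) ≐ mulY (dZ p)
dZ-mulY p zero    zero          c = refl
dZ-mulY p zero    (suc b)       c = refl
dZ-mulY p (suc a) zero          c = refl
dZ-mulY p (suc a) (suc zero)    c = *-zeroʳ (suc c)
dZ-mulY p (suc a) (suc (suc b)) c = refl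

dZ-mulZ : ∀ p → dZ (mulZ p) ≐ mulZ (dZ p) ⊕ mulX (mulY p)
dZ-mulZ p zero    b       zero    = refl
dZ-mulZ p zero    b       (suc c) = refl
dZ-mulZ p (suc a) zero    zero    = refl
dZ-mulZ p (suc a) zero    (suc c) = refl
dZ-mulZ p (suc a) (suc b) zero    = +-identityʳ _
dZ-mulZ p (suc a) (suc b) (suc c) = +-comm (p a b (suc c)) _

-- The Leibniz rule, with D(X) = Y Z as the extra term; the next two treat Y and Z alike.
D-mulX : ∀ p → D (mulX p) ≐ mulX (D p) ⊕ mulY (mulZ p)
D-mulX p a b c rewrite dX-mulX p a b c | dY-mulX p a b c | dZ-mulX p a b c
  | L-⊕ mulX-linear (dX p ⊕ dY p) (dZ p) a b c | L-⊕ mulX-linear (dX p) (dY p) a b c =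
  eq (mulX (dX p) a b c) (mulX (dY p) a b c) (mulX (dZ p) a b c) (mulY (mulZ p) a b c)
  where
  eq : ∀ x y z w → x + w + y + z ≡ x + y + z + w
  eq = solve-∀

D-mulY : ∀ p → D (mulY p) ≐ mulY (D p) ⊕ mulX (mulZ p)
D-mulY p a b c rewrite dX-mulY p a b c | dY-mulY p a b c | dZ-mulY p a b c
  | L-⊕ mulY-linear (dX p ⊕ dY p) (dZ p) a b c | L-⊕ mulY-linear (dX p) (dY p) a b c =
  eq (mulY (dX p) a b c) (mulY (dY p) a b c) (mulY (dZ p) a b c) (mulX (mulZ p) a b c)
  where
  eq : ∀ x y z w → x + (y + w) + z ≡ x + y + z + w
  eq = solve-∀

D-mulZ : ∀ p → D (mulZ p) ≐ mulZ (D p) ⊕ mulX (mulY p)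
D-mulZ p a b c rewrite dX-mulZ p a b c | dY-mulZ p a b c | dZ-mulZ p a b c
  | L-⊕ mulZ-linear (dX p ⊕ dY p) (dZ p) a b c | L-⊕ mulZ-linear (dX p) (dY p) a b c =
  sym (+-assoc (mulZ (dX p) a b c + mulZ (dY p) a b c) (mulZ (dZ p) a b c) (mulX (mulY p) a b c))

XD : Poly → Poly
XD p = mulX (D p)

XD-linear : Linear XD
XD-linear = ∘-linear mulX-linear D-linear

-- Multiplication by σ = Y + Z, φ = X (Y + Z) and θ = X² + Y Z.
mulσ mulφ mulθ : Poly → Poly
mulσ p = mulY p ⊕ mulZ p
mulφ p = mulX (mulσ p)
mulθ p = mulX (mulX p) ⊕ mulY (mulZ p)

mulσ-linear : Linear mulσ
mulσ-linear = ⊕-linear mulY-linear mulZ-linear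

mulφ-linear : Linear mulφ
mulφ-linear = ∘-linear mulX-linear mulσ-linear

mulθ-linear : Linear mulθ
mulθ-linear = ⊕-linear (∘-linear mulX-linear mulX-linear) (∘-linear mulY-linear mulZ-linear)

mulXσ : ∀ p → mulX (mulσ p) ≐ mulσ (mulX p)
mulXσ p = ≐-trans (L-⊕ mulX-linear (mulY p) (mulZ p)) (⊕-cong (mulXY p) (mulXZ p))

mulYσ : ∀ p → mulY (mulσ p) ≐ mulσ (mulY p)
mulYσ p = ≐-trans (L-⊕ mulY-linear (mulY p) (mulZ p)) (⊕-cong (λ _ _ _ → refl) (mulYZ p))

mulZσ : ∀ p → mulZ (mulσ p) ≐ mulσ (mulZ p)
mulZσ p = ≐-trans (L-⊕ mulZ-linear (mulY p) (mulZ p)) (⊕-cong (≐-sym (mulYZ p)) (λ _ _ _ → refl))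

-- D(Y + Z) = X Z + X Y = X σ.
D-mulσ : ∀ p → D (mulσ p) ≐ mulσ (D p) ⊕ mulX (mulσ p)
D-mulσ p a b c rewrite L-⊕ D-linear (mulY p) (mulZ p) a b c | D-mulY p a b c | D-mulZ p a b c
  | L-⊕ mulX-linear (mulY p) (mulZ p) a b c =
  eq (mulY (D p) a b c) (mulX (mulZ p) a b c) (mulZ (D p) a b c) (mulX (mulY p) a b c)
  where
  eq : ∀ w x y z → w + x + (y + z) ≡ w + y + (z + x)
  eq = solve-∀

mulX-θ : ∀ p → mulX (mulθ p) ≐ mulθ (mulX p)
mulX-θ p = ≐-trans (L-⊕ mulX-linear (mulX (mulX p)) (mulY (mulZ p)))
  (⊕-cong (λ _ _ _ → refl) (≐-trans (mulXY (mulZ p)) (L-cong mulY-linear (mulXZ p))))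

mulσ-θ : ∀ p → mulσ (mulθ p) ≐ mulθ (mulσ p)
mulσ-θ p = ≐-trans (L-⊕ mulσ-linear (mulX (mulX p)) (mulY (mulZ p)))
  (⊕-cong (≐-sym (≐-trans (L-cong mulX-linear (mulXσ p)) (mulXσ (mulX p))))
    (≐-sym (≐-trans (L-cong mulY-linear (mulZσ p)) (mulYσ (mulZ p)))))

mulφ-θ : ∀ p → mulφ (mulθ p) ≐ mulθ (mulφ p)
mulφ-θ p = ≐-trans (L-cong mulX-linear (mulσ-θ p)) (mulX-θ (mulσ p))

-- D(φ) = Y Z σ + X · X σ = σ θ, hence X D (φ) = φ θ.
XD-mulφ : ∀ p → XD (mulφ p) ≐ mulφ (XD p) ⊕ mulφ (mulθ p)
XD-mulφ p = ≐-trans (L-cong mulX-linear D-mulφ)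
  (≐-trans (L-⊕ mulX-linear (mulX (mulσ (D p))) (mulθ (mulσ p)))
    (⊕-cong (L-cong mulX-linear (mulXσ (D p))) (L-cong mulX-linear (≐-sym (mulσ-θ p)))))
  where
  D-mulφ : D (mulφ p) ≐ mulX (mulσ (D p)) ⊕ mulθ (mulσ p)
  D-mulφ a b c rewrite D-mulX (mulσ p) a b c | L-cong mulX-linear (D-mulσ p) a b c
    | L-⊕ mulX-linear (mulσ (D p)) (mulX (mulσ p)) a b c = +-assoc (mulX (mulσ (D p)) a b c) _ _

-- D(θ) = 2 X Y Z + X Y² + X Z² = X σ² = σ φ, hence X D (θ) = φ².
XD-mulθ : ∀ p → XD (mulθ p) ≐ mulθ (XD p) ⊕ mulφ (mulφ p)
XD-mulθ p = ≐-trans (L-cong mulX-linear D-mulθ) (≐-trans (L-⊕ mulX-linear (mulθ (D p)) (mulσ (mulφ p)))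
  (⊕-cong (mulX-θ (D p)) (λ _ _ _ → refl)))
  where
  D-XX : D (mulX (mulX p)) ≐ mulX (mulX (D p)) ⊕ mulX (mulY (mulZ p)) ⊕ mulY (mulZ (mulX p))
  D-XX a b c rewrite D-mulX (mulX p) a b c | L-cong mulX-linear (D-mulX p) a b c
    | L-⊕ mulX-linear (mulX (D p)) (mulY (mulZ p)) a b c = refl
  D-YZ : D (mulY (mulZ p)) ≐ mulY (mulZ (D p)) ⊕ mulY (mulX (mulY p)) ⊕ mulX (mulZ (mulZ p))
  D-YZ a b c rewrite D-mulY (mulZ p) a b c | L-cong mulY-linear (D-mulZ p) a b c
    | L-⊕ mulY-linear (mulZ (D p)) (mulX (mulY p)) a b c = refl
  D-mulθ : D (mulθ p) ≐ mulθ (D p) ⊕ mulσ (mulφ p)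
  D-mulθ a b c rewrite L-⊕ D-linear (mulX (mulX p)) (mulY (mulZ p)) a b c | D-XX a b c | D-YZ a b c
    | L-cong mulY-linear (L-⊕ mulX-linear (mulY p) (mulZ p)) a b c
    | L-cong mulZ-linear (L-⊕ mulX-linear (mulY p) (mulZ p)) a b c
    | L-⊕ mulY-linear (mulX (mulY p)) (mulX (mulZ p)) a b c
    | L-⊕ mulZ-linear (mulX (mulY p)) (mulX (mulZ p)) a b c
    | mulXY (mulZ p) a b c | L-cong mulY-linear (mulXZ p) a b c
    | sym (mulXZ (mulY p) a b c) | sym (L-cong mulX-linear (mulYZ p) a b c) | mulXY (mulZ p) a b c | L-cong mulY-linear (mulXZ p) a b c
    | sym (mulXZ (mulZ p) a b c) =
    eq (mulX (mulX (D p)) a b c) (mulY (mulZ (mulX p)) a b c) (mulY (mulZ (D p)) a b c) (mulY (mulX (mulY p)) a b c) (mulX (mulZ (mulZ p)) a b c)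
    where
    -- `v` is X Y Z p: the two copies produced by X² are the two cross terms of σ φ.
    eq : ∀ u v w x y → u + v + v + (w + x + y) ≡ u + w + (x + v + (v + y))
    eq = solve-∀

-- Powers of φ and θ under X D.

one : Poly
one = mono 0 0 0

-- M r s = φ^r θ^s
M : ℕ → ℕ → Poly
M zero    zero    = one
M zero    (suc s) = mulθ (M zero s)
M (suc r) s       = mulφ (M r s)

M-suc : ∀ r s → mulθ (M r s) ≐ M r (suc s)
M-suc zero    s a b c = refl
M-suc (suc r) s = ≐-trans (≐-sym (mulφ-θ (M r s))) (L-cong mulφ-linear (M-suc r s))

XD-one : XD one ≐ 0 • one
XD-one zero          b       c       = refl
XD-one (suc zero)    zero    c       = refl
XD-one (suc zero)    (suc b) zero    = refl
XD-one (suc zero)    (suc b) (suc c) = refl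
XD-one (suc (suc a)) b       c       = trans (XD-step one (suc (suc a)) b c)
  (cong₂ _+_ (trans (cong (suc (suc (a + 0)) *_) (zero-shift₂ b c)) (*-zeroʳ (suc (suc (a + 0)))))
    (cong₂ _+_ (trans (cong (suc b *_) (zero-Y c)) (*-zeroʳ (suc b))) (trans (cong (suc c *_) (zero-Z b)) (*-zeroʳ (suc c)))))
  where
  zero-shift₂ : ∀ b c → shift₂ (one (suc (suc a))) b c ≡ 0
  zero-shift₂ zero    c       = refl
  zero-shift₂ (suc b) zero    = refl
  zero-shift₂ (suc b) (suc c) = refl
  zero-Y : ∀ c → shift (one a (suc b)) c ≡ 0
  zero-Y zero    = refl
  zero-Y (suc c) = *-zeroʳ (δ 0 a)
  zero-Z : ∀ b → shift (λ b′ → one a b′ (suc c)) b ≡ 0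
  zero-Z zero    = refl
  zero-Z (suc b) = trans (cong (δ 0 a *_) (*-zeroʳ (δ 0 b))) (*-zeroʳ (δ 0 a))

-- The product rule with X D (φ) = φ θ and X D (θ) = φ². For r = 2p + 1 and s = n - 2p the factors r
-- and s are the numbers of neutral and of peak-creating places in `lpk-step`. At s = 0 the exponent
-- s ∸ 1 is a dummy with factor 0.
XD-M : ∀ r s → XD (M r s) ≐ r • M r (suc s) ⊕ s • M (suc (suc r)) (s ∸ 1)
XD-M zero    zero    = XD-one
XD-M zero    (suc s) = ≐-trans (XD-mulθ (M zero s)) (≐-trans
  (⊕-cong (≐-trans (L-cong mulθ-linear (XD-M zero s)) (≐-trans (L-• mulθ-linear s (M 2 (s ∸ 1))) (absorb s))) (λ _ _ _ → refl))
  λ a b c → +-comm (s * M 2 s a b c) (M 2 s a b c))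
  where
  absorb : ∀ s → s • mulθ (M 2 (s ∸ 1)) ≐ s • M 2 s
  absorb zero    a b c = refl
  absorb (suc s) = •-cong (suc s) (M-suc 2 s)
XD-M (suc r) s a b c = begin
  XD (mulφ (M r s)) a b c
    ≡⟨ XD-mulφ (M r s) a b c ⟩
  mulφ (XD (M r s)) a b c + mulφ (mulθ (M r s)) a b c
    ≡⟨ cong₂ _+_ (L-cong mulφ-linear (XD-M r s) a b c) (L-cong mulφ-linear (M-suc r s) a b c) ⟩
  mulφ (r • M r (suc s) ⊕ s • M (suc (suc r)) (s ∸ 1)) a b c + M (suc r) (suc s) a b c
    ≡⟨ cong (_+ M (suc r) (suc s) a b c) (trans (L-⊕ mulφ-linear (r • M r (suc s)) (s • M (suc (suc r)) (s ∸ 1)) a b c)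
         (cong₂ _+_ (L-• mulφ-linear r (M r (suc s)) a b c) (L-• mulφ-linear s (M (suc (suc r)) (s ∸ 1)) a b c))) ⟩
  r * M (suc r) (suc s) a b c + s * M (suc (suc (suc r))) (s ∸ 1) a b c + M (suc r) (suc s) a b c
    ≡⟨ eq r (M (suc r) (suc s) a b c) (s * M (suc (suc (suc r))) (s ∸ 1) a b c) ⟩
  suc r * M (suc r) (suc s) a b c + s * M (suc (suc (suc r))) (s ∸ 1) a b c ∎
  where
  open ≡-Reasoning
  eq : ∀ r x y → r * x + y + x ≡ suc r * x + y
  eq = solve-∀

XD^ : ℕ → Poly → Poly
XD^ zero    p = p
XD^ (suc n) p = XD (XD^ n p)

XD^-linear : ∀ n → Linear (XD^ n)
XD^-linear zero    = record { L-cong = id ; L-⊕ = λ _ _ _ _ _ → refl ; L-• = λ _ _ _ _ _ → refl }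
XD^-linear (suc n) = ∘-linear XD-linear (XD^-linear n)

XD^-mulX : ∀ n q → XD^ n (mulX q) ≐ mulX (DXpow n q)
XD^-mulX zero    q a b c = refl
XD^-mulX (suc n) q = L-cong XD-linear (XD^-mulX n q)

linear-sumOver : ∀ {L} → Linear L → (g : X → Poly) → ∀ ws →
  L (λ a b c → sumOver (λ w → g w a b c) ws) ≐ (λ a b c → sumOver (λ w → L (g w) a b c) ws)
-- The empty sum is `0 • one`, so compatibility with scalars gives its image.
linear-sumOver l g []       = L-• l 0 one
linear-sumOver l g (w ∷ ws) = ≐-trans (L-⊕ l (g w) (λ a b c → sumOver (λ w → g w a b c) ws))
  (⊕-cong (λ _ _ _ → refl) (linear-sumOver l g ws))

XD-M-∸ : ∀ {n} r d → d ≤ n → XD (M r (n ∸ d)) ≐ r • M r (suc n ∸ d) ⊕ (n ∸ d) • M (suc (suc r)) (n ∸ suc d)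
XD-M-∸ {n} r d d≤n a b c = trans (XD-M r (n ∸ d) a b c)
  (cong₂ (λ s s′ → r * M r s a b c + (n ∸ d) * M (suc (suc r)) s′ a b c)
    (sym (+-∸-assoc 1 d≤n)) (trans (∸-+-assoc n d 1) (cong (n ∸_) (+-comm d 1))))

-- By `XD-M-∸` the summand of w goes to exactly what `lpk-step` assigns to w for f p = φ^(2p+1)
-- θ^(n+1-2p). The bound 2p ≤ n keeps the truncated exponents honest.
XD^-φ : ∀ n a b c → XD^ n (M 1 0) a b c ≡
  sumOver (λ w → M (suc (double (lpk w))) (n ∸ double (lpk w)) a b c) (perms n)
XD^-φ zero    a b c = sym (+-identityʳ _)
XD^-φ (suc n) a b c = begin
  XD (XD^ n (M 1 0)) a b c
    ≡⟨ L-cong XD-linear (XD^-φ n) a b c ⟩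
  XD (λ a b c → sumOver (λ w → M (suc (double (lpk w))) (n ∸ double (lpk w)) a b c) (perms n)) a b c
    ≡⟨ linear-sumOver XD-linear (λ w → M (suc (double (lpk w))) (n ∸ double (lpk w))) (perms n) a b c ⟩
  sumOver (λ w → XD (M (suc (double (lpk w))) (n ∸ double (lpk w))) a b c) (perms n)
    ≡⟨ sumOver-cong-∈ (perms n) (λ {w} w∈ → XD-M-∸ (suc (double (lpk w))) (double (lpk w)) (lpk-bound w∈) a b c) ⟩
  sumOver (λ w → suc (double (lpk w)) * f (lpk w) + (n ∸ double (lpk w)) * f (suc (lpk w))) (perms n)
    ≡⟨ sym (lpk-step n f) ⟩
  sumOver (λ w → f (lpk w)) (perms (suc n)) ∎
  where
  open ≡-Reasoning
  f : ℕ → ℕ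
  f p = M (suc (double p)) (suc n ∸ double p) a b c

-- The induction starts at exponent one: X D (θ) = φ² is the term of the single permutation of [1],
-- whereas θ itself lacks the required factor φ².
XD^-θ : ∀ n a b c → XD^ (suc n) (M 0 1) a b c ≡
  sumOver (λ w → M (suc (suc (double (ipk w)))) (n ∸ double (ipk w)) a b c) (perms (suc n))
XD^-θ zero    a b c = XD-M 0 1 a b c
XD^-θ (suc n) a b c = begin
  XD (XD^ (suc n) (M 0 1)) a b c
    ≡⟨ L-cong XD-linear (XD^-θ n) a b c ⟩
  XD (λ a b c → sumOver (λ w → M (suc (suc (double (ipk w)))) (n ∸ double (ipk w)) a b c) (perms (suc n))) a b c
    ≡⟨ linear-sumOver XD-linear (λ w → M (suc (suc (double (ipk w)))) (n ∸ double (ipk w))) (perms (suc n)) a b c ⟩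
  sumOver (λ w → XD (M (suc (suc (double (ipk w)))) (n ∸ double (ipk w))) a b c) (perms (suc n))
    ≡⟨ sumOver-cong-∈ (perms (suc n)) (λ {w} w∈ → XD-M-∸ (suc (suc (double (ipk w)))) (double (ipk w)) (ipk-bound w∈) a b c) ⟩
  sumOver (λ w → suc (suc (double (ipk w))) * f (ipk w) + (n ∸ double (ipk w)) * f (suc (ipk w))) (perms (suc n))
    ≡⟨ sym (ipk-step n f) ⟩
  sumOver (λ w → f (ipk w)) (perms (suc (suc n))) ∎
  where
  open ≡-Reasoning
  f : ℕ → ℕ
  f p = M (suc (suc (double p))) (suc n ∸ double p) a b c

-- At Y = 0, φ = X Z and θ = X².
M-Y⁰ : ∀ r s a c → M r s a 0 c ≡ mono (r + double s) 0 r a 0 c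
M-Y⁰ zero    zero    a             c       = refl
M-Y⁰ zero    (suc s) zero          c       = refl
M-Y⁰ zero    (suc s) (suc zero)    c       = refl
M-Y⁰ zero    (suc s) (suc (suc a)) c       = trans (+-identityʳ _) (M-Y⁰ zero s a c)
M-Y⁰ (suc r) s       zero          c       = refl
M-Y⁰ (suc r) s       (suc a)       zero    = sym (*-zeroʳ (δ (r + double s) a))
M-Y⁰ (suc r) s       (suc a)       (suc c) = M-Y⁰ r s a c

-- Monomials free of Y: parity and extraction of the peak numbers.

XD^-YParity : ∀ {e p} n → YParity e p → YParity (parity n xor e) (XD^ n p)
XD^-YParity zero    par = par
XD^-YParity {e} {p} (suc n) par a b c odd = trans (XD-step (XD^ n p) a b c)
  (step-YParity 0 (XD^-YParity n par) a b c (trans (not-distribˡ-xor (parity n) e) odd))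

-- The exponent N is odd, so the image of X Z has only odd powers of Y. At Y^0 the image of X Y = X
-- · `varY` is therefore all of (X D)^N (φ); `suc a` accounts for the outer X.
DXpow-varY-Y⁰ : ∀ n a c → DXpow (suc (double n)) varY a 0 c ≡
  sumOver (λ w → M (suc (double (lpk w))) (suc (double n) ∸ double (lpk w)) (suc a) 0 c) (perms (suc (double n)))
DXpow-varY-Y⁰ n a c = begin
  mulX (DXpow N varY) (suc a) 0 c
    ≡⟨ sym (XD^-mulX N varY (suc a) 0 c) ⟩
  XD^ N (mulX varY) (suc a) 0 c
    ≡⟨ sym (+-identityʳ _) ⟩
  XD^ N (mulX varY) (suc a) 0 c + 0
    ≡⟨ cong (XD^ N (mulX varY) (suc a) 0 c +_) (sym (XD^-YParity N XZ-parity (suc a) 0 c odd-N)) ⟩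
  XD^ N (mulX varY) (suc a) 0 c + XD^ N (mulX (mulZ one)) (suc a) 0 c
    ≡⟨ sym (L-⊕ (XD^-linear N) (mulX varY) (mulX (mulZ one)) (suc a) 0 c) ⟩
  XD^ N (mulX varY ⊕ mulX (mulZ one)) (suc a) 0 c
    ≡⟨ L-cong (XD^-linear N) (≐-sym φ≐) (suc a) 0 c ⟩
  XD^ N (M 1 0) (suc a) 0 c
    ≡⟨ XD^-φ N (suc a) 0 c ⟩
  _ ∎
  where
  open ≡-Reasoning
  N = suc (double n)
  mulY-one : mulY one ≐ varY
  mulY-one a zero    c = sym (trans (varY-mono a 0 c) (*-zeroʳ (δ 0 a)))
  mulY-one a (suc b) c = sym (varY-mono a (suc b) c)
  φ≐ : M 1 0 ≐ mulX varY ⊕ mulX (mulZ one)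
  φ≐ = ≐-trans (L-⊕ mulX-linear (mulY one) (mulZ one)) (⊕-cong (L-cong mulX-linear mulY-one) (λ _ _ _ → refl))
  XZ-parity : YParity false (mulX (mulZ one))
  XZ-parity zero          b       c       odd = refl
  XZ-parity (suc a)       b       zero    odd = refl
  XZ-parity (suc a)       (suc b) (suc c) odd = *-zeroʳ (δ 0 a)
  odd-N : not (parity (double n)) xor false ≡ true
  odd-N = cong (λ e → not e xor false) (parity-double₀ n)

-- Here N is even, so the image of Y Z keeps odd powers of Y and disappears at Y^0, leaving that of
-- X².
DXpow-varX-Y⁰ : ∀ n a c → DXpow (double (suc n)) varX a 0 c ≡
  sumOver (λ w → M (suc (suc (double (ipk w)))) (suc (double n) ∸ double (ipk w)) (suc a) 0 c) (perms (double (suc n)))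
DXpow-varX-Y⁰ n a c = begin
  mulX (DXpow N varX) (suc a) 0 c
    ≡⟨ sym (XD^-mulX N varX (suc a) 0 c) ⟩
  XD^ N (mulX varX) (suc a) 0 c
    ≡⟨ sym (+-identityʳ _) ⟩
  XD^ N (mulX varX) (suc a) 0 c + 0
    ≡⟨ cong (XD^ N (mulX varX) (suc a) 0 c +_) (sym (XD^-YParity N YZ-parity (suc a) 0 c even-N)) ⟩
  XD^ N (mulX varX) (suc a) 0 c + XD^ N (mulY (mulZ one)) (suc a) 0 c
    ≡⟨ sym (L-⊕ (XD^-linear N) (mulX varX) (mulY (mulZ one)) (suc a) 0 c) ⟩
  XD^ N (mulX varX ⊕ mulY (mulZ one)) (suc a) 0 c
    ≡⟨ L-cong (XD^-linear N) (⊕-cong (L-cong mulX-linear (≐-sym mulX-one)) (λ _ _ _ → refl)) (suc a) 0 c ⟩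
  XD^ N (M 0 1) (suc a) 0 c
    ≡⟨ XD^-θ (suc (double n)) (suc a) 0 c ⟩
  _ ∎
  where
  open ≡-Reasoning
  N = double (suc n)
  mulX-one : mulX one ≐ varX
  mulX-one zero    b c = refl
  mulX-one (suc a) b c = sym (varX-mono (suc a) b c)
  YZ-parity : YParity true (mulY (mulZ one))
  YZ-parity a zero          c       odd = refl
  YZ-parity a (suc zero)    c       ()
  YZ-parity a (suc (suc b)) zero    odd = refl
  YZ-parity a (suc (suc b)) (suc c) odd = *-zeroʳ (δ 0 a)
  even-N : not (not (parity (double n))) xor true ≡ true
  even-N = cong (λ e → not (not e) xor true) (parity-double₀ n)

double-injective : ∀ {m n} → double m ≡ double n → m ≡ n
double-injective {zero}  {zero}  _  = refl
double-injective {suc m} {suc n} eq = cong suc (double-injective (suc-injective (suc-injective eq)))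

-- At Y = 0 the power of X in φ^(2k) θ^(N - 2k) is 2k + 2 (N - 2k) = 2 (N - k), that is, 2i.
double-split : ∀ {N} i k → i + k ≡ N → double k ≤ N → double k + double (N ∸ double k) ≡ double i
double-split {N} i k i+k≡N 2k≤N = trans (sym (double-+ k (N ∸ double k))) (cong double (+-cancelʳ-≡ k _ i (begin
  k + (N ∸ double k) + k ≡⟨ +-comm (k + (N ∸ double k)) k ⟩
  k + (k + (N ∸ double k)) ≡⟨ sym (+-assoc k k _) ⟩
  k + k + (N ∸ double k) ≡⟨ cong (_+ (N ∸ double k)) (sym (double≡+ k)) ⟩
  double k + (N ∸ double k) ≡⟨ m+[n∸m]≡n 2k≤N ⟩
  N ≡⟨ sym i+k≡N ⟩
  i + k ∎)))
  where open ≡-Reasoning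

-- e = 1 serves the left peaks and e = 2 the interior peaks.
M-Y⁰-δ : ∀ {N} e i k p → i + k ≡ N → double p ≤ N →
  M (e + double p) (N ∸ double p) (e + double i) 0 (e + double k) ≡ δ k p
M-Y⁰-δ {N} e i k p i+k≡N 2p≤N with p ≟ k
... | yes refl = trans (M-Y⁰ (e + double k) (N ∸ double k) (e + double i) (e + double k))
  (trans (cong (λ r → mono r 0 (e + double k) (e + double i) 0 (e + double k))
      (trans (+-assoc e (double k) _) (cong (e +_) (double-split i k i+k≡N 2p≤N))))
    (trans (mono-refl (e + double i) 0 (e + double k)) (sym (δ-refl k))))
... | no p≢k = trans (M-Y⁰ (e + double p) (N ∸ double p) (e + double i) (e + double k))
  (trans (mono-≢ {e + double p + double (N ∸ double p)} {0} (e + double i) 0 (e + double k) (inj₂ (inj₂ λ eq → p≢k (sym (double-injective (+-cancelˡ-≡ e _ _ eq))))))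
    (sym (δ-≢ p≢k)))

m≤double : ∀ m → m ≤ double m
m≤double m = subst (m ≤_) (sym (double≡+ m)) (m≤m+n m m)

double-complement : ∀ {N} i k → i + k ≡ N → double k + double i ≡ double N
double-complement i k refl = trans (sym (double-+ k i)) (cong double (+-comm k i))

d-coeff-Y⁰ : ∀ n k → let N = suc (double n) in atDiff (λ i → CoeffD.coeff N i 0) N k ≡ Ptnk N k
d-coeff-Y⁰ n k = trans (by-size (k ≤? N)) (sym (count≡sumOver (λ w → lpk w ≡ᵇ k) (perms N)))
  where
  N = suc (double n)
  by-size : Dec (k ≤ N) → atDiff (λ i → CoeffD.coeff N i 0) N k ≡ sumOver (λ w → δ k (lpk w)) (perms N)
  -- No index i = N - k exists, and 2 `lpk` ≤ N excludes permutations with k left peaks, so both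
  -- sides are 0.
  by-size (no k≰N) = trans (atDiff-> _ (≰⇒> k≰N)) (sym (trans (sumOver-cong-∈ (perms N) λ {w} w∈ →
    δ-≢ {k} {lpk w} λ { refl → k≰N (≤-trans (m≤double (lpk w)) (lpk-bound w∈)) }) (sumOver-0 (perms N))))
  by-size (yes k≤N) = begin
    atDiff (λ i → CoeffD.coeff N i 0) N k
      ≡⟨ atDiff-≤ (λ i → CoeffD.coeff N i 0) N k i i+k≡N ⟩
    CoeffD.coeff N i 0
      ≡⟨ cong₂ (λ a B → atDiff (DXpow N varY a 0) (double N + 1) B) (+-identityʳ (double i)) (+-identityʳ (double i)) ⟩
    atDiff (DXpow N varY (double i) 0) (double N + 1) (double i)
      ≡⟨ atDiff-≤ (DXpow N varY (double i) 0) (double N + 1) (double i) (suc (double k))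
           (trans (cong suc (double-complement i k i+k≡N)) (+-comm 1 (double N))) ⟩
    DXpow N varY (double i) 0 (suc (double k))
      ≡⟨ DXpow-varY-Y⁰ n (double i) (suc (double k)) ⟩
    _ ≡⟨ sumOver-cong-∈ (perms N) (λ {w} w∈ → M-Y⁰-δ 1 i k (lpk w) i+k≡N (lpk-bound w∈)) ⟩
    sumOver (λ w → δ k (lpk w)) (perms N) ∎
    where
    open ≡-Reasoning
    i = N ∸ k
    i+k≡N : i + k ≡ N
    i+k≡N = m∸n+n≡m k≤N

c-coeff-Y⁰ : ∀ n k → atDiff (λ i → CoeffC.coeff (double (suc n)) i 0) (suc (double n)) k ≡ Pnk (double (suc n)) k
c-coeff-Y⁰ n k = trans (by-size (k ≤? N)) (sym (count≡sumOver (λ w → ipk w ≡ᵇ k) (perms (suc N))))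
  where
  N = suc (double n)
  by-size : Dec (k ≤ N) → atDiff (λ i → CoeffC.coeff (suc N) i 0) N k ≡ sumOver (λ w → δ k (ipk w)) (perms (suc N))
  by-size (no k≰N) = trans (atDiff-> _ (≰⇒> k≰N)) (sym (trans (sumOver-cong-∈ (perms (suc N)) λ {w} w∈ →
    δ-≢ {k} {ipk w} λ { refl → k≰N (≤-trans (m≤double (ipk w)) (ipk-bound w∈)) }) (sumOver-0 (perms (suc N)))))
  by-size (yes k≤N) = begin
    atDiff (λ i → CoeffC.coeff (suc N) i 0) N k
      ≡⟨ atDiff-≤ (λ i → CoeffC.coeff (suc N) i 0) N k i i+k≡N ⟩
    CoeffC.coeff (suc N) i 0
      ≡⟨ cong₂ (λ a B → atDiff (DXpow (suc N) varX a 0) (double (suc N) + 0) B) (+-comm (double i) 1) (+-identityʳ (double i)) ⟩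
    atDiff (DXpow (suc N) varX (suc (double i)) 0) (double (suc N) + 0) (double i)
      ≡⟨ atDiff-≤ (DXpow (suc N) varX (suc (double i)) 0) (double (suc N) + 0) (double i) (suc (suc (double k)))
           (trans (cong (suc ∘ suc) (double-complement i k i+k≡N)) (sym (+-identityʳ _))) ⟩
    DXpow (suc N) varX (suc (double i)) 0 (suc (suc (double k)))
      ≡⟨ DXpow-varX-Y⁰ n (suc (double i)) (suc (suc (double k))) ⟩
    _ ≡⟨ sumOver-cong-∈ (perms (suc N)) (λ {w} w∈ → M-Y⁰-δ 2 i k (ipk w) i+k≡N (ipk-bound w∈)) ⟩
    sumOver (λ w → δ k (ipk w)) (perms (suc N)) ∎
    where
    open ≡-Reasoning
    i = N ∸ k
    i+k≡N : i + k ≡ N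
    i+k≡N = m∸n+n≡m k≤N

-- The nine identities

triangle-cong : ∀ {α α′ : ℕ → ℕ} {β β′ : ℕ → ℕ → ℕ} → (∀ k → α k ≡ α′ k) → (∀ n k → β n k ≡ β′ n k) →
  ∀ n k → triangle α β n k ≡ triangle α′ β′ n k
triangle-cong α≡ β≡ zero    zero    = refl
triangle-cong α≡ β≡ zero    (suc k) = refl
triangle-cong α≡ β≡ (suc n) zero    = cong₂ _*_ (α≡ 0) (triangle-cong α≡ β≡ n 0)
triangle-cong α≡ β≡ (suc n) (suc k) = cong₂ _+_
  (cong₂ _*_ (α≡ (suc k)) (triangle-cong α≡ β≡ n (suc k))) (cong₂ _*_ (β≡ n k) (triangle-cong α≡ β≡ n k))

triangle-> : ∀ {α β} n k → n < k → triangle α β n k ≡ 0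
triangle-> zero    (suc k) _         = refl
triangle-> {α} {β} (suc n) (suc k) (s≤s n<k) = cong₂ _+_
  (trans (cong (α (suc k) *_) (triangle-> n (suc k) (m<n⇒m<1+n n<k))) (*-zeroʳ (α (suc k))))
  (trans (cong (β n k *_) (triangle-> n k n<k)) (*-zeroʳ (β n k)))

sumTo-cong-< : ∀ N {f g} → (∀ k → k < N → f k ≡ g k) → sumTo N f ≡ sumTo N g
sumTo-cong-< zero    f≡g = refl
sumTo-cong-< (suc N) f≡g = cong₂ _+_ (sumTo-cong-< N λ k k<N → f≡g k (m<n⇒m<1+n k<N)) (f≡g N (n<1+n N))

-- The entry k of row n is passed on with weight α k to column k and β n k to column k + 1; the
-- boundary term at column n + 1 is 0.
sumTo-triangle : ∀ α β n → sumTo (suc (suc n)) (triangle α β (suc n)) ≡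
  sumTo (suc n) (λ k → (α k + β n k) * triangle α β n k)
sumTo-triangle α β n = begin
  sumTo (suc (suc n)) (triangle α β (suc n))
    ≡⟨ sumTo-first (suc n) (triangle α β (suc n)) ⟩
  α 0 * row 0 + sumTo (suc n) (λ k → α (suc k) * row (suc k) + β n k * row k)
    ≡⟨ cong (α 0 * row 0 +_) (sumTo-+ (suc n) (λ k → α (suc k) * row (suc k)) (λ k → β n k * row k)) ⟩
  α 0 * row 0 + (sumTo (suc n) (λ k → α (suc k) * row (suc k)) + sumTo (suc n) (λ k → β n k * row k))
    ≡⟨ sym (+-assoc (α 0 * row 0) _ _) ⟩
  α 0 * row 0 + sumTo (suc n) (λ k → α (suc k) * row (suc k)) + sumTo (suc n) (λ k → β n k * row k)
    ≡⟨ cong (_+ sumTo (suc n) (λ k → β n k * row k)) (trans (sym (sumTo-first (suc n) (λ k → α k * row k)))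
         (trans (cong (sumTo (suc n) (λ k → α k * row k) +_) (trans (cong (α (suc n) *_) (triangle-> n (suc n) (n<1+n n))) (*-zeroʳ (α (suc n))))) (+-identityʳ _))) ⟩
  sumTo (suc n) (λ k → α k * row k) + sumTo (suc n) (λ k → β n k * row k)
    ≡⟨ sym (sumTo-+ (suc n) (λ k → α k * row k) (λ k → β n k * row k)) ⟩
  sumTo (suc n) (λ k → α k * row k + β n k * row k)
    ≡⟨ sumTo-cong (suc n) (λ k → sym (*-distribʳ-+ (row k) (α k) (β n k))) ⟩
  sumTo (suc n) (λ k → (α k + β n k) * row k) ∎
  where
  open ≡-Reasoning
  row = triangle α β n

matchingTriangle : ℕ → ℕ → ℕ
matchingTriangle = triangle (λ k → suc (double k)) (λ n k → double n ∸ double k)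

double-mono-≤ : ∀ {m n} → m ≤ n → double m ≤ double n
double-mono-≤ z≤n       = z≤n
double-mono-≤ (s≤s m≤n) = s≤s (s≤s (double-mono-≤ m≤n))

-- The total weight (2k + 1) + (2n - 2k) = 2n + 1 does not depend on k. Truncation is harmless
-- because only k ≤ n are summed.
sumTo-matchingTriangle : ∀ n → sumTo (suc n) (matchingTriangle n) ≡ (double n ∸ 1) ‼
sumTo-matchingTriangle zero    = refl
sumTo-matchingTriangle (suc n) = begin
  sumTo (suc (suc n)) (matchingTriangle (suc n))
    ≡⟨ sumTo-triangle (λ k → suc (double k)) (λ n k → double n ∸ double k) n ⟩
  sumTo (suc n) (λ k → (suc (double k) + (double n ∸ double k)) * matchingTriangle n k)
    ≡⟨ sumTo-cong-< (suc n) (λ k k≤n → cong (λ x → suc x * matchingTriangle n k) (m+[n∸m]≡n (double-mono-≤ (≤-pred k≤n)))) ⟩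
  sumTo (suc n) (λ k → suc (double n) * matchingTriangle n k)
    ≡⟨ sumTo-* (suc n) (suc (double n)) (matchingTriangle n) ⟩
  suc (double n) * sumTo (suc n) (matchingTriangle n)
    ≡⟨ cong (suc (double n) *_) (sumTo-matchingTriangle n) ⟩
  suc (double n) * (double n ∸ 1) ‼
    ≡⟨ ‼-odd n ⟩
  suc (double n) ‼ ∎
  where
  open ≡-Reasoning
  ‼-odd : ∀ n → suc (double n) * (double n ∸ 1) ‼ ≡ suc (double n) ‼
  ‼-odd zero    = refl
  ‼-odd (suc n) = refl

atDiff-sumOver : ∀ (g : ℕ → X → ℕ) ws A B →
  atDiff (λ k → sumOver (g k) ws) A B ≡ sumOver (λ w → atDiff (λ k → g k w) A B) ws
atDiff-sumOver g []       A B = atDiff-0 A B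
atDiff-sumOver g (w ∷ ws) A B = trans (atDiff-+ (λ k → g k w) (λ k → sumOver (g k) ws) A B)
  (cong (atDiff (λ k → g k w) A B +_) (atDiff-sumOver g ws A B))

-- Reverses the statistic o to n - o, which turns N(n, n - i) into a count by odd closers.
atDiff-δ : ∀ n i {o} → o ≤ n → atDiff (λ k → δ k o) n i ≡ δ i (n ∸ o)
atDiff-δ n i {o} o≤n with (n ∸ o) ≟ i
... | yes refl = trans (atDiff-≤ (λ k → δ k o) n (n ∸ o) o (m+[n∸m]≡n o≤n)) (trans (δ-refl o) (sym (δ-refl (n ∸ o))))
... | no  ≢i   = trans (atDiff-cong n i λ k k+i≡n → δ-≢ {k} {o} λ { refl → ≢i (∸-remainder o i (sym k+i≡n)) })
  (trans (atDiff-0 n i) (sym (δ-≢ ≢i)))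

open import Data.Integer using (+_; _-_)

Nnk-triangle : ∀ n i → atZ (Nnk n) (+ n - + i) ≡ matchingTriangle n i
Nnk-triangle n i = begin
  atZ (Nnk n) (+ n - + i)
    ≡⟨ atZ-minus (Nnk n) n i ⟩
  atDiff (Nnk n) n i
    ≡⟨ atDiff-cong n i (λ k _ → trans (count≡sumOver (λ w → oddBlocks (2 * n) w ≡ᵇ k) (matchings n))
         (cong₂ (λ m ws → sumOver (λ w → δ k (oddBlocks m w)) ws) (sym (double≡2* n)) (matchings≡ n))) ⟩
  atDiff (λ k → sumOver (λ w → δ k (oddBlocks (double n) w)) (matchingWords (double n))) n i
    ≡⟨ atDiff-sumOver (λ k w → δ k (oddBlocks (double n) w)) (matchingWords (double n)) n i ⟩
  sumOver (λ w → atDiff (λ k → δ k (oddBlocks (double n) w)) n i) (matchingWords (double n))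
    ≡⟨ sumOver-cong-∈ (matchingWords (double n)) (λ w∈ → atDiff-δ n i (oddBlocks-bound n w∈)) ⟩
  sumOver (λ w → δ i (n ∸ oddBlocks (double n) w)) (matchingWords (double n))
    ≡⟨ IsTriangle.≡-triangle (count-isTriangle (λ n → matchingWords (double n)) (λ n w → n ∸ oddBlocks (double n) w)
         (λ f → +-identityʳ (f 0)) oddBlocks-step) n i ⟩
  matchingTriangle n i ∎
  where open ≡-Reasoning

a-α : ∀ k → double k + 1 + 0 ≡ suc (double k)
a-α k = trans (+-identityʳ _) (+-comm (double k) 1)

c-α : ∀ k → double k + 1 + 1 ≡ suc (suc (double k))
c-α k = trans (+-comm (double k + 1) 1) (cong suc (+-comm (double k) 1))

d-α : ∀ k → double k + 0 + 1 ≡ suc (double k)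
d-α k = trans (+-comm (double k + 0) 1) (cong suc (+-identityʳ (double k)))

a-rowSum-triangle : ∀ n i → sumTo (n + 1) (λ j → aCoef n i j) ≡ matchingTriangle n i
a-rowSum-triangle n i = trans (a-rowSum n i) (trans (IsTriangle.≡-triangle CoeffA.rowSum-isTriangle n i)
  (triangle-cong a-α (λ n k → cong (_∸ double k) (+-identityʳ (double n))) n i))

part-i : ∀ n → sumTo (n + 1) (λ i → sumTo (n + 1) (λ j → aCoef n i j)) ≡ (2 * n ∸ 1) ‼
part-i n = trans (sumTo-cong (n + 1) (a-rowSum-triangle n)) (trans (cong (λ N → sumTo N (matchingTriangle n)) (+-comm n 1))
  (trans (sumTo-matchingTriangle n) (cong (λ m → (m ∸ 1) ‼) (double≡2* n))))

part-ii : ∀ n i → sumTo (n + 1) (λ j → aCoef n i j) ≡ atZ (Nnk n) (+ n - + i)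
part-ii n i = trans (a-rowSum-triangle n i) (sym (Nnk-triangle n i))

part-iii-Y : ∀ n i → aCoef n i (half n) ≡ Ptnk n i
part-iii-Y n i = trans (a-topY n i) (trans (IsTriangle.≡-triangle CoeffA.topY-isTriangle n i)
  (trans (triangle-cong a-α (λ _ _ → refl) n i) (sym (Ptnk-triangle n i))))

part-iii-Z : ∀ n i → atZ (aCoef n i) (+ half n - + i) ≡ Ptnk n i
part-iii-Z n i = trans (a-topZ n i) (trans (IsTriangle.≡-triangle CoeffA.topZ-isTriangle n i)
  (trans (triangle-cong a-α (λ n k → cong (_∸ double k) (+-identityʳ n)) n i) (sym (Ptnk-triangle n i))))

part-iv : ∀ n i → sumTo (n + 1) (λ j → cCoef n i j) ≡ 2 ^ n * eulerian n i
part-iv n i = trans (c-rowSum n i) (trans (IsTriangle.≡-triangle CoeffC.rowSum-isTriangle n i)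
  (trans (triangle-cong c-α (λ n k → cong (_∸ double k) (+-identityʳ (double n))) n i) (sym (eulerian-triangle n i))))

part-v : ∀ n i → sumTo (n + 1) (λ j → dCoef n i j) ≡ Bnk n i
part-v n i = trans (d-rowSum n i) (trans (IsTriangle.≡-triangle CoeffD.rowSum-isTriangle n i)
  (trans (triangle-cong d-α (λ n k → cong (_∸ double k) (+-comm (double n) 1)) n i) (sym (Bnk-triangle n i))))

part-vi-Y : ∀ n i → cCoef n i (half n) ≡ Pnk (n + 1) i
part-vi-Y n i = trans (c-topY n i) (trans (IsTriangle.≡-triangle CoeffC.topY-isTriangle n i)
  (trans (triangle-cong c-α (λ _ _ → refl) n i) (trans (sym (Pnk-suc-triangle n i)) (cong (λ m → Pnk m i) (+-comm 1 n)))))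

part-vi-Z : ∀ n i → atZ (cCoef n i) (+ half n - + i) ≡ Pnk (n + 1) i
part-vi-Z n i = trans (c-topZ n i) (trans (IsTriangle.≡-triangle CoeffC.topZ-isTriangle n i)
  (trans (triangle-cong c-α (λ n k → cong (_∸ double k) (+-identityʳ n)) n i)
    (trans (sym (Pnk-suc-triangle n i)) (cong (λ m → Pnk m i) (+-comm 1 n)))))

part-viii-Y : ∀ n i → dCoef n i (halfUp n) ≡ Ptnk n i
part-viii-Y n i = trans (d-topY n i) (trans (IsTriangle.≡-triangle CoeffD.topY-isTriangle n i)
  (trans (triangle-cong d-α (λ _ _ → refl) n i) (sym (Ptnk-triangle n i))))

part-viii-Z : ∀ n i → atZ (dCoef n i) (+ halfUp n - + i) ≡ Ptnk (n + 1) i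
part-viii-Z n i = trans (d-topZ n i) (trans (IsTriangle.≡-triangle CoeffD.topZ-isTriangle n i)
  (trans (triangle-cong d-α (λ n k → cong (_∸ double k) (+-comm n 1)) n i)
    (trans (sym (Ptnk-suc-triangle n i)) (cong (λ m → Ptnk m i) (+-comm 1 n)))))

c-even : ∀ n i → cCoef (double n) i 0 ≡ CoeffC.coeff (double n) i 0
c-even n i = subst (λ m → cCoef m i 0 ≡ CoeffC.coeff m i 0) (+-identityʳ (double n)) (cCoef≡ n 0 0<2 i 0)

c-odd : ∀ n i → cCoef (suc (double n)) i 0 ≡ CoeffC.coeff (suc (double n)) i 1
c-odd n i = subst (λ m → cCoef m i 0 ≡ CoeffC.coeff m i 1) (+-comm (double n) 1) (cCoef≡ n 1 1<2 i 0)

d-even : ∀ n i → dCoef (double n) i 0 ≡ CoeffD.coeff (double n) i 1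
d-even n i = subst (λ m → dCoef m i 0 ≡ CoeffD.coeff m i 1) (+-identityʳ (double n)) (dCoef-even n i 0)

d-odd : ∀ n i → dCoef (suc (double n)) i 0 ≡ CoeffD.coeff (suc (double n)) i 0
d-odd n i = subst (λ m → dCoef m i 0 ≡ CoeffD.coeff m i 0) (+-comm (double n) 1) (dCoef-odd n i 0)

part-vii-even : ∀ n k → 1 ≤ n → atZ (λ i → cCoef (2 * n) i 0) (+ (2 * n ∸ 1) - + k) ≡ Pnk (2 * n) k
part-vii-even (suc n) k _ = subst (λ m → atZ (λ i → cCoef m i 0) (+ (m ∸ 1) - + k) ≡ Pnk m k) (double≡2* (suc n))
  (trans (atZ-minus (λ i → cCoef (double (suc n)) i 0) (suc (double n)) k)
    (trans (atDiff-cong (suc (double n)) k (λ i _ → c-even (suc n) i)) (c-coeff-Y⁰ n k)))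

part-vii-odd : ∀ n k → 1 ≤ n → atZ (λ i → cCoef (2 * n ∸ 1) i 0) (+ (2 * n ∸ 2) - + k) ≡ Pnk (2 * n) k
part-vii-odd (suc n) k _ = subst (λ m → atZ (λ i → cCoef (m ∸ 1) i 0) (+ (m ∸ 2) - + k) ≡ Pnk m k) (double≡2* (suc n)) (begin
  atZ (λ i → cCoef (suc (double n)) i 0) (+ double n - + k)
    ≡⟨ atZ-minus (λ i → cCoef (suc (double n)) i 0) (double n) k ⟩
  atDiff (λ i → cCoef (suc (double n)) i 0) (double n) k
    ≡⟨ atDiff-cong (double n) k (λ i _ → trans (c-odd n i) (CoeffC.coeff-one (suc (double n)) i)) ⟩
  atDiff (λ i → CoeffC.coeff (double (suc n)) (suc i) 0) (double n) k
    -- The shift of i reads the entry i = 0 when k is `suc (double n)`; `coeff-base` says that this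
    -- entry is 0.
    ≡⟨ atDiff-suc (λ i → CoeffC.coeff (double (suc n)) i 0) (CoeffC.coeff-base (suc (double n))) (double n) k ⟩
  atDiff (λ i → CoeffC.coeff (double (suc n)) i 0) (suc (double n)) k
    ≡⟨ c-coeff-Y⁰ n k ⟩
  Pnk (double (suc n)) k ∎)
  where open ≡-Reasoning

part-ix-odd : ∀ n k → atZ (λ i → dCoef (2 * n + 1) i 0) (+ (2 * n + 1) - + k) ≡ Ptnk (2 * n + 1) k
part-ix-odd n k = subst (λ m → atZ (λ i → dCoef m i 0) (+ m - + k) ≡ Ptnk m k)
  (trans (+-comm 1 (double n)) (cong (_+ 1) (double≡2* n)))
  (trans (atZ-minus (λ i → dCoef (suc (double n)) i 0) (suc (double n)) k)
    (trans (atDiff-cong (suc (double n)) k (λ i _ → d-odd n i)) (d-coeff-Y⁰ n k)))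

part-ix-even : ∀ n k → atZ (λ i → dCoef (2 * n) i 0) (+ (2 * n) - + k) ≡ Ptnk (2 * n + 1) k
part-ix-even n k = subst (λ m → atZ (λ i → dCoef m i 0) (+ m - + k) ≡ Ptnk (m + 1) k) (double≡2* n) (begin
  atZ (λ i → dCoef (double n) i 0) (+ double n - + k)
    ≡⟨ atZ-minus (λ i → dCoef (double n) i 0) (double n) k ⟩
  atDiff (λ i → dCoef (double n) i 0) (double n) k
    ≡⟨ atDiff-cong (double n) k (λ i _ → trans (d-even n i) (CoeffD.coeff-one (double n) i)) ⟩
  atDiff (λ i → CoeffD.coeff (suc (double n)) (suc i) 0) (double n) k
    ≡⟨ atDiff-suc (λ i → CoeffD.coeff (suc (double n)) i 0) (CoeffD.coeff-base (double n)) (double n) k ⟩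
  atDiff (λ i → CoeffD.coeff (suc (double n)) i 0) (suc (double n)) k
    ≡⟨ d-coeff-Y⁰ n k ⟩
  Ptnk (suc (double n)) k
    ≡⟨ cong (λ m → Ptnk m k) (+-comm 1 (double n)) ⟩
  Ptnk (double n + 1) k ∎)
  where open ≡-Reasoning

theorem4p1 : (n : ℕ) → 1 ≤ n →
    -- (i)
    (sumTo (n + 1) (λ i → sumTo (n + 1) (λ j → aCoef n i j)) ≡ (2 * n ∸ 1) ‼)
    -- (ii)
  × (∀ i → sumTo (n + 1) (λ j → aCoef n i j) ≡ atZ (Nnk n) (+ n - + i))
    -- (iii)
  × (∀ i → aCoef n i (half n) ≡ Ptnk n i)
  × (∀ i → atZ (aCoef n i) (+ half n - + i) ≡ Ptnk n i)
    -- (iv)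
  × (∀ i → sumTo (n + 1) (λ j → cCoef n i j) ≡ 2 ^ n * eulerian n i)
    -- (v)
  × (∀ i → sumTo (n + 1) (λ j → dCoef n i j) ≡ Bnk n i)
    -- (vi)
  × (∀ i → cCoef n i (half n) ≡ Pnk (n + 1) i)
  × (∀ i → atZ (cCoef n i) (+ half n - + i) ≡ Pnk (n + 1) i)
    -- (vii)
  × (∀ k → atZ (λ i → cCoef (2 * n ∸ 1) i 0) (+ (2 * n ∸ 2) - + k) ≡ Pnk (2 * n) k)
  × (∀ k → atZ (λ i → cCoef (2 * n) i 0) (+ (2 * n ∸ 1) - + k) ≡ Pnk (2 * n) k)
    -- (viii)
  × (∀ i → dCoef n i (halfUp n) ≡ Ptnk n i)
  × (∀ i → atZ (dCoef n i) (+ halfUp n - + i) ≡ Ptnk (n + 1) i)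
    -- (ix)
  × (∀ k → atZ (λ i → dCoef (2 * n) i 0) (+ (2 * n) - + k) ≡ Ptnk (2 * n + 1) k)
  × (∀ k → atZ (λ i → dCoef (2 * n + 1) i 0) (+ (2 * n + 1) - + k) ≡ Ptnk (2 * n + 1) k)
theorem4p1 n 1≤n =
    part-i n
  , part-ii n
  , part-iii-Y n
  , part-iii-Z n
  , part-iv n
  , part-v n
  , part-vi-Y n
  , part-vi-Z n
  , (λ k → part-vii-odd n k 1≤n)
  , (λ k → part-vii-even n k 1≤n)
  , part-viii-Y n
  , part-viii-Z n
  , part-ix-even n
  , part-ix-odd n
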